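{- There is a function $\mathsf{rep}$, computable in polynomial time, that, given a finite set $\Gamma$ of ground term equations and ground terms $p$ and $q$, outputs ground terms $\mathsf{rep}(p)$ and $\mathsf{rep}(q)$ such that (1) $p\sim_\Gamma \mathsf{rep}(p)$, and (2) $p\sim_\Gamma q$ if and only if $\mathsf{rep}(p)=\mathsf{rep}(q)$ (equality as terms).
   Context: $\Sigma$ is a finite functional signature having function symbols (of positive arity) and constant symbols. A ground term is a term built only from constants and function symbols of $\Sigma$; $\mathcal{F}$ is the algebra of all ground terms. A ground term equation is an expression $p=q$ with $p,q$ ground terms. For a finite set $\Gamma$ of ground term equations, $\sim_\Gamma$ is the congruence on $\mathcal{F}$ given by $p\sim_\Gamma q$ iff $\Gamma\vdash p=q$ (equivalently, the smallest congruence on $\mathcal{F}$ containing all pairs $(p,q)$ with $p=q$ in $\Gamma$). The size $|t|$ of a ground term $t$ is the number of nodes of its syntax tree, and $|\Gamma|=\sum_{(p=q)\in\Gamma}(|p|+|q|)$. Polynomial time means polynomial in $|\Gamma|$ and the sizes of the input terms. The value $\mathsf{rep}(t)$ depends on $\Gamma$ and $t$ only; $\Gamma$ is suppressed in the notation. -}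

module Defs where

open import Data.Fin using (Fin; zero)
open import Data.List using (List; []; _∷_; _++_; map; replicate; concatMap)
open import Data.List.Membership.Propositional using (_∈_)
open import Data.List.Relation.Unary.All using (All)
open import Data.Maybe as Maybe using (Maybe; just; nothing)
open import Data.Nat using (ℕ; suc; _+_; _*_; _^_; _≤_)
open import Data.Nat.ListAction using (sum)
open import Data.Product using (Σ-syntax; ∃; ∃-syntax; _×_; _,_)
open import Data.Vec as Vec using (Vec; []; _∷_)
open import Data.Vec.Relation.Binary.Pointwise.Inductive using (Pointwise)
open import Function using (_↔_; _↣_; Injection)
open import Relation.Binary.PropositionalEquality using (_≡_)

------------------------------------------------------------------------
-- Ground terms and equations

-- Constants are the symbols of arity 0.
record Signature : Set where
  field
    symbols : ℕ
    arity   : Fin symbols → ℕ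

module Ground (Sig : Signature) where
  open Signature Sig

  data Term : Set where
    node : (f : Fin symbols) → Vec Term (arity f) → Term

  infix 4 _≐_
  record Equation : Set where
    constructor _≐_
    field
      lhs rhs : Term

  infix 4 _⊢_∼_
  data _⊢_∼_ (Γ : List Equation) : Term → Term → Set where
    axiom : ∀ {p q} → (p ≐ q) ∈ Γ → Γ ⊢ p ∼ q
    refl  : ∀ {p} → Γ ⊢ p ∼ p
    sym   : ∀ {p q} → Γ ⊢ p ∼ q → Γ ⊢ q ∼ p
    trans : ∀ {p q r} → Γ ⊢ p ∼ q → Γ ⊢ q ∼ r → Γ ⊢ p ∼ r
    cong  : ∀ f {ps qs} → Pointwise (Γ ⊢_∼_) ps qs → Γ ⊢ node f ps ∼ node f qs

  mutual
    ∥_∥ : Term → ℕ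
    ∥ node f ts ∥ = suc ∥ ts ∥*

    ∥_∥* : ∀ {n} → Vec Term n → ℕ
    ∥ [] ∥*     = 0
    ∥ t ∷ ts ∥* = ∥ t ∥ + ∥ ts ∥*

  sizeEqs : List Equation → ℕ
  sizeEqs Γ = sum (map (λ (p ≐ q) → ∥ p ∥ + ∥ q ∥) Γ)

  -- Inputs and outputs as words: a term is written in Polish (prefix)
  -- notation, one letter per node; an equation p = q as "p equals q end".
  data Letter : Set where
    symbol     : Fin symbols → Letter
    equals end : Letter

  mutual
    encodeTerm : Term → List Letter
    encodeTerm (node f ts) = symbol f ∷ encodeTerms ts

    encodeTerms : ∀ {n} → Vec Term n → List Letter
    encodeTerms []       = []
    encodeTerms (t ∷ ts) = encodeTerm t ++ encodeTerms ts

  encodeEquation : Equation → List Letter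
  encodeEquation (p ≐ q) = encodeTerm p ++ equals ∷ encodeTerm q ++ end ∷ []

  encodeInput : List Equation × Term → List Letter
  encodeInput (Γ , t) = concatMap encodeEquation Γ ++ encodeTerm t

  sizeInput : List Equation × Term → ℕ
  sizeInput (Γ , t) = sizeEqs Γ + ∥ t ∥

------------------------------------------------------------------------
-- Deterministic multi-tape Turing machines

Finite : Set → Set
Finite A = ∃[ n ] (A ↔ Fin n)

data Move : Set where
  left stay right : Move

-- A two-way infinite tape over C with blank cells `nothing`. The lists are the
-- cells on either side of the head, nearest first; all cells beyond their
-- ends are blank.
record Tape (C : Set) : Set where
  constructor tape
  field
    before : List (Maybe C)
    head   : Maybe C
    after  : List (Maybe C)

module _ {C : Set} where

  move : Move → Tape C → Tape C
  move left  (tape []       h as)       = tape [] nothing (h ∷ as)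
  move left  (tape (b ∷ bs) h as)       = tape bs b (h ∷ as)
  move stay  t                          = t
  move right (tape bs       h [])       = tape (h ∷ bs) nothing []
  move right (tape bs       h (a ∷ as)) = tape (h ∷ bs) a as

  act : Maybe C × Move → Tape C → Tape C
  act (c , m) (tape bs _ as) = move m (tape bs c as)

  blank : Tape C
  blank = tape [] nothing []

  write : List C → Tape C
  write []       = blank
  write (c ∷ cs) = tape [] (just c) (map just cs)

  -- The tape holds the given word and nothing else, with the head on its
  -- first letter.
  Holds : Tape C → List C → Set
  Holds (tape bs h as) cs =
    All (_≡ nothing) bs × ∃[ n ] h ∷ as ≡ map just cs ++ replicate n nothing

-- Machines over the input alphabet I. Tape 0 is used for input and output;
-- the machine halts when δ yields `nothing`.
record TuringMachine (I : Set) : Set₁ where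
  field
    State   : Set
    TapeSym : Set
    finiteState   : Finite State
    finiteTapeSym : Finite TapeSym
    embed   : I ↣ TapeSym
    extraTapes : ℕ
    start   : State
    δ : State → Vec (Maybe TapeSym) (suc extraTapes) →
        Maybe (State × Vec (Maybe TapeSym × Move) (suc extraTapes))

  Config : Set
  Config = State × Vec (Tape TapeSym) (suc extraTapes)

  letters : List I → List TapeSym
  letters = map (Injection.to embed)

  initial : List I → Config
  initial w = start , write (letters w) ∷ Vec.replicate extraTapes blank

  step : Config → Maybe Config
  step (s , ts) = Maybe.map (λ (s′ , as) → s′ , Vec.zipWith act as ts)
                            (δ s (Vec.map Tape.head ts))

  infix 4 _⇓[_]_
  data _⇓[_]_ : Config → ℕ → Config → Set where
    halt : ∀ {c} → step c ≡ nothing → c ⇓[ 0 ] c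
    next : ∀ {c c′ d n} → step c ≡ just c′ → c′ ⇓[ n ] d → c ⇓[ suc n ] d

  Outputs : Config → List I → Set
  Outputs (_ , t ∷ _) w = Holds t (letters w)

-- f : A → B is computable in time polynomial in `size`, with respect to the
-- given encodings of A and B as words over I.
PolyTimeComputable : {A B I : Set} (size : A → ℕ)
                     (encA : A → List I) (encB : B → List I) → (A → B) → Set₁
PolyTimeComputable {I = I} size encA encB f =
  Σ[ M ∈ TuringMachine I ] let open TuringMachine M in
  ∃[ c ] ∃[ k ] ∀ a →
  ∃[ n ] ∃[ d ] (initial (encA a) ⇓[ n ] d)
              × (n ≤ c * size a ^ k + c)
              × Outputs d (encB (f a))

{-# OPTIONS --safe #-}
module Submission where

-- Every class that contains a subterm of Γ is named by one of these subterms.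
-- A table holds an entry f(s₁,…,sₙ) ≐ s for each subterm f(s₁,…,sₙ) of Γ; at
-- first every subterm names itself, except that the left side of an equation
-- is sent to the right side. Whenever two entries with the same key carry
-- different values, the lexicographically larger value is replaced by the
-- smaller one, as a value and as an argument of keys. Values only decrease and
-- remain subterms of Γ, so at most quadratically many replacements occur. In the
-- final table the value of a subterm is the least subterm of Γ congruent to it,
-- which depends on the set Γ alone, and rep is innermost evaluation by the
-- table, a term f(s₁,…,sₙ) without an entry being its own value.
--
-- In Polish notation terms form a prefix code, so names are recognised by
-- comparing letters and evaluation proceeds from the last letter of the term to
-- the first. Thus a few stacks suffice, and the blank cells of a tape let it
-- serve as a stack with the head on its top.

open import Defs
open import Algebra.Properties.CommutativeSemigroup using (interchange)
open import Data.Bool as Bool using (Bool; true; false; if_then_else_; _∧_; _∨_)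
open import Data.Bool.Properties using (∧-zeroʳ)
open import Data.Fin as Fin using (Fin; zero; suc; #_)
open import Data.Fin.Properties as Fin using ()
open import Data.List as List
  using (List; []; _∷_; _++_; [_]; _ʳ++_; map; length; foldl; filter; concatMap; replicate; reverse)
open import Data.List.Membership.Propositional using (_∈_)
open import Data.List.Membership.Propositional.Properties using (∈-++⁺ˡ; ∈-++⁺ʳ; ∈-++⁻; ∈-map⁺; ∈-map⁻)
open import Data.List.Properties as List
  using (∷-injective; ++-assoc; ++-identityʳ; ++-ʳ++; ʳ++-ʳ++; ʳ++-defn; length-++; length-map; map-∘)
open import Data.List.Relation.Binary.BagAndSetEquality using (_∼[_]_; set)
open import Data.List.Relation.Unary.All as All using (All; []; _∷_)
open import Data.List.Relation.Unary.All.Properties as All using ()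
open import Data.List.Relation.Unary.Any using (here; there)
open import Data.Maybe as Maybe using (Maybe; just; nothing; maybe; is-just; is-nothing)
open import Data.Maybe.Properties using (just-injective)
open import Data.Nat using (ℕ; zero; suc; _+_; _*_; _^_; _≤_; _<_; z≤n; s≤s; _⊔_; _⊓_; _<ᵇ_)
open import Data.Nat.ListAction using (sum)
open import Data.Nat.Properties as ℕ using ()
open import Data.Product using (Σ-syntax; ∃-syntax; _×_; _,_; proj₁; proj₂; map₁; uncurry)
open import Data.Sum as Sum using (_⊎_; inj₁; inj₂)
open import Data.Sum.Function.Propositional using (_⊎-cong_)
open import Data.Sum.Properties using (≡-dec; inj₁-injective)
open import Data.Unit using (⊤; tt)
open import Data.Vec as Vec using (Vec; []; _∷_; lookup; _[_]≔_)
open import Data.Vec.Properties as Vec using (lookup∘update; lookup∘update′; []≔-idempotent; lookup-map)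
open import Data.Vec.Relation.Binary.Pointwise.Inductive as Pw using (Pointwise; []; _∷_)
open import Data.Vec.Relation.Unary.All as VAll using ([]; _∷_) renaming (All to VAll)
open import Function using (_∘_; _⇔_; _↣_; Equivalence; Injection; const; id; mk⇔; mk↣; mk↔ₛ′)
open import Function.Construct.Composition using (_↔-∘_)
open import Function.Construct.Symmetry using (↔-sym)
open import Relation.Binary.Definitions using (Tri; tri<; tri≈; tri>)
open import Relation.Binary.PropositionalEquality as ≡ using (_≡_; _≢_; refl; subst; module ≡-Reasoning)
open import Relation.Nullary using (¬_; Dec; yes; no; contradiction; does)
open import Relation.Nullary.Decidable using (False; toWitnessFalse; dec-true; dec-false; _×-dec_)

-- Stack programs and their Turing machines

-- Identifying two classes can make the keys of two entries equal and so force further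
-- identifications; as names are replaced inside keys too, this propagation needs no rule of its
-- own. Conversely, once the table is single-valued, equality of evaluated terms is a congruence
-- that contains Γ, and completeness becomes an induction on derivations. The order on names is
-- lexicographic because a machine can decide it at the first differing letter. A smaller name may
-- be longer, however, so sizes are controlled differently: every name is a value of the initial
-- table and has at most `sizeEqs Γ` nodes, which keeps all intermediate tables of polynomial
-- length. For the running time it suffices that no loop of a stack program exceeds B rounds; the
-- bound on machine steps, a polynomial in B, then comes from the syntax of the program.

⊎-finite : {A B : Set} → Finite A → Finite B → Finite (A ⊎ B)
⊎-finite (m , f) (n , g) = m + n , ↔-sym Fin.+↔⊎ ↔-∘ (f ⊎-cong g)

⊤-finite : Finite ⊤
⊤-finite = 1 , ↔-sym Fin.1↔⊤

Bool-finite : Finite Bool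
Bool-finite = 2 , ↔-sym Fin.2↔Bool

-- Closure properties of polynomial bounds

module Polynomials where

  PolyBounded : (ℕ → ℕ) → Set
  PolyBounded f = ∃[ c ] ∃[ k ] ∀ n → f n ≤ c * n ^ k + c

  constᵖ : ∀ a → PolyBounded (λ _ → a)
  constᵖ a = a , 0 , λ n → ℕ.m≤n+m a (a * 1)

  idᵖ : PolyBounded (λ n → n)
  idᵖ = 1 , 1 , λ n → ℕ.≤-trans (ℕ.≤-reflexive (≡.sym (≡.trans (ℕ.*-identityˡ _) (ℕ.*-identityʳ n))))
      (ℕ.m≤m+n _ 1)

  private
    -- The summand 1 covers the base 0, where `0 ^ 0` exceeds `0 ^ l` for positive `l`.
    pow≤ : ∀ n {k l} → k ≤ l → n ^ k ≤ n ^ l + 1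
    pow≤ zero {zero} _ = ℕ.m≤n+m 1 _
    pow≤ zero {suc k} _ = z≤n
    pow≤ (suc n) k≤l = ℕ.≤-trans (ℕ.^-monoʳ-≤ (suc n) k≤l) (ℕ.m≤m+n _ 1)

    -- Bounds become multiples of `n ^ l + 1`, a form in which different degrees can be added and
    -- multiplied.
    raise : ∀ c k l n → k ≤ l → c * n ^ k + c ≤ (c + c) * (n ^ l + 1)
    raise c k l n k≤l = begin
      c * n ^ k + c            ≤⟨ ℕ.+-monoˡ-≤ c (ℕ.*-monoʳ-≤ c (pow≤ n k≤l)) ⟩
      c * (n ^ l + 1) + c      ≡⟨ ≡.cong (c * (n ^ l + 1) +_) (ℕ.*-identityʳ c) ⟨
      c * (n ^ l + 1) + c * 1  ≤⟨ ℕ.+-monoʳ-≤ (c * (n ^ l + 1)) (ℕ.*-monoʳ-≤ c (ℕ.m≤n+m 1 (n ^ l))) ⟩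
      c * (n ^ l + 1) + c * (n ^ l + 1) ≡⟨ ℕ.*-distribʳ-+ (n ^ l + 1) c c ⟨
      (c + c) * (n ^ l + 1) ∎
      where open ℕ.≤-Reasoning

    close : ∀ c n k → c * (n ^ k + 1) ≡ c * n ^ k + c
    close c n k = ≡.trans (ℕ.*-distribˡ-+ c (n ^ k) 1) (≡.cong (c * n ^ k +_) (ℕ.*-identityʳ c))

  _+ᵖ_ : {f g : ℕ → ℕ} → PolyBounded f → PolyBounded g → PolyBounded (λ n → f n + g n)
  _+ᵖ_ {f} {g} (c , k , f≤) (d , l , g≤) = e , k ⊔ l , λ n → begin
    f n + g n ≤⟨ ℕ.+-mono-≤ (ℕ.≤-trans (f≤ n) (raise c k (k ⊔ l) n (ℕ.m≤m⊔n k l)))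
                             (ℕ.≤-trans (g≤ n) (raise d l (k ⊔ l) n (ℕ.m≤n⊔m k l))) ⟩
    (c + c) * (n ^ (k ⊔ l) + 1) + (d + d) * (n ^ (k ⊔ l) + 1) ≡⟨ ℕ.*-distribʳ-+ (n ^ (k ⊔ l) + 1) (c + c)
        (d + d) ⟨
    e * (n ^ (k ⊔ l) + 1) ≡⟨ close e n (k ⊔ l) ⟩
    e * n ^ (k ⊔ l) + e ∎
    where
    open ℕ.≤-Reasoning
    e = (c + c) + (d + d)

  _*ᵖ_ : {f g : ℕ → ℕ} → PolyBounded f → PolyBounded g → PolyBounded (λ n → f n * g n)
  _*ᵖ_ {f} {g} (c , k , f≤) (d , l , g≤) = e , k + l , λ n → begin
    f n * g n ≤⟨ ℕ.*-mono-≤ (ℕ.≤-trans (f≤ n) (raise c k k n ℕ.≤-refl))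
        (ℕ.≤-trans (g≤ n) (raise d l l n ℕ.≤-refl)) ⟩
    (c + c) * (n ^ k + 1) * ((d + d) * (n ^ l + 1)) ≡⟨ ℕ.[m*n]*[o*p]≡[m*o]*[n*p] (c + c) (n ^ k + 1) (d + d)
        (n ^ l + 1) ⟩
    (c + c) * (d + d) * ((n ^ k + 1) * (n ^ l + 1)) ≤⟨ ℕ.*-monoʳ-≤ ((c + c) * (d + d)) (cross n) ⟩
    (c + c) * (d + d) * (4 * (n ^ (k + l) + 1)) ≡⟨ ℕ.*-assoc ((c + c) * (d + d)) 4 (n ^ (k + l) + 1) ⟨
    e * (n ^ (k + l) + 1) ≡⟨ close e n (k + l) ⟩
    e * n ^ (k + l) + e ∎
    where
    open ℕ.≤-Reasoning
    e = (c + c) * (d + d) * 4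

    -- Each of the four products in the expansion is at most `n ^ (k + l) + 1`.
    cross : ∀ n → (n ^ k + 1) * (n ^ l + 1) ≤ 4 * (n ^ (k + l) + 1)
    cross n = begin
      (n ^ k + 1) * (n ^ l + 1) ≡⟨ ℕ.*-distribʳ-+ (n ^ l + 1) (n ^ k) 1 ⟩
      n ^ k * (n ^ l + 1) + 1 * (n ^ l + 1) ≡⟨ ≡.cong₂ _+_ (ℕ.*-distribˡ-+ (n ^ k) (n ^ l) 1)
          (ℕ.*-identityˡ (n ^ l + 1)) ⟩
      n ^ k * n ^ l + n ^ k * 1 + (n ^ l + 1) ≡⟨ ≡.cong₂ (λ a b → a + b + (n ^ l + 1))
          (≡.sym (ℕ.^-distribˡ-+-* n k l)) (ℕ.*-identityʳ (n ^ k)) ⟩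
      P + n ^ k + (n ^ l + 1) ≤⟨ ℕ.+-mono-≤ (ℕ.+-mono-≤ (ℕ.m≤m+n P 1) (pow≤ n (ℕ.m≤m+n k l)))
                                             (ℕ.+-mono-≤ (pow≤ n (ℕ.m≤n+m l k)) (ℕ.m≤n+m 1 P)) ⟩
      Q + Q + (Q + Q) ≡⟨ ℕ.+-assoc Q Q (Q + Q) ⟩
      Q + (Q + (Q + Q)) ≡⟨ ≡.cong (λ x → Q + (Q + (Q + x))) (ℕ.+-identityʳ Q) ⟨
      4 * Q ∎
      where
      P = n ^ (k + l)
      Q = P + 1

-- Tapes as stacks

module _ {C : Set} where

  holds-head : (t : Tape C) {w : List C} → Holds t w → Tape.head t ≡ List.head w
  holds-head _ {[]} (_ , suc n , refl) = refl
  holds-head _ {x ∷ w} (_ , n , refl) = refl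

  holds-right : ∀ {bs as} {w : List C} n → All (_≡ nothing) bs → as ≡ map just w ++ replicate n nothing →
                Holds (act (nothing , right) (tape bs nothing as)) w
  holds-right {as = []} {[]} n bs eq = refl ∷ bs , 1 , refl
  holds-right {as = a ∷ as} n bs eq = refl ∷ bs , n , eq

  -- The cell is erased before the head leaves it, which keeps everything left of the head blank.
  holds-pop : (t : Tape C) {w : List C} → Holds t w → Holds (act (nothing , right) t) (List.drop 1 w)
  holds-pop (tape bs h as) {[]} (b , suc n , refl) = holds-right n b refl
  holds-pop (tape bs h as) {x ∷ w} (b , n , refl) = holds-right n b refl

  -- The head is already on the blank cell left of the top; if nothing is to be written it has to
  -- return.
  put : Maybe C → Maybe C × Move
  put (just a) = just a , stay
  put nothing  = nothing , right

  push : Maybe C → List C → List C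
  push (just a) w = a ∷ w
  push nothing  w = w

  holds-push : ∀ (t : Tape C) {w : List C} a → Holds t w →
               Holds (act (put a) (act (Tape.head t , left) t)) (push a w)
  holds-push (tape [] h as) (just a) (b , n , eq) = b , n , ≡.cong (just a ∷_) eq
  holds-push (tape [] h as) nothing (b , n , eq) = refl ∷ b , n , eq
  holds-push (tape (_ ∷ bs) h as) (just a) (_ ∷ b , n , eq) = b , n , ≡.cong (just a ∷_) eq
  holds-push (tape (_ ∷ bs) h as) nothing (_ ∷ b , n , eq) = refl ∷ b , n , eq

  holds-write : (w : List C) → Holds (write w) w
  holds-write [] = [] , 1 , refl
  holds-write (x ∷ w) = [] , 0 , ≡.cong (just x ∷_) (≡.sym (++-identityʳ (map just w)))

-- Stack commands, their semantics and their compilation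

module StackProgram (A : Set) (k : ℕ) where

  Store : Set
  Store = Vec (List A) k

  Tops : Set
  Tops = Vec (Maybe A) k

  tops : Store → Tops
  tops = Vec.map List.head

  infixr 5 _⨟_

  -- The stacks of `emit` must differ because the machine first moves the head of `j` off its top
  -- and reads `i` only afterwards. If the function answers `nothing`, nothing is pushed, so `emit`
  -- is a conditional push.
  data Cmd : Set where
    pop   : Fin k → Cmd
    emit  : (i j : Fin k) → {False (i Fin.≟ j)} → (Maybe A → Maybe A) → Cmd
    _⨟_   : Cmd → Cmd → Cmd
    cond  : (Tops → Bool) → Cmd → Cmd → Cmd
    while : (Tops → Bool) → Cmd → Cmd

  -- The parameter B bounds the number of iterations of every loop, including
  -- nested ones; it is what makes the running time of a derivation polynomial in B.
  infix 4 _⊢_∶_⇒_ _⊢_/_∶_⇒[_]_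
  mutual
    data _⊢_∶_⇒_ (B : ℕ) : Cmd → Store → Store → Set where
      pop : ∀ {i σ} → B ⊢ pop i ∶ σ ⇒ (σ [ i ]≔ List.drop 1 (lookup σ i))
      emit : ∀ {i j ne g σ} →
             B ⊢ emit i j {ne} g ∶ σ ⇒ (σ [ j ]≔ push (g (List.head (lookup σ i))) (lookup σ j))
      _⨟_ : ∀ {c d σ σ′ τ} → B ⊢ c ∶ σ ⇒ σ′ → B ⊢ d ∶ σ′ ⇒ τ → B ⊢ c ⨟ d ∶ σ ⇒ τ
      cond-true : ∀ {t c d σ τ} → t (tops σ) ≡ true → B ⊢ c ∶ σ ⇒ τ → B ⊢ cond t c d ∶ σ ⇒ τ
      cond-false : ∀ {t c d σ τ} → t (tops σ) ≡ false → B ⊢ d ∶ σ ⇒ τ → B ⊢ cond t c d ∶ σ ⇒ τ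
      loop : ∀ {t c n σ τ} → n ≤ B → B ⊢ t / c ∶ σ ⇒[ n ] τ → t (tops τ) ≡ false → B ⊢ while t c ∶ σ ⇒ τ

    data _⊢_/_∶_⇒[_]_ (B : ℕ) (t : Tops → Bool) (c : Cmd) : Store → ℕ → Store → Set where
      stop : ∀ {σ} → B ⊢ t / c ∶ σ ⇒[ 0 ] σ
      iter : ∀ {σ σ′ n τ} → t (tops σ) ≡ true → B ⊢ c ∶ σ ⇒ σ′ → B ⊢ t / c ∶ σ′ ⇒[ n ] τ →
             B ⊢ t / c ∶ σ ⇒[ suc n ] τ

  infixr 5 _⊹_
  _⊹_ : ∀ {B t c σ σ′ τ m n} → B ⊢ t / c ∶ σ ⇒[ m ] σ′ → B ⊢ t / c ∶ σ′ ⇒[ n ] τ → B ⊢ t / c ∶ σ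
      ⇒[ m + n ] τ
  stop ⊹ r = r
  iter t b l ⊹ r = iter t b (l ⊹ r)

  -- Both branches of `cond` are charged, and a loop pays for each test including the last, so that
  -- the cost depends on B but not on the contents of the stacks.
  cost : Cmd → ℕ → ℕ
  cost (pop _) B = 1
  cost (emit _ _ _) B = 2
  cost (c ⨟ d) B = cost c B + cost d B
  cost (cond _ c d) B = 1 + (cost c B + cost d B)
  cost (while _ c) B = 1 + B * (1 + cost c B)

  Tapes : Set
  Tapes = Vec (Tape A) k

  Acts : Set
  Acts = Vec (Maybe A × Move) k

  -- One control position per machine step: `emit` takes two, and `cond` and `while` add one for the
  -- test.
  St : Cmd → Set
  St (pop _) = ⊤
  St (emit _ _ _) = Bool
  St (c ⨟ d) = St c ⊎ St d
  St (cond _ c d) = ⊤ ⊎ (St c ⊎ St d)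
  St (while _ c) = ⊤ ⊎ St c

  St-finite : ∀ c → Finite (St c)
  St-finite (pop _) = ⊤-finite
  St-finite (emit _ _ _) = Bool-finite
  St-finite (c ⨟ d) = ⊎-finite (St-finite c) (St-finite d)
  St-finite (cond _ c d) = ⊎-finite ⊤-finite (⊎-finite (St-finite c) (St-finite d))
  St-finite (while _ c) = ⊎-finite ⊤-finite (St-finite c)

  entry : ∀ c → St c
  entry (pop _) = tt
  entry (emit _ _ _) = false
  entry (c ⨟ d) = inj₁ (entry c)
  entry (cond _ c d) = inj₁ tt
  entry (while _ c) = inj₁ tt

  idle : Tops → Acts
  idle = Vec.map (_, stay)

  -- `nothing` as the next state means that the command has finished.
  trans : ∀ c → St c → Tops → Maybe (St c) × Acts
  trans (pop i) tt h = nothing , idle h [ i ]≔ (nothing , right)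
  trans (emit i j g) false h = just true , idle h [ j ]≔ (lookup h j , left)
  trans (emit i j g) true h = nothing , idle h [ j ]≔ put (g (lookup h i))
  trans (c ⨟ d) (inj₁ s) h = map₁ (just ∘ maybe inj₁ (inj₂ (entry d))) (trans c s h)
  trans (c ⨟ d) (inj₂ s) h = map₁ (Maybe.map inj₂) (trans d s h)
  trans (cond t c d) (inj₁ tt) h = just (inj₂ (if t h then inj₁ (entry c) else inj₂ (entry d))) , idle h
  trans (cond t c d) (inj₂ (inj₁ s)) h = map₁ (Maybe.map (inj₂ ∘ inj₁)) (trans c s h)
  trans (cond t c d) (inj₂ (inj₂ s)) h = map₁ (Maybe.map (inj₂ ∘ inj₂)) (trans d s h)
  trans (while t c) (inj₁ tt) h = (if t h then just (inj₂ (entry c)) else nothing) , idle h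
  trans (while t c) (inj₂ s) h = map₁ (just ∘ maybe inj₂ (inj₁ tt)) (trans c s h)

  heads : Tapes → Tops
  heads = Vec.map Tape.head

  data Exec (c : Cmd) : St c → Tapes → ℕ → Tapes → Set where
    exit : ∀ {s ts as} → trans c s (heads ts) ≡ (nothing , as) → Exec c s ts 1 (Vec.zipWith act as ts)
    go   : ∀ {s s′ ts as n ts′} → trans c s (heads ts) ≡ (just s′ , as) →
           Exec c s′ (Vec.zipWith act as ts) n ts′ → Exec c s ts (suc n) ts′

  -- The last step of `c` enters `d` directly, so the step counts add up without overhead.
  Exec-⨟ : ∀ {c d s ts m ts′ n ts″} → Exec c s ts m ts′ → Exec d (entry d) ts′ n ts″ →
           Exec (c ⨟ d) (inj₁ s) ts (m + n) ts″
  Exec-⨟ (exit e) y = go (≡.cong (map₁ (just ∘ maybe inj₁ (inj₂ (entry _)))) e) (second y)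
    where
    second : ∀ {c d s ts n ts′} → Exec d s ts n ts′ → Exec (c ⨟ d) (inj₂ s) ts n ts′
    second (exit e) = exit (≡.cong (map₁ (Maybe.map inj₂)) e)
    second (go e r) = go (≡.cong (map₁ (Maybe.map inj₂)) e) (second r)
  Exec-⨟ (go e x) y = go (≡.cong (map₁ (just ∘ maybe inj₁ (inj₂ (entry _)))) e) (Exec-⨟ x y)

  Exec-yes : ∀ {t c d s ts n ts′} → Exec c s ts n ts′ → Exec (cond t c d) (inj₂ (inj₁ s)) ts n ts′
  Exec-yes (exit e) = exit (≡.cong (map₁ (Maybe.map (inj₂ ∘ inj₁))) e)
  Exec-yes (go e r) = go (≡.cong (map₁ (Maybe.map (inj₂ ∘ inj₁))) e) (Exec-yes r)

  Exec-no : ∀ {t c d s ts n ts′} → Exec d s ts n ts′ → Exec (cond t c d) (inj₂ (inj₂ s)) ts n ts′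
  Exec-no (exit e) = exit (≡.cong (map₁ (Maybe.map (inj₂ ∘ inj₂))) e)
  Exec-no (go e r) = go (≡.cong (map₁ (Maybe.map (inj₂ ∘ inj₂))) e) (Exec-no r)

  Exec-while : ∀ {t c s ts m ts′ n ts″} → Exec c s ts m ts′ → Exec (while t c) (inj₁ tt) ts′ n ts″ →
               Exec (while t c) (inj₂ s) ts (m + n) ts″
  Exec-while (exit e) y = go (≡.cong (map₁ (just ∘ maybe inj₂ (inj₁ tt))) e) y
  Exec-while (go e x) y = go (≡.cong (map₁ (just ∘ maybe inj₂ (inj₁ tt))) e) (Exec-while x y)

  Represents : Tapes → Store → Set
  Represents = Pointwise Holds

  act-idle : ∀ {n} (ts : Vec (Tape A) n) →
      Vec.zipWith act (Vec.map (_, stay) (Vec.map Tape.head ts)) ts ≡ ts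
  act-idle [] = refl
  act-idle (t ∷ ts) = ≡.cong (t ∷_) (act-idle ts)

  act-at : ∀ {n} (ts : Vec (Tape A) n) j {a} →
           Vec.zipWith act (Vec.map (_, stay) (Vec.map Tape.head ts) [ j ]≔ a) ts
               ≡ ts [ j ]≔ act a (lookup ts j)
  act-at (t ∷ ts) zero = ≡.cong (_ ∷_) (act-idle ts)
  act-at (t ∷ ts) (suc j) = ≡.cong (t ∷_) (act-at ts j)

  represents-update : ∀ {n} {ts : Vec (Tape A) n} {σ} j {t w} → Pointwise Holds ts σ → Holds t w →
                      Pointwise Holds (ts [ j ]≔ t) (σ [ j ]≔ w)
  represents-update zero (_ ∷ r) h = h ∷ r
  represents-update (suc j) (x ∷ r) h = x ∷ represents-update j r h

  heads-tops : ∀ {n} {ts : Vec (Tape A) n} {σ} → Pointwise Holds ts σ →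
      Vec.map Tape.head ts ≡ Vec.map List.head σ
  heads-tops [] = refl
  heads-tops {ts = t ∷ _} (h ∷ r) = ≡.cong₂ _∷_ (holds-head t h) (heads-tops r)

  private
    Result : Cmd → ℕ → Tapes → Store → Set
    Result c B ts τ = ∃[ n ] ∃[ ts′ ] Exec c (entry c) ts n ts′ × n ≤ cost c B × Represents ts′ τ

  emit-result : ∀ {i j ne g B ts σ} → Represents ts σ →
                Result (emit i j {ne} g) B ts (σ [ j ]≔ push (g (List.head (lookup σ i))) (lookup σ j))
  emit-result {i} {j} {ne} {g} {B} {ts} {σ} r =
    2 , _ , go refl (exit refl) , ℕ.≤-refl ,
    subst (λ x → Represents x (σ [ j ]≔ push (g (List.head (lookup σ i))) (lookup σ j))) (≡.sym final)
          (represents-update j r (holds-push (lookup ts j) _ (Pw.lookup r j)))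
    where
    i≢j : i ≢ j
    i≢j = toWitnessFalse ne

    t : Tape A
    t = act (Tape.head (lookup ts j) , left) (lookup ts j)

    ts₁ : Tapes
    ts₁ = Vec.zipWith act (idle (heads ts) [ j ]≔ (lookup (heads ts) j , left)) ts

    ts₁≡ : ts₁ ≡ ts [ j ]≔ t
    ts₁≡ = ≡.trans (act-at ts j) (≡.cong (λ h → ts [ j ]≔ act (h , left) (lookup ts j))
        (lookup-map j Tape.head ts))

    top-i : lookup (heads ts₁) i ≡ List.head (lookup σ i)
    top-i = begin
      lookup (heads ts₁) i               ≡⟨ ≡.cong (λ x → lookup (heads x) i) ts₁≡ ⟩
      lookup (heads (ts [ j ]≔ t)) i     ≡⟨ lookup-map i Tape.head (ts [ j ]≔ t) ⟩
      Tape.head (lookup (ts [ j ]≔ t) i) ≡⟨ ≡.cong Tape.head (lookup∘update′ i≢j ts t) ⟩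
      Tape.head (lookup ts i)            ≡⟨ holds-head (lookup ts i) (Pw.lookup r i) ⟩
      List.head (lookup σ i)             ∎
      where open ≡-Reasoning

    final : Vec.zipWith act (idle (heads ts₁) [ j ]≔ put (g (lookup (heads ts₁) i))) ts₁ ≡
            ts [ j ]≔ act (put (g (List.head (lookup σ i)))) t
    final = begin
      Vec.zipWith act (idle (heads ts₁) [ j ]≔ put (g (lookup (heads ts₁) i))) ts₁
        ≡⟨ act-at ts₁ j ⟩
      ts₁ [ j ]≔ act (put (g (lookup (heads ts₁) i))) (lookup ts₁ j)
        ≡⟨ ≡.cong₂ (λ x h → x [ j ]≔ act (put (g h)) (lookup x j)) ts₁≡ top-i ⟩
      (ts [ j ]≔ t) [ j ]≔ act (put (g (List.head (lookup σ i)))) (lookup (ts [ j ]≔ t) j)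
        ≡⟨ ≡.cong (λ x → (ts [ j ]≔ t) [ j ]≔ act (put (g (List.head (lookup σ i)))) x)
            (lookup∘update j ts t) ⟩
      (ts [ j ]≔ t) [ j ]≔ act (put (g (List.head (lookup σ i)))) t
        ≡⟨ []≔-idempotent ts j ⟩
      ts [ j ]≔ act (put (g (List.head (lookup σ i)))) t ∎
      where open ≡-Reasoning

  compile : ∀ {B c σ τ ts} → B ⊢ c ∶ σ ⇒ τ → Represents ts σ → Result c B ts τ
  compileLoop : ∀ {B t c σ n τ ts} → B ⊢ t / c ∶ σ ⇒[ n ] τ → t (tops τ) ≡ false → Represents ts σ →
                ∃[ m ] ∃[ ts′ ] Exec (while t c) (inj₁ tt) ts m ts′ × m ≤ 1 + n * (1 + cost c B) ×
                    Represents ts′ τ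

  compile {ts = ts} (pop {i}) r =
    1 , _ , exit refl , ℕ.≤-refl ,
    subst (λ x → Represents x _) (≡.sym (act-at ts i))
        (represents-update i r (holds-pop (lookup ts i) (Pw.lookup r i)))
  compile {B = B} (emit {ne = ne}) r = emit-result {ne = ne} {B = B} r
  compile (x ⨟ y) r with compile x r
  ... | m , _ , ex , m≤ , r′ with compile y r′
  ...   | n , _ , ey , n≤ , r″ = m + n , _ , Exec-⨟ ex ey , ℕ.+-mono-≤ m≤ n≤ , r″
  compile {ts = ts} (cond-true {t} {c} {d} t≡ x) r with compile x r
  ... | m , _ , ex , m≤ , r′ =
    suc m , _ ,
    go (≡.cong (λ b → just (inj₂ (if b then inj₁ (entry c) else inj₂ (entry d))) , idle (heads ts))
               (≡.trans (≡.cong t (heads-tops r)) t≡))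
       (subst (λ x → Exec (cond t c d) _ x m _) (≡.sym (act-idle ts)) (Exec-yes ex)) ,
    s≤s (ℕ.≤-trans m≤ (ℕ.m≤m+n _ _)) , r′
  compile {ts = ts} (cond-false {t} {c} {d} t≡ x) r with compile x r
  ... | m , _ , ex , m≤ , r′ =
    suc m , _ ,
    go (≡.cong (λ b → just (inj₂ (if b then inj₁ (entry c) else inj₂ (entry d))) , idle (heads ts))
               (≡.trans (≡.cong t (heads-tops r)) t≡))
       (subst (λ x → Exec (cond t c d) _ x m _) (≡.sym (act-idle ts)) (Exec-no ex)) ,
    s≤s (ℕ.≤-trans m≤ (ℕ.m≤n+m _ _)) , r′
  compile {B} (loop {c = c} {n} n≤ x t≡) r with compileLoop x t≡ r
  ... | m , ts′ , ex , m≤ , r′ = m , ts′ , ex , ℕ.≤-trans m≤ (s≤s (ℕ.*-monoˡ-≤ (1 + cost c B) n≤)) , r′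

  compileLoop {t = t} {c = c} {ts = ts} stop t≡ r =
    1 , ts ,
    subst (Exec (while t c) (inj₁ tt) ts 1) (act-idle ts)
          (exit (≡.cong (λ b → (if b then just (inj₂ (entry c)) else nothing) , idle (heads ts))
                        (≡.trans (≡.cong t (heads-tops r)) t≡))) ,
    ℕ.≤-refl , r
  compileLoop {B} {t = t} {c = c} {ts = ts} (iter {n = n} t≡ b x) f r with compile b r
  ... | m , _ , eb , m≤ , r′ with compileLoop x f r′
  ...   | l , ts″ , ex , l≤ , r″ =
    suc (m + l) , ts″ ,
    go (≡.cong (λ b → (if b then just (inj₂ (entry c)) else nothing) , idle (heads ts))
               (≡.trans (≡.cong t (heads-tops r)) t≡))
       (subst (λ x → Exec (while t c) (inj₂ (entry c)) x (m + l) ts″) (≡.sym (act-idle ts))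
           (Exec-while eb ex)) ,
    s≤s bound , r″
    where
    open ℕ.≤-Reasoning
    K = cost c B
    bound : m + l ≤ suc (K + n * suc K)
    bound = begin
      m + l                 ≤⟨ ℕ.+-mono-≤ m≤ l≤ ⟩
      K + suc (n * suc K)   ≡⟨ ℕ.+-suc K _ ⟩
      suc (K + n * suc K)   ∎

  module _ where
    open Polynomials

    cost-poly : ∀ c {B : ℕ → ℕ} → PolyBounded B → PolyBounded (cost c ∘ B)
    cost-poly (pop _) p = constᵖ 1
    cost-poly (emit _ _ _) p = constᵖ 2
    cost-poly (c ⨟ d) p = cost-poly c p +ᵖ cost-poly d p
    cost-poly (cond _ c d) p = constᵖ 1 +ᵖ (cost-poly c p +ᵖ cost-poly d p)
    cost-poly (while _ c) p = constᵖ 1 +ᵖ (p *ᵖ (constᵖ 1 +ᵖ cost-poly c p))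

-- From commands to polynomial-time computability

module Computation {I S : Set} (S-finite : Finite S) (ι : I ↣ S) (e : ℕ) where

  open StackProgram S (suc e)
  open Polynomials

  -- The added state `nothing` means that the command has finished; there `δ` is undefined.
  machine : Cmd → TuringMachine I
  machine c = record
    { State = Maybe (St c)
    ; TapeSym = S
    ; finiteState = Maybe-finite (St-finite c)
    ; finiteTapeSym = S-finite
    ; embed = ι
    ; extraTapes = e
    ; start = just (entry c)
    ; δ = λ { (just s) h → just (trans c s h) ; nothing h → nothing }
    }
    where
    Maybe-finite : {A : Set} → Finite A → Finite (Maybe A)
    Maybe-finite F with ⊎-finite ⊤-finite F
    ... | n , f = n , f ↔-∘ mk↔ₛ′ (maybe inj₂ (inj₁ tt)) (λ { (inj₁ tt) → nothing ; (inj₂ a) → just a })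
                    (λ { (inj₁ tt) → refl ; (inj₂ a) → refl }) (λ { (just a) → refl ; nothing → refl })

  halts : ∀ {c s ts n ts′} → Exec c s ts n ts′ → let open TuringMachine (machine c) in
          (just s , ts) ⇓[ n ] (nothing , ts′)
  halts (exit {s} {ts} e) = TuringMachine.next
      (≡.cong (λ x → just (proj₁ x , Vec.zipWith act (proj₂ x) ts)) e) (TuringMachine.halt refl)
  halts (go {ts = ts} e x) = TuringMachine.next
      (≡.cong (λ x → just (proj₁ x , Vec.zipWith act (proj₂ x) ts)) e) (halts x)

  private
    letters : List I → List S
    letters = map (Injection.to ι)

  computable : ∀ {X Y : Set} {size : X → ℕ} {encX : X → List I} {encY : Y → List I} {f : X → Y}
               (c : Cmd) {B : ℕ → ℕ} → PolyBounded B →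
               (∀ x → ∃[ σ ] B (size x) ⊢ c ∶ letters (encX x) ∷ Vec.replicate e []
                   ⇒ (letters (encY (f x)) ∷ σ)) →
               PolyTimeComputable size encX encY f
  computable {size = size} {encX} c p spec = machine c , a , b , λ x →
    let n , ts , ex , n≤ , r = compile (proj₂ (spec x)) (initially (letters (encX x))) in
    n , (nothing , ts) , halts ex , ℕ.≤-trans n≤ (≤poly (size x)) , output r
    where
    poly = cost-poly c p
    a = proj₁ poly
    b = proj₁ (proj₂ poly)
    ≤poly = proj₂ (proj₂ poly)

    initially : ∀ w → Represents (write w ∷ Vec.replicate e blank) (w ∷ Vec.replicate e [])
    initially w = holds-write w ∷ empties e
      where
      empties : ∀ n → Pointwise Holds (Vec.replicate n (blank {C = S})) (Vec.replicate n [])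
      empties zero = []
      empties (suc n) = holds-write [] ∷ empties n

    output : ∀ {ts v σ} → Represents ts (letters v ∷ σ) → TuringMachine.Outputs (machine c) (nothing , ts) v
    output (h ∷ _) = h

-- Ground congruence closure

module Closure (Sig : Signature) where

  open Signature Sig
  open Ground Sig renaming (refl to ∼-refl; sym to ∼-sym; trans to ∼-trans; cong to ∼-cong; equals to
      equalsᴸ; end to endᴸ)
  open Equation

  -- Polish notation as an ordered prefix code

  Sym : Set
  Sym = Fin symbols ⊎ Fin 3

  pattern sym f  = inj₁ f
  pattern equals = inj₂ zero
  pattern end    = inj₂ (suc zero)
  pattern bar    = inj₂ (suc (suc zero))

  code  : Term → List Sym
  codes : ∀ {n} → Vec Term n → List Sym
  code (node f ts) = sym f ∷ codes ts
  codes [] = []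
  codes (t ∷ ts) = code t ++ codes ts

  infix 4 _<ˢ_ _≺_ _≼_

  -- There is no rule for a proper prefix or for differing marks: the order serves codes of terms,
  -- and distinct ones first differ at two function symbols.
  data _<ˢ_ : List Sym → List Sym → Set where
    here  : ∀ {x y xs ys} → x Fin.< y → sym x ∷ xs <ˢ sym y ∷ ys
    there : ∀ {a xs ys} → xs <ˢ ys → a ∷ xs <ˢ a ∷ ys

  <ˢ-irrefl : ∀ {xs} → ¬ xs <ˢ xs
  <ˢ-irrefl (here x<x) = ℕ.<-irrefl refl x<x
  <ˢ-irrefl (there r) = <ˢ-irrefl r

  <ˢ-trans : ∀ {xs ys zs} → xs <ˢ ys → ys <ˢ zs → xs <ˢ zs
  <ˢ-trans (here p) (here q) = here (ℕ.<-trans p q)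
  <ˢ-trans (here p) (there q) = here p
  <ˢ-trans (there p) (here q) = here q
  <ˢ-trans (there p) (there q) = there (<ˢ-trans p q)

  <ˢ-++ : ∀ as {xs ys} → xs <ˢ ys → as ++ xs <ˢ as ++ ys
  <ˢ-++ [] r = r
  <ˢ-++ (a ∷ as) r = there (<ˢ-++ as r)

  -- Yields the position at which a letter-by-letter comparison by the machine stops.
  divergence : ∀ {xs ys} → xs <ˢ ys →
    ∃[ c ] ∃[ x ] ∃[ y ] ∃[ a ] ∃[ b ] xs ≡ c ++ sym x ∷ a × ys ≡ c ++ sym y ∷ b × x Fin.< y
  divergence (here {x} {y} {xs} {ys} x<y) = [] , x , y , xs , ys , refl , refl , x<y
  divergence (there {a} r) with divergence r
  ... | c , x , y , as , bs , refl , refl , x<y = a ∷ c , x , y , as , bs , refl , refl , x<y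

  _≺_ : Term → Term → Set
  p ≺ q = code p <ˢ code q

  _≼_ : Term → Term → Set
  p ≼ q = p ≡ q ⊎ p ≺ q

  ≺-asym : ∀ {p q} → p ≺ q → ¬ q ≺ p
  ≺-asym p≺q q≺p = <ˢ-irrefl (<ˢ-trans p≺q q≺p)

  ≼-trans : ∀ {p q r} → p ≼ q → q ≼ r → p ≼ r
  ≼-trans (inj₁ refl) r = r
  ≼-trans (inj₂ p) (inj₁ refl) = inj₂ p
  ≼-trans (inj₂ p) (inj₂ q) = inj₂ (<ˢ-trans p q)

  ≼-antisym : ∀ {p q} → p ≼ q → q ≼ p → p ≡ q
  ≼-antisym (inj₁ p≡q) _ = p≡q
  ≼-antisym (inj₂ _) (inj₁ q≡p) = ≡.sym q≡p
  ≼-antisym (inj₂ p≺q) (inj₂ q≺p) = contradiction q≺p (≺-asym p≺q)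

  private
    -- Polish notation is a prefix code, so that distinct terms already differ
    -- before either of them ends.
    Comparison : {A : Set} → (A → List Sym) → A → A → Set
    Comparison c p q = p ≡ q ⊎ (∀ {xs ys} → c p ++ xs <ˢ c q ++ ys) ⊎ (∀ {xs ys} → c q ++ xs <ˢ c p ++ ys)

    extend : ∀ as bs {xs ys} {cs ds : List Sym} →
             as ++ bs ++ xs <ˢ cs ++ ds ++ ys → (as ++ bs) ++ xs <ˢ (cs ++ ds) ++ ys
    extend as bs {xs} {ys} {cs} {ds} = ≡.subst₂ _<ˢ_ (≡.sym (++-assoc as bs xs)) (≡.sym (++-assoc cs ds ys))

    compareTerm  : ∀ p q → Comparison code p q
    compareTerms : ∀ {n} (ps qs : Vec Term n) → Comparison codes ps qs

    compareTerm (node f ps) (node g qs) with Fin.<-cmp f g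
    ... | tri< f<g _ _ = inj₂ (inj₁ (here f<g))
    ... | tri> _ _ g<f = inj₂ (inj₂ (here g<f))
    ... | tri≈ _ refl _ with compareTerms ps qs
    ...   | inj₁ refl = inj₁ refl
    ...   | inj₂ (inj₁ r) = inj₂ (inj₁ (there r))
    ...   | inj₂ (inj₂ r) = inj₂ (inj₂ (there r))

    compareTerms [] [] = inj₁ refl
    compareTerms (p ∷ ps) (q ∷ qs) with compareTerm p q
    ... | inj₂ (inj₁ r) = inj₂ (inj₁ (extend (code p) (codes ps) {cs = code q} r))
    ... | inj₂ (inj₂ r) = inj₂ (inj₂ (extend (code q) (codes qs) {cs = code p} r))
    ... | inj₁ refl with compareTerms ps qs
    ...   | inj₁ refl = inj₁ refl
    ...   | inj₂ (inj₁ r) = inj₂ (inj₁ (extend (code p) (codes ps) {cs = code p} (<ˢ-++ (code p) r)))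
    ...   | inj₂ (inj₂ r) = inj₂ (inj₂ (extend (code p) (codes qs) {cs = code p} (<ˢ-++ (code p) r)))

  ≺-compare : ∀ p q → Tri (p ≺ q) (p ≡ q) (q ≺ p)
  ≺-compare p q with compareTerm p q
  ... | inj₁ refl = tri≈ <ˢ-irrefl refl <ˢ-irrefl
  ... | inj₂ (inj₁ r) = let p≺q = ≡.subst₂ _<ˢ_ (++-identityʳ _) (++-identityʳ _) r in
        tri< p≺q (λ { refl → <ˢ-irrefl p≺q }) (≺-asym p≺q)
  ... | inj₂ (inj₂ r) = let q≺p = ≡.subst₂ _<ˢ_ (++-identityʳ _) (++-identityʳ _) r in
        tri> (≺-asym q≺p) (λ { refl → <ˢ-irrefl q≺p }) q≺p

  code-injective : ∀ {p q xs ys} → code p ++ xs ≡ code q ++ ys → p ≡ q × xs ≡ ys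
  code-injective {p} {q} {xs} {ys} eq with compareTerm p q
  ... | inj₁ refl = refl , List.++-cancelˡ (code p) xs ys eq
  ... | inj₂ (inj₁ r) = contradiction (subst (code p ++ xs <ˢ_) (≡.sym eq) r) <ˢ-irrefl
  ... | inj₂ (inj₂ r) = contradiction (subst (code q ++ ys <ˢ_) eq r) <ˢ-irrefl

  infix 4 _≟_ _≺?_

  _≟_ : (p q : Term) → Dec (p ≡ q)
  p ≟ q with ≺-compare p q
  ... | tri< _ p≢q _ = no p≢q
  ... | tri≈ _ p≡q _ = yes p≡q
  ... | tri> _ p≢q _ = no p≢q

  _≺?_ : (p q : Term) → Dec (p ≺ q)
  p ≺? q with ≺-compare p q
  ... | tri< p≺q _ _ = yes p≺q
  ... | tri≈ p⊀q _ _ = no p⊀q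
  ... | tri> p⊀q _ _ = no p⊀q

  -- Tables, merging and evaluation

  Table : Set
  Table = List Equation

  -- An entry f(s₁,…,sₙ) ≐ s stands for the fact that the operation f maps the
  -- classes named s₁,…,sₙ to the class named s.
  subterms  : Term → Table
  subterms* : ∀ {n} → Vec Term n → Table
  subterms (node f ts) = subterms* ts ++ [ node f ts ≐ node f ts ]
  subterms* [] = []
  subterms* (t ∷ ts) = subterms* ts ++ subterms t

  -- The left side gets no entry for itself here: its key carries `q` at once, so that the equation
  -- need not be imposed by a merge.
  entries : Equation → Table
  entries (node f ps ≐ q) = subterms q ++ subterms* ps ++ [ node f ps ≐ q ]

  -- In the order in which the entries are found when the input is read from
  -- right to left.
  table : List Equation → Table
  table [] = []
  table (e ∷ Γ) = table Γ ++ entries e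

  mapArgs : (Term → Term) → Term → Term
  mapArgs ρ (node f ts) = node f (Vec.map ρ ts)

  rename : (Term → Term) → Equation → Equation
  rename ρ (k ≐ v) = mapArgs ρ k ≐ ρ v

  infix 6 _↦_
  _↦_ : Term → Term → Term → Term
  (m ↦ m′) t with t ≟ m
  ... | yes _ = m′
  ... | no  _ = t

  -- Directed, with the smaller value in the first entry, so that every merge found is a decrease.
  Conflict : Equation → Equation → Set
  Conflict e e′ = lhs e ≡ lhs e′ × rhs e ≺ rhs e′

  conflict? : ∀ e e′ → Dec (Conflict e e′)
  conflict? e e′ = (lhs e ≟ lhs e′) ×-dec (rhs e ≺? rhs e′)

  Merge : Set
  Merge = Maybe (Term × Term)

  -- The first conflict found is kept. The nested folds follow the two nested passes that the
  -- machine makes over the table.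
  probe : Equation → Merge → Equation → Merge
  probe e (just m) e′ = just m
  probe e nothing e′ with conflict? e e′
  ... | yes _ = just (rhs e′ , rhs e)
  ... | no  _ = nothing

  probeAll : Table → Merge → Equation → Merge
  probeAll T m e = foldl (probe e) m T

  search : Table → Merge
  search T = foldl (probeAll T) nothing T

  infix 4 _⟶[_]_
  -- The index counts merges and becomes the number of rounds of the saturation loop.
  data _⟶[_]_ (T : Table) : ℕ → Table → Set where
    done  : search T ≡ nothing → T ⟶[ 0 ] T
    merge : ∀ {m m′ n U} → search T ≡ just (m , m′) → map (rename (m ↦ m′)) T ⟶[ n ] U → T ⟶[ suc n ] U

  look : Table → Term → Term
  look [] k = k
  look (e ∷ T) k with lhs e ≟ k
  ... | yes _ = rhs e
  ... | no  _ = look T k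

  nf  : Table → Term → Term
  nfs : ∀ {n} → Table → Vec Term n → Vec Term n
  nf T (node f ts) = look T (node f (nfs T ts))
  nfs T [] = []
  nfs T (t ∷ ts) = nf T t ∷ nfs T ts

  module _ {X C : Set} {f : Maybe C → X → Maybe C} (f-just : ∀ c x → f (just c) x ≡ just c) where

    foldl-just : ∀ c xs → foldl f (just c) xs ≡ just c
    foldl-just c [] = refl
    foldl-just c (x ∷ xs) = ≡.trans (≡.cong (λ a → foldl f a xs) (f-just c x)) (foldl-just c xs)

    foldl-found : ∀ xs {c} → foldl f nothing xs ≡ just c → ∃[ x ] x ∈ xs × f nothing x ≡ just c
    foldl-found (x ∷ xs) eq with f nothing x in eqx
    ... | just d = x , here refl , ≡.trans eqx (≡.trans (≡.sym (foldl-just d xs)) eq)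
    ... | nothing with foldl-found xs eq
    ...   | y , y∈ , eqy = y , there y∈ , eqy

    foldl-none : ∀ xs → foldl f nothing xs ≡ nothing → ∀ {x} → x ∈ xs → f nothing x ≡ nothing
    foldl-none (x ∷ xs) eq x∈ with f nothing x in eqx
    ... | just d with () ← ≡.trans (≡.sym (foldl-just d xs)) eq
    foldl-none (x ∷ xs) eq (here refl) | nothing = eqx
    foldl-none (x ∷ xs) eq (there y∈) | nothing = foldl-none xs eq y∈

  probe-just : ∀ e m e′ → probe e (just m) e′ ≡ just m
  probe-just _ _ _ = refl

  probeAll-just : ∀ T m e → probeAll T (just m) e ≡ just m
  probeAll-just T m e = foldl-just (probe-just e) m T

  search-found : ∀ T {m m′} → search T ≡ just (m , m′) →
    ∃[ e ] ∃[ e′ ] e ∈ T × e′ ∈ T × Conflict e e′ × m ≡ rhs e′ × m′ ≡ rhs e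
  search-found T eq with foldl-found (probeAll-just T) T eq
  ... | e , e∈ , eq₁ with foldl-found (probe-just e) T eq₁
  ...   | e′ , e′∈ , eq₂ with conflict? e e′
  search-found T eq | e , e∈ , eq₁ | e′ , e′∈ , refl | yes c = e , e′ , e∈ , e′∈ , c , refl , refl

  Stable : Table → Set
  Stable T = ∀ {e e′} → e ∈ T → e′ ∈ T → lhs e ≡ lhs e′ → rhs e ≡ rhs e′

  search-none : ∀ T → search T ≡ nothing → ∀ {e e′} → e ∈ T → e′ ∈ T → ¬ Conflict e e′
  search-none T eq {e} {e′} e∈ e′∈ c with foldl-none (probe-just e) T (foldl-none (probeAll-just T) T eq e∈)
      e′∈
  ... | eq′ with conflict? e e′
  ...   | yes _ with () ← eq′
  search-none T eq {e} {e′} e∈ e′∈ c | eq′ | no ¬c = ¬c c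

  search-stable : ∀ T → search T ≡ nothing → Stable T
  search-stable T eq {e} {e′} e∈ e′∈ k≡ with ≺-compare (rhs e) (rhs e′)
  ... | tri≈ _ v≡ _ = v≡
  ... | tri< v≺ _ _ = contradiction (k≡ , v≺) (search-none T eq e∈ e′∈)
  ... | tri> _ _ v≻ = contradiction (≡.sym k≡ , v≻) (search-none T eq e′∈ e∈)

  ↦-elim : ∀ (P : Term → Set) {m m′} t → P t → P m′ → P ((m ↦ m′) t)
  ↦-elim P {m} t pt pm with t ≟ m
  ... | yes _ = pm
  ... | no  _ = pt

  ↦-hit : ∀ {m m′} → (m ↦ m′) m ≡ m′
  ↦-hit {m} with m ≟ m
  ... | yes _ = refl
  ... | no m≢m = contradiction refl m≢m

  ↦-≼ : ∀ {m m′} → m′ ≺ m → ∀ t → (m ↦ m′) t ≼ t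
  ↦-≼ {m} m′≺m t with t ≟ m
  ... | yes refl = inj₂ m′≺m
  ... | no _ = inj₁ refl

  -- The sum of the ranks of all values is the termination measure.
  module Rank (V : List Term) where

    below : List Term → Term → ℕ
    below xs v = length (filter (_≺? v) xs)

    below-mono : ∀ xs {u v} → u ≺ v → below xs u ≤ below xs v
    below-mono [] u≺v = z≤n
    below-mono (x ∷ xs) {u} {v} u≺v with x ≺? u | x ≺? v
    ... | yes _   | yes _ = s≤s (below-mono xs u≺v)
    ... | yes x≺u | no x⊀v = contradiction (<ˢ-trans x≺u u≺v) x⊀v
    ... | no _    | yes _ = ℕ.≤-trans (below-mono xs u≺v) (ℕ.n≤1+n _)
    ... | no _    | no _ = below-mono xs u≺v

    -- `u` itself is counted below `v` but not below `u`.
    below-strict : ∀ xs {u v} → u ∈ xs → u ≺ v → below xs u < below xs v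
    below-strict (x ∷ xs) {u} {v} (here refl) u≺v with u ≺? u | u ≺? v
    ... | yes u≺u | _ = contradiction u≺u <ˢ-irrefl
    ... | no _    | yes _ = s≤s (below-mono xs u≺v)
    ... | no _    | no u⊀v = contradiction u≺v u⊀v
    below-strict (x ∷ xs) {u} {v} (there u∈) u≺v with x ≺? u | x ≺? v
    ... | yes _   | yes _ = s≤s (below-strict xs u∈ u≺v)
    ... | yes x≺u | no x⊀v = contradiction (<ˢ-trans x≺u u≺v) x⊀v
    ... | no _    | yes _ = ℕ.≤-trans (below-strict xs u∈ u≺v) (ℕ.n≤1+n _)
    ... | no _    | no _ = below-strict xs u∈ u≺v

    rank : Term → ℕ
    rank = below V

    rank≤ : ∀ v → rank v ≤ length V
    rank≤ v = List.length-filter (_≺? v) V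

    measure : Table → ℕ
    measure T = sum (map (rank ∘ rhs) T)

    measure≤ : ∀ T → measure T ≤ length T * length V
    measure≤ [] = z≤n
    measure≤ (e ∷ T) = ℕ.+-mono-≤ (rank≤ (rhs e)) (measure≤ T)

    module _ {m m′} (m′∈ : m′ ∈ V) (m′≺m : m′ ≺ m) where

      rank-↦ : ∀ t → rank ((m ↦ m′) t) ≤ rank t
      rank-↦ t with t ≟ m
      ... | yes refl = below-mono V m′≺m
      ... | no _ = ℕ.≤-refl

      measure-mono : ∀ T → measure (map (rename (m ↦ m′)) T) ≤ measure T
      measure-mono [] = z≤n
      measure-mono (e ∷ T) = ℕ.+-mono-≤ (rank-↦ (rhs e)) (measure-mono T)

      measure-strict : ∀ T {e} → e ∈ T → rhs e ≡ m → measure (map (rename (m ↦ m′)) T) < measure T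
      measure-strict (e ∷ T) (here refl) refl =
        ℕ.+-mono-<-≤ (subst (λ x → rank x < rank m) (≡.sym (↦-hit {m} {m′})) (below-strict V m′∈ m′≺m))
            (measure-mono T)
      measure-strict (e ∷ T) (there e∈) eq = ℕ.+-mono-≤-< (rank-↦ (rhs e)) (measure-strict T e∈ eq)

    -- Induction on a bound `n` for the measure. The values stay in `V` because a merge only inserts
    -- another value of the table.
    saturates : ∀ n T → measure T ≤ n → All ((_∈ V) ∘ rhs) T → ∃[ U ] ∃[ k ] k ≤ n × T ⟶[ k ] U
    saturates n T T≤n T⊆V with search T in eq
    ... | nothing = T , 0 , z≤n , done eq
    ... | just (m , m′) with search-found T eq
    ...   | e , e′ , e∈ , e′∈ , (_ , v≺v′) , refl , refl
            with measure-strict (All.lookup T⊆V e∈) v≺v′ T e′∈ refl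
    saturates zero T T≤n T⊆V | just (m , m′) | e , e′ , e∈ , e′∈ , (_ , v≺v′) , refl , refl | lt
      with () ← ℕ.<-≤-trans lt T≤n
    saturates (suc n) T T≤n T⊆V | just (m , m′) | e , e′ , e∈ , e′∈ , (_ , v≺v′) , refl , refl | lt
      with saturates n (map (rename (m ↦ m′)) T) (ℕ.≤-pred (ℕ.<-≤-trans lt T≤n))
             (All.map⁺ (All.map (λ {x} v∈ → ↦-elim (_∈ V) (rhs x) v∈ (All.lookup T⊆V e∈)) T⊆V))
    ... | U , k , k≤n , r = U , suc k , s≤s k≤n , merge eq r

  saturate : ∀ T → ∃[ U ] ∃[ n ] n ≤ length T * length T × T ⟶[ n ] U
  saturate T with Rank.saturates V (Rank.measure V T) T ℕ.≤-refl (All.tabulate (∈-map⁺ rhs))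
    where V = map rhs T
  ... | U , n , n≤ , r = U , n , ℕ.≤-trans n≤ (ℕ.≤-trans (Rank.measure≤ (map rhs T) T)
                           (ℕ.≤-reflexive (≡.cong (length T *_) (length-map rhs T)))) , r

  saturated : List Equation → Table
  saturated Γ = proj₁ (saturate (table Γ))

  rep : List Equation → Term → Term
  rep Γ = nf (saturated Γ)

  look-view : ∀ T k → (∃[ e ] e ∈ T × lhs e ≡ k × look T k ≡ rhs e) ⊎
      (look T k ≡ k × (∀ {e} → e ∈ T → lhs e ≢ k))
  look-view [] k = inj₂ (refl , λ ())
  look-view (e ∷ T) k with lhs e ≟ k
  ... | yes k≡ = inj₁ (e , here refl , k≡ , refl)
  ... | no k≢ with look-view T k
  ...   | inj₁ (e′ , e′∈ , k≡ , eq) = inj₁ (e′ , there e′∈ , k≡ , eq)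
  ...   | inj₂ (eq , none) = inj₂ (eq , λ { (here refl) → k≢ ; (there e∈) → none e∈ })

  look-stable : ∀ {T e} → Stable T → e ∈ T → look T (lhs e) ≡ rhs e
  look-stable {T} {e} st e∈ with look-view T (lhs e)
  ... | inj₁ (e′ , e′∈ , k≡ , eq) = ≡.trans eq (st e′∈ e∈ k≡)
  ... | inj₂ (_ , none) = contradiction refl (none e∈)

  -- Closure and soundness of the initial table

  args : (P : Term → Set) → Term → Set
  args P (node f ts) = VAll P ts

  Self : Table → Term → Set
  Self T t = (t ≐ t) ∈ T

  -- The second table allows a proof piece by piece along `++`, since the required self-entries may
  -- lie in another piece.
  record Closed (T U : Table) : Set where
    field
      closed-lhs : ∀ {e} → e ∈ T → args (Self U) (lhs e)
      closed-rhs : ∀ {e} → e ∈ T → Self U (rhs e)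
  open Closed

  args-map : ∀ {P Q : Term → Set} → (∀ {t} → P t → Q t) → ∀ t → args P t → args Q t
  args-map f (node _ ts) = VAll.map f

  Closed-weaken : ∀ {T U W} → (∀ {e} → e ∈ U → e ∈ W) → Closed T U → Closed T W
  Closed-weaken f c .closed-lhs {e} e∈ = args-map f (lhs e) (c .closed-lhs e∈)
  Closed-weaken f c .closed-rhs e∈ = f (c .closed-rhs e∈)

  Closed-++ : ∀ {T T′ U} → Closed T U → Closed T′ U → Closed (T ++ T′) U
  Closed-++ {T} c d .closed-lhs e∈ = Sum.[ c .closed-lhs , d .closed-lhs ] (∈-++⁻ T e∈)
  Closed-++ {T} c d .closed-rhs e∈ = Sum.[ c .closed-rhs , d .closed-rhs ] (∈-++⁻ T e∈)

  Closed-[] : ∀ {U} → Closed [] U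
  Closed-[] .closed-lhs ()
  Closed-[] .closed-rhs ()

  Closed-[-] : ∀ {e U} → args (Self U) (lhs e) → Self U (rhs e) → Closed [ e ] U
  Closed-[-] a s .closed-lhs (here refl) = a
  Closed-[-] a s .closed-rhs (here refl) = s

  subterms-self : ∀ t → Self (subterms t) t
  subterms-self (node f ts) = ∈-++⁺ʳ (subterms* ts) (here refl)

  subterms*-self : ∀ {n} (ts : Vec Term n) → VAll (Self (subterms* ts)) ts
  subterms*-self [] = []
  subterms*-self (t ∷ ts) = ∈-++⁺ʳ (subterms* ts) (subterms-self t) ∷ VAll.map ∈-++⁺ˡ (subterms*-self ts)

  subterms-closed  : ∀ t → Closed (subterms t) (subterms t)
  subterms*-closed : ∀ {n} (ts : Vec Term n) → Closed (subterms* ts) (subterms* ts)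
  subterms-closed (node f ts) =
    Closed-++ (Closed-weaken ∈-++⁺ˡ (subterms*-closed ts))
              (Closed-[-] (VAll.map ∈-++⁺ˡ (subterms*-self ts)) (subterms-self (node f ts)))
  subterms*-closed [] = Closed-[]
  subterms*-closed (t ∷ ts) =
    Closed-++ (Closed-weaken ∈-++⁺ˡ (subterms*-closed ts))
        (Closed-weaken (∈-++⁺ʳ (subterms* ts)) (subterms-closed t))

  entries-closed : ∀ e → Closed (entries e) (entries e)
  entries-closed (node f ps ≐ q) =
    Closed-++ (Closed-weaken ∈-++⁺ˡ (subterms-closed q))
      (Closed-++ (Closed-weaken (∈-++⁺ʳ (subterms q) ∘ ∈-++⁺ˡ) (subterms*-closed ps))
        (Closed-[-] (VAll.map (∈-++⁺ʳ (subterms q) ∘ ∈-++⁺ˡ) (subterms*-self ps))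
            (∈-++⁺ˡ (subterms-self q))))

  table-closed : ∀ Γ → Closed (table Γ) (table Γ)
  table-closed [] = Closed-[]
  table-closed (e ∷ Γ) =
    Closed-++ (Closed-weaken ∈-++⁺ˡ (table-closed Γ)) (Closed-weaken (∈-++⁺ʳ (table Γ)) (entries-closed e))

  entries-self : ∀ e → e ∈ entries e
  entries-self (node f ps ≐ q) = ∈-++⁺ʳ (subterms q) (∈-++⁺ʳ (subterms* ps) (here refl))

  table⁺ : ∀ {Γ e e′} → e ∈ Γ → e′ ∈ entries e → e′ ∈ table Γ
  table⁺ {_ ∷ Γ} (here refl) e′∈ = ∈-++⁺ʳ (table Γ) e′∈
  table⁺ (there e∈) e′∈ = ∈-++⁺ˡ (table⁺ e∈ e′∈)

  table⁻ : ∀ Γ {e′} → e′ ∈ table Γ → ∃[ e ] e ∈ Γ × e′ ∈ entries e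
  table⁻ (e ∷ Γ) e′∈ with ∈-++⁻ (table Γ) e′∈
  ... | inj₂ e′∈e = e , here refl , e′∈e
  ... | inj₁ e′∈Γ with table⁻ Γ e′∈Γ
  ...   | d , d∈ , e′∈d = d , there d∈ , e′∈d

  table-mono : ∀ {Γ Δ} → (∀ {e} → e ∈ Γ → e ∈ Δ) → ∀ {e} → e ∈ table Γ → e ∈ table Δ
  table-mono {Γ} Γ⊆Δ e∈ with table⁻ Γ e∈
  ... | d , d∈ , e∈d = table⁺ (Γ⊆Δ d∈) e∈d

  Sound : List Equation → Table → Set
  Sound Γ T = ∀ {e} → e ∈ T → Γ ⊢ lhs e ∼ rhs e

  subterms-reflexive  : ∀ t {e} → e ∈ subterms t → lhs e ≡ rhs e
  subterms*-reflexive : ∀ {n} (ts : Vec Term n) {e} → e ∈ subterms* ts → lhs e ≡ rhs e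
  subterms-reflexive (node f ts) e∈ with ∈-++⁻ (subterms* ts) e∈
  ... | inj₁ e∈ts = subterms*-reflexive ts e∈ts
  ... | inj₂ (here refl) = refl
  subterms*-reflexive (t ∷ ts) e∈ with ∈-++⁻ (subterms* ts) e∈
  ... | inj₁ e∈ts = subterms*-reflexive ts e∈ts
  ... | inj₂ e∈t = subterms-reflexive t e∈t

  ≡⇒∼ : ∀ {Γ p q} → p ≡ q → Γ ⊢ p ∼ q
  ≡⇒∼ refl = ∼-refl

  table-sound : ∀ Γ → Sound Γ (table Γ)
  table-sound Γ e∈ with table⁻ Γ e∈
  ... | (node f ps ≐ q) , d∈ , e∈d with ∈-++⁻ (subterms q) e∈d
  ...   | inj₁ e∈q = ≡⇒∼ (subterms-reflexive q e∈q)
  ...   | inj₂ e∈′ with ∈-++⁻ (subterms* ps) e∈′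
  ...     | inj₁ e∈ps = ≡⇒∼ (subterms*-reflexive ps e∈ps)
  ...     | inj₂ (here refl) = axiom d∈

  map-sound : ∀ {Γ ρ} → (∀ t → Γ ⊢ t ∼ ρ t) → ∀ {n} (ts : Vec Term n) → Pointwise (Γ ⊢_∼_) ts (Vec.map ρ ts)
  map-sound s [] = []
  map-sound s (t ∷ ts) = s t ∷ map-sound s ts

  mapArgs-sound : ∀ {Γ ρ} → (∀ t → Γ ⊢ t ∼ ρ t) → ∀ t → Γ ⊢ t ∼ mapArgs ρ t
  mapArgs-sound s (node f ts) = ∼-cong f (map-sound s ts)

  mapArgs-∘ : ∀ ρ π t → mapArgs ρ (mapArgs π t) ≡ mapArgs (ρ ∘ π) t
  mapArgs-∘ ρ π (node f ts) = ≡.cong (node f) (≡.sym (Vec.map-∘ ρ π ts))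

  mapArgs-id : ∀ t → mapArgs (λ x → x) t ≡ t
  mapArgs-id (node f ts) = ≡.cong (node f) (Vec.map-id ts)

  -- All merges of a run amount to a single map `ρ` on terms. In `ρ-values` the list `V` is
  -- arbitrary because the induction passes to a renamed table while `V` has to stay the same.
  record Renaming (Γ : List Equation) (T U : Table) : Set where
    field
      ρ        : Term → Term
      renamed  : U ≡ map (rename ρ) T
      sound    : Sound Γ U
      ρ-sound  : ∀ t → Γ ⊢ t ∼ ρ t
      ρ-≼      : ∀ t → ρ t ≼ t
      ρ-values : ∀ V → (∀ {e} → e ∈ T → rhs e ∈ V) → ∀ {t} → t ∈ V → ρ t ∈ V
      stable   : Stable U

  rename-sound : ∀ {Γ T ρ} → Sound Γ T → (∀ t → Γ ⊢ t ∼ ρ t) → Sound Γ (map (rename ρ) T)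
  rename-sound s r e∈ with ∈-map⁻ _ e∈
  ... | (k ≐ v) , e₀∈ , refl = ∼-trans (∼-sym (mapArgs-sound r k)) (∼-trans (s e₀∈) (r v))

  renames : ∀ {Γ T n U} → Sound Γ T → T ⟶[ n ] U → Renaming Γ T U
  renames {T = T} s (done eq) = record
    { ρ = λ t → t
    ; renamed = ≡.sym (≡.trans (List.map-cong (λ e → ≡.cong (_≐ rhs e) (mapArgs-id (lhs e))) T)
        (List.map-id T))
    ; sound = s
    ; ρ-sound = λ _ → ∼-refl
    ; ρ-≼ = λ _ → inj₁ refl
    ; ρ-values = λ _ _ t∈ → t∈
    ; stable = search-stable T eq
    }
  renames {Γ} {T} s (merge {m} {m′} eq r) with search-found T eq
  ... | e , e′ , e∈ , e′∈ , (k≡ , v≺v′) , refl , refl = record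
    { ρ = R.ρ ∘ (m ↦ m′)
    ; renamed = ≡.trans R.renamed (≡.trans (≡.sym (map-∘ T))
        (List.map-cong (λ e → ≡.cong (_≐ R.ρ ((m ↦ m′) (rhs e))) (mapArgs-∘ R.ρ (m ↦ m′) (lhs e))) T))
    ; sound = R.sound
    ; ρ-sound = λ t → ∼-trans (step t) (R.ρ-sound _)
    ; ρ-≼ = λ t → ≼-trans (R.ρ-≼ _) (↦-≼ v≺v′ t)
    ; ρ-values = λ V T⊆V {t} t∈ → R.ρ-values V
        (λ d∈ → let d , d₀∈ , d≡ = ∈-map⁻ _ d∈ in
          subst (λ d → rhs d ∈ V) (≡.sym d≡) (↦-elim (_∈ V) (rhs d) (T⊆V d₀∈) (T⊆V e∈)))
        (↦-elim (_∈ V) t t∈ (T⊆V e∈))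
    ; stable = R.stable
    }
    where
    -- Both values are congruent to the key that the two entries share.
    m∼m′ : Γ ⊢ m ∼ m′
    m∼m′ = ∼-trans (∼-sym (s e′∈)) (subst (Γ ⊢_∼ m′) k≡ (s e∈))

    step : ∀ t → Γ ⊢ t ∼ (m ↦ m′) t
    step t with t ≟ m
    ... | yes refl = m∼m′
    ... | no _ = ∼-refl

    module R = Renaming (renames (rename-sound s step) r)

  -- Correctness of evaluation by the saturated table

  module Representative (Γ : List Equation) where

    T : Table
    T = saturated Γ

    open Renaming (renames (table-sound Γ) (proj₂ (proj₂ (proj₂ (saturate (table Γ)))))) public

    T⁺ : ∀ {e} → e ∈ table Γ → rename ρ e ∈ T
    T⁺ {e} e∈ = subst (rename ρ e ∈_) (≡.sym renamed) (∈-map⁺ (rename ρ) e∈)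

    T⁻ : ∀ {e} → e ∈ T → ∃[ d ] d ∈ table Γ × e ≡ rename ρ d
    T⁻ {e} e∈ = ∈-map⁻ (rename ρ) (subst (e ∈_) renamed e∈)

    -- By closure the arguments have self-entries too, so evaluation arrives at the renamed key of
    -- `t`; stability makes the result independent of which matching entry is found first.
    nf-self : ∀ t → Self (table Γ) t → nf T t ≡ ρ t
    nfs-self : ∀ {n} (ts : Vec Term n) → VAll (Self (table Γ)) ts → nfs T ts ≡ Vec.map ρ ts
    nf-self (node f ts) t∈ =
      ≡.trans (≡.cong (look T ∘ node f) (nfs-self ts (table-closed Γ .closed-lhs t∈)))
          (look-stable stable (T⁺ t∈))
    nfs-self [] [] = refl
    nfs-self (t ∷ ts) (t∈ ∷ ts∈) = ≡.cong₂ _∷_ (nf-self t t∈) (nfs-self ts ts∈)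

    nf-entry : ∀ {e} → e ∈ table Γ → nf T (lhs e) ≡ ρ (rhs e)
    nf-entry {node f ts ≐ v} e∈ =
      ≡.trans (≡.cong (look T ∘ node f) (nfs-self ts (table-closed Γ .closed-lhs e∈)))
          (look-stable stable (T⁺ e∈))

    -- Only an axiom needs the table: both sides evaluate to `ρ q`, the left one through the entry
    -- `p ≐ q` and the right one through `q ≐ q`.
    nf-cong : ∀ {p q} → Γ ⊢ p ∼ q → nf T p ≡ nf T q
    nfs-cong : ∀ {n} {ps qs : Vec Term n} → Pointwise (Γ ⊢_∼_) ps qs → nfs T ps ≡ nfs T qs
    nf-cong (axiom {p} {q} e∈) =
      ≡.trans (nf-entry e∈T) (≡.sym (nf-self q (table-closed Γ .closed-rhs e∈T)))
      where e∈T = table⁺ e∈ (entries-self (p ≐ q))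
    nf-cong ∼-refl = refl
    nf-cong (∼-sym r) = ≡.sym (nf-cong r)
    nf-cong (∼-trans r s) = ≡.trans (nf-cong r) (nf-cong s)
    nf-cong (∼-cong f rs) = ≡.cong (look T ∘ node f) (nfs-cong rs)
    nfs-cong [] = refl
    nfs-cong (r ∷ rs) = ≡.cong₂ _∷_ (nf-cong r) (nfs-cong rs)

    look-sound : ∀ k → Γ ⊢ k ∼ look T k
    look-sound k with look-view T k
    ... | inj₁ (e , e∈ , refl , eq) = subst (Γ ⊢ k ∼_) (≡.sym eq) (sound e∈)
    ... | inj₂ (eq , _) = ≡⇒∼ (≡.sym eq)

    nf-sound : ∀ t → Γ ⊢ t ∼ nf T t
    nfs-sound : ∀ {n} (ts : Vec Term n) → Pointwise (Γ ⊢_∼_) ts (nfs T ts)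
    nf-sound (node f ts) = ∼-trans (∼-cong f (nfs-sound ts)) (look-sound _)
    nfs-sound [] = []
    nfs-sound (t ∷ ts) = nf-sound t ∷ nfs-sound ts

    nf-⇔ : ∀ p q → Γ ⊢ p ∼ q ⇔ nf T p ≡ nf T q
    nf-⇔ p q = mk⇔ nf-cong λ eq → ∼-trans (nf-sound p) (∼-trans (≡⇒∼ eq) (∼-sym (nf-sound q)))

    -- `ρ t` is again a value of the initial table, and these have self-entries.
    ρ-self : ∀ {t} → Self (table Γ) t → Self (table Γ) (ρ t)
    ρ-self t∈ with ∈-map⁻ rhs (ρ-values (map rhs (table Γ)) (∈-map⁺ rhs) (∈-map⁺ rhs t∈))
    ... | e , e∈ , eq = subst (Self (table Γ)) (≡.sym eq) (table-closed Γ .closed-rhs e∈)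

    -- `ρ s` and `ρ t` are normal forms of congruent terms, hence equal, and `ρ` never increases. So
    -- `ρ s` is the least term with a self-entry in its class, a description that does not mention
    -- the run.
    ρ-minimal : ∀ {s t} → Self (table Γ) s → Self (table Γ) t → Γ ⊢ s ∼ t → ρ s ≼ t
    ρ-minimal {s} {t} s∈ t∈ s∼t =
      subst (_≼ t) (≡.trans (≡.sym (nf-self t t∈)) (≡.trans (≡.sym (nf-cong s∼t)) (nf-self s s∈))) (ρ-≼ t)

  -- Independence of the list that presents Γ

  weaken  : ∀ {Γ Δ} → (∀ {e} → e ∈ Γ → e ∈ Δ) → ∀ {p q} → Γ ⊢ p ∼ q → Δ ⊢ p ∼ q
  weakens : ∀ {Γ Δ} → (∀ {e} → e ∈ Γ → e ∈ Δ) → ∀ {n} {ps qs : Vec Term n} →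
            Pointwise (Γ ⊢_∼_) ps qs → Pointwise (Δ ⊢_∼_) ps qs
  weaken i (axiom e∈) = axiom (i e∈)
  weaken i ∼-refl = ∼-refl
  weaken i (∼-sym r) = ∼-sym (weaken i r)
  weaken i (∼-trans r s) = ∼-trans (weaken i r) (weaken i s)
  weaken i (∼-cong f rs) = ∼-cong f (weakens i rs)
  weakens i [] = []
  weakens i (r ∷ rs) = weaken i r ∷ weakens i rs

  module SetInvariance {Γ Δ : List Equation} (i : ∀ {e} → e ∈ Γ → e ∈ Δ) (j : ∀ {e} → e ∈ Δ → e ∈ Γ) where

    module G = Representative Γ
    module D = Representative Δ

    -- Each of the two names lies in the class of `t` and has a self-entry in the other table, so
    -- each is at most the other.
    ρ-≡ : ∀ {t} → Self (table Γ) t → G.ρ t ≡ D.ρ t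
    ρ-≡ {t} t∈ = ≼-antisym
      (G.ρ-minimal t∈ (table-mono j (D.ρ-self t∈Δ)) (weaken j (D.ρ-sound t)))
      (D.ρ-minimal t∈Δ (table-mono i (G.ρ-self t∈)) (weaken i (G.ρ-sound t)))
      where t∈Δ = table-mono i t∈

    map-ρ-≡ : ∀ {n} {ts : Vec Term n} → VAll (Self (table Γ)) ts → Vec.map G.ρ ts ≡ Vec.map D.ρ ts
    map-ρ-≡ [] = refl
    map-ρ-≡ (t∈ ∷ ts∈) = ≡.cong₂ _∷_ (ρ-≡ t∈) (map-ρ-≡ ts∈)

    mapArgs-ρ-≡ : ∀ t → args (Self (table Γ)) t → mapArgs G.ρ t ≡ mapArgs D.ρ t
    mapArgs-ρ-≡ (node f ts) ts∈ = ≡.cong (node f) (map-ρ-≡ ts∈)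

    -- If an entry for Δ fires, the result is a name, and the names agree. If none fires, none for Γ
    -- can, because the renamed keys of the two tables are the same.
    nf-nf : ∀ t → nf G.T (nf D.T t) ≡ nf D.T t
    nfs-nfs : ∀ {n} (ts : Vec Term n) → nfs G.T (nfs D.T ts) ≡ nfs D.T ts
    nf-nf (node f ts) with look-view D.T (node f (nfs D.T ts))
    ... | inj₁ (e , e∈ , _ , eq) with D.T⁻ e∈
    ...   | (k ≐ v) , d∈ , refl = subst (λ x → nf G.T x ≡ x) (≡.sym eq) (begin
      nf G.T (D.ρ v) ≡⟨ G.nf-cong (weaken j (D.ρ-sound v)) ⟨
      nf G.T v       ≡⟨ G.nf-self v v∈ ⟩
      G.ρ v          ≡⟨ ρ-≡ v∈ ⟩
      D.ρ v          ∎)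
      where
      open ≡-Reasoning
      v∈ = table-closed Γ .closed-rhs (table-mono j d∈)
    nf-nf (node f ts) | inj₂ (eq , none) with look-view G.T (node f (nfs D.T ts))
    ... | inj₁ (e , e∈ , k≡ , _) with G.T⁻ e∈
    ...   | (k ≐ v) , d∈ , refl = contradiction
      (≡.trans (≡.sym (mapArgs-ρ-≡ k (table-closed Γ .closed-lhs d∈))) k≡) (none (D.T⁺ (table-mono i d∈)))
    nf-nf (node f ts) | inj₂ (eq , none) | inj₂ (eq′ , _) = subst (λ x → nf G.T x ≡ x) (≡.sym eq)
      (≡.trans (≡.cong (look G.T ∘ node f) (nfs-nfs ts)) eq′)
    nfs-nfs [] = refl
    nfs-nfs (t ∷ ts) = ≡.cong₂ _∷_ (nf-nf t) (nfs-nfs ts)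

    rep-≡ : ∀ t → rep Γ t ≡ rep Δ t
    rep-≡ t = ≡.trans (G.nf-cong (weaken j (D.nf-sound t))) (nf-nf t)

  rep-set : ∀ {Γ Δ} → Γ ∼[ set ] Δ → ∀ t → rep Γ t ≡ rep Δ t
  rep-set Γ∼Δ = SetInvariance.rep-≡ (Equivalence.to Γ∼Δ) (Equivalence.from Γ∼Δ)

-- The program for rep

module Program (Sig : Signature) where

  open Signature Sig
  open Ground Sig using
    ( Term; node; Equation; _≐_; ∥_∥; ∥_∥*; sizeEqs; sizeInput
    ; encodeTerm; encodeTerms; encodeEquation; encodeInput; Letter; symbol )
    renaming (equals to equalsᴸ; end to endᴸ)
  open Equation
  open Closure Sig
  open StackProgram Sym 9

  variable
    B : ℕ
    i r y x o t u v w : List Sym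

  -- Stack 0 holds the input and finally the output, and 1 the reversed input.
  -- While a text is traversed it moves from 5 to 4, which hold the table, from 6
  -- to 7, a second copy of it, or from 2 to 3. A merge m ↦ m′ is kept on 2 and 8.
  st : (i r y x o t u v w : List Sym) → Store
  st i r y x o t u v w = i ∷ r ∷ y ∷ x ∷ o ∷ t ∷ u ∷ v ∷ w ∷ []

  isSym : Maybe Sym → Bool
  isSym (just (sym _)) = true
  isSym _ = false

  isBar : Maybe Sym → Bool
  isBar (just bar) = true
  isBar _ = false

  isEquals : Maybe Sym → Bool
  isEquals (just equals) = true
  isEquals _ = false

  beforeEnd : Maybe Sym → Bool
  beforeEnd (just end) = false
  beforeEnd (just _) = true
  beforeEnd nothing = false

  on : Fin 9 → (Maybe Sym → Bool) → Tops → Bool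
  on j P h = P (lookup h j)

  -- Loops that move texts between stacks

  mv : (i j : Fin 9) → {_ : _} → Cmd
  mv i j {ne} = emit i j {ne} id ⨟ pop i

  -- A command without effect: the answer is always `nothing`, so nothing is pushed.
  skip : Cmd
  skip = emit (# 0) (# 1) (const nothing)

  IsSym : Sym → Set
  IsSym a = isSym (just a) ≡ true

  -- The store is a function of the text still to be read and of two texts that receive each letter.
  -- A loop with fewer targets uses an `S` that ignores the extra arguments.
  each : ∀ {B t c} (S : (x p q : List Sym) → Store) {P : Sym → Set} →
         (∀ {a x p q} → P a → t (tops (S (a ∷ x) p q)) ≡ true) →
         (∀ {a x p q} → P a → B ⊢ c ∶ S (a ∷ x) p q ⇒ S x (a ∷ p) (a ∷ q)) →
         ∀ w {p q} → All P w → B ⊢ t / c ∶ S w p q ⇒[ length w ] S [] (w ʳ++ p) (w ʳ++ q)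
  each S h b [] [] = stop
  each S h b (a ∷ w) (pa ∷ ps) = iter (h pa) (b pa) (each S h b w ps)

  sweep : ∀ {B t c} (S : (x p q : List Sym) → Store) {P : Sym → Set} →
          (∀ {a x p q} → P a → t (tops (S (a ∷ x) p q)) ≡ true) →
          (∀ {a x p q} → P a → B ⊢ c ∶ S (a ∷ x) p q ⇒ S x (a ∷ p) (a ∷ q)) →
          ∀ w {p q} → length w ≤ B → All P w → t (tops (S [] (w ʳ++ p) (w ʳ++ q))) ≡ false →
          B ⊢ while t c ∶ S w p q ⇒ S [] (w ʳ++ p) (w ʳ++ q)
  sweep S h b w w≤ ps = loop w≤ (each S h b w ps)

  iterations : ∀ {B t c σ τ m n} → m ≡ n → B ⊢ t / c ∶ σ ⇒[ m ] τ → B ⊢ t / c ∶ σ ⇒[ n ] τ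
  iterations refl l = l

  everything : (w : List Sym) → All (λ _ → ⊤) w
  everything = All.universal (λ _ → tt)

  code-syms  : ∀ t → All IsSym (code t)
  codes-syms : ∀ {n} (ts : Vec Term n) → All IsSym (codes ts)
  code-syms (node f ts) = refl ∷ codes-syms ts
  codes-syms [] = []
  codes-syms (t ∷ ts) = All.++⁺ (code-syms t) (codes-syms ts)

  length-code  : ∀ t → length (code t) ≡ ∥ t ∥
  length-codes : ∀ {n} (ts : Vec Term n) → length (codes ts) ≡ ∥ ts ∥*
  length-code (node f ts) = ≡.cong suc (length-codes ts)
  length-codes [] = refl
  length-codes (t ∷ ts) = ≡.trans (length-++ (code t)) (≡.cong₂ _+_ (length-code t) (length-codes ts))

  -- The text of a table and the reading of keys

  names : ∀ {n} → Vec Term n → List Sym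
  names [] = []
  names (t ∷ ts) = bar ∷ code t ++ names ts

  keyText : Term → List Sym
  keyText (node f ts) = sym f ∷ names ts

  entryBody : Equation → List Sym
  entryBody (k ≐ v) = keyText k ++ equals ∷ code v

  -- f(s₁,…,sₙ) ≐ s is written f|s₁|…|sₙ = s end; the bars make the arguments of
  -- the key recognisable without counting arities.
  entryText : Equation → List Sym
  entryText e = entryBody e ++ [ end ]

  tableText : Table → List Sym
  tableText = concatMap entryText

  upper : ∀ {n} → (Fin n → ℕ) → ℕ
  upper {zero} g = 0
  upper {suc n} g = g zero ⊔ upper (g ∘ suc)

  ≤-upper : ∀ {n} (g : Fin n → ℕ) j → g j ≤ upper g
  ≤-upper g zero = ℕ.m≤m⊔n _ _
  ≤-upper g (suc j) = ℕ.≤-trans (≤-upper (g ∘ suc) j) (ℕ.m≤n⊔m _ _)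

  -- Commands cannot count, so the arity is found in straight-line code, by testing the letter
  -- against each number below the maximal arity.
  markIf : ℕ → Sym → Maybe Sym → Maybe Sym
  markIf p m (just (sym f)) = if p <ᵇ arity f then just m else nothing
  markIf p m _ = nothing

  -- One mark for each argument of the symbol on top of stack 2.
  marks : ℕ → Sym → Cmd
  marks zero m = skip
  marks (suc p) m = emit (# 2) (# 6) (markIf p m) ⨟ marks p m

  replicate-snoc : ∀ n (m : Sym) u → replicate n m ++ m ∷ u ≡ m ∷ replicate n m ++ u
  replicate-snoc zero m u = refl
  replicate-snoc (suc n) m u = ≡.cong (m ∷_) (replicate-snoc n m u)

  marks-up-to : ∀ p {m f} → B ⊢ marks p m ∶ st i r (sym f ∷ y) x o t u v w ⇒
                            st i r (sym f ∷ y) x o t (replicate (p ⊓ arity f) m ++ u) v w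
  marks-up-to zero = emit
  marks-up-to {B} {i} {r} {y} {x} {o} {t} {u} {v} {w} (suc p) {m} {f} = emit ⨟ rest
    where
    rest : B ⊢ marks p m ∶ st i r (sym f ∷ y) x o t (push (if p <ᵇ arity f then just m else nothing) u) v
        w ⇒
               st i r (sym f ∷ y) x o t (replicate (suc p ⊓ arity f) m ++ u) v w
    rest with p <ᵇ arity f in p<
    ... | true = subst (λ s → B ⊢ marks p m ∶ _ ⇒ st i r (sym f ∷ y) x o t s v w) eq (marks-up-to p)
      where
      p<a : p < arity f
      p<a = ℕ.<ᵇ⇒< p (arity f) (subst Bool.T (≡.sym p<) tt)
      eq : replicate (p ⊓ arity f) m ++ m ∷ u ≡ replicate (suc p ⊓ arity f) m ++ u
      eq = ≡.trans (replicate-snoc (p ⊓ arity f) m u)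
             (≡.cong (λ n → replicate n m ++ u)
               (≡.trans (≡.cong suc (ℕ.m≤n⇒m⊓n≡m (ℕ.<⇒≤ p<a))) (≡.sym (ℕ.m≤n⇒m⊓n≡m p<a))))
    ... | false = subst (λ n → B ⊢ marks p m ∶ _
        ⇒ st i r (sym f ∷ y) x o t (replicate n m ++ u) v w) eq (marks-up-to p)
      where
      a≤p : arity f ≤ p
      a≤p = ℕ.≮⇒≥ (λ p<a → subst Bool.T p< (ℕ.<⇒<ᵇ p<a))
      eq : p ⊓ arity f ≡ suc p ⊓ arity f
      eq = ≡.trans (ℕ.m≥n⇒m⊓n≡n a≤p) (≡.sym (ℕ.m≥n⇒m⊓n≡n (ℕ.m≤n⇒m≤1+n a≤p)))

  markArgs : Sym → Cmd
  markArgs = marks (upper arity)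

  markArgs-spec : ∀ {m f} → B ⊢ markArgs m ∶ st i r (sym f ∷ y) x o t u v w ⇒
                            st i r (sym f ∷ y) x o t (replicate (arity f) m ++ u) v w
  markArgs-spec {B} {i} {r} {y} {x} {o} {t} {u} {v} {w} {m} {f} =
    subst (λ n → B ⊢ markArgs m ∶ _ ⇒ st i r (sym f ∷ y) x o t (replicate n m ++ u) v w)
          (ℕ.m≥n⇒m⊓n≡n (≤-upper arity f)) (marks-up-to (upper arity))

  write₄ : Sym → Cmd
  write₄ a = emit (# 5) (# 4) (const (just a))

  -- Stack 6 holds one mark for every term still to be read; the mark is `bar`
  -- for an argument of the key and `equals` below that.
  parse : Cmd
  parse = cond (on (# 6) isBar) (write₄ bar) skip ⨟ pop (# 6) ⨟ emit (# 2) (# 4) id ⨟ markArgs equals ⨟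
      mv (# 2) (# 3)

  -- A symbol exchanges its mark for one mark per argument, so each letter takes one round and the
  -- marks above `u` run out exactly with the terms. Keeping `u` general lets the runs for arguments
  -- and later terms be chained.
  parse-terms : ∀ {n} (ts : Vec Term n) →
    B ⊢ on (# 6) is-just / parse ∶ st i r (codes ts ++ y) x o t (replicate n equals ++ u) v w
      ⇒[ ∥ ts ∥* ] st i r y (codes ts ʳ++ x) (codes ts ʳ++ o) t u v w
  parse-terms [] = stop
  parse-terms {y = y} {x = x} {o = o} (node f ss ∷ ts)
    rewrite ++-assoc (codes ss) (codes ts) y | ++-ʳ++ (codes ss) {codes ts} {sym f ∷ x}
        | ++-ʳ++ (codes ss) {codes ts} {sym f ∷ o}
    = iter refl (cond-false refl emit ⨟ pop ⨟ emit ⨟ markArgs-spec ⨟ emit ⨟ pop)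
        (parse-terms ss ⊹ parse-terms ts)

  parse-names : ∀ {n} (ts : Vec Term n) →
    B ⊢ on (# 6) is-just / parse ∶ st i r (codes ts ++ y) x o t (replicate n bar ++ u) v w
      ⇒[ ∥ ts ∥* ] st i r y (codes ts ʳ++ x) (names ts ʳ++ o) t u v w
  parse-names [] = stop
  parse-names {y = y} {x = x} {o = o} (node f ss ∷ ts)
    rewrite ++-assoc (codes ss) (codes ts) y | ++-ʳ++ (codes ss) {codes ts} {sym f ∷ x}
        | ++-ʳ++ (codes ss) {names ts} {sym f ∷ bar ∷ o}
    = iter refl (cond-true refl emit ⨟ pop ⨟ emit ⨟ markArgs-spec ⨟ emit ⨟ pop)
        (parse-terms ss ⊹ parse-names ts)

  -- The root is handled before the loop because it gets no bar, while its arguments do.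
  readKey : Cmd
  readKey = emit (# 2) (# 4) id ⨟ markArgs bar ⨟ mv (# 2) (# 3) ⨟ while (on (# 6) is-just) parse

  readKey-spec : ∀ k → ∥ k ∥ ≤ B → B ⊢ readKey ∶ st i r (code k ++ y) x o t [] v w ⇒
                                          st i r y (code k ʳ++ x) (keyText k ʳ++ o) t [] v w
  readKey-spec {B} {i} {r} {y} {x} {o} {t} {v} {w} (node f ts) k≤ =
    emit ⨟ markArgs-spec ⨟ (emit ⨟ pop) ⨟ loop (ℕ.≤-trans (ℕ.n≤1+n _) k≤) (parse-names ts) refl

  -- Building the initial table from the input

  restore : Cmd
  restore = while (on (# 3) is-just) (mv (# 3) (# 2))

  restore-spec : length x ≤ B → B ⊢ restore ∶ st i r y x o t u v w ⇒ st i r (x ʳ++ y) [] o t u v w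
  restore-spec {x = x} {i = i} {r} {y} {o} {t} {u} {v} {w} x≤ =
    sweep (λ x p _ → st i r p x o t u v w) (λ _ → refl) (λ _ → emit ⨟ pop) x {q = []} x≤ (everything x) refl

  recordRhs : Cmd
  recordRhs = write₄ equals ⨟ mv (# 2) (# 3) ⨟
      while (on (# 2) isSym) (emit (# 2) (# 4) id ⨟ mv (# 2) (# 3)) ⨟ restore

  -- The key lies reversed on stack 3. Moving it back also leaves a copy on stack 7 with the first
  -- letter on top, ready to be written as the value.
  recordSelf : Cmd
  recordSelf = write₄ equals ⨟ while (on (# 3) is-just) (emit (# 3) (# 7) id ⨟ mv (# 3) (# 2)) ⨟
               while (on (# 7) is-just) (mv (# 7) (# 4))

  -- Applied to the letter before a term: among the subterms of the equations only a left side is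
  -- preceded by `end` or, in the first equation, by nothing.
  atRoot : Maybe Sym → Bool
  atRoot (just end) = true
  atRoot (just _) = false
  atRoot nothing = true

  recordEntry : Cmd
  recordEntry = readKey ⨟ cond (on (# 1) atRoot) recordRhs recordSelf ⨟ write₄ end

  entryText-ʳ++ : ∀ k v o → end ∷ code v ʳ++ (equals ∷ keyText k ʳ++ o) ≡ entryText (k ≐ v) ʳ++ o
  entryText-ʳ++ k v o = ≡.sym (≡.trans (++-ʳ++ (entryBody (k ≐ v)) {[ end ]})
      (≡.cong (end ∷_) (++-ʳ++ (keyText k))))

  record-self : ∀ s → ∥ s ∥ ≤ B → atRoot (List.head r) ≡ false →
    B ⊢ recordEntry ∶ st i r (code s ++ y) [] o t [] [] w
        ⇒ st i r (code s ++ y) [] (entryText (s ≐ s) ʳ++ o) t [] [] w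
  record-self {B} {r} {i} {y} {o} {t} {w} s s≤ inner
    rewrite ≡.sym (entryText-ʳ++ s s o) =
    readKey-spec s s≤ ⨟ cond-false inner (emit ⨟ a ⨟ b) ⨟ emit
    where
    R = code s ʳ++ []
    o′ = equals ∷ keyText s ʳ++ o
    R≤ : length R ≤ B
    R≤ = subst (_≤ B) (≡.trans (≡.sym (length-code s))
        (≡.sym (≡.trans (List.length-ʳ++ (code s)) (ℕ.+-identityʳ _)))) s≤
    back : ∀ z → (code s ʳ++ []) ʳ++ z ≡ code s ++ z
    back z = ʳ++-ʳ++ (code s)
    a : B ⊢ _ ∶ st i r y R o′ t [] [] w ⇒ st i r (code s ++ y) [] o′ t [] (code s) w
    a = ≡.subst₂ (λ p q → B ⊢ _ ∶ st i r y R o′ t [] [] w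
        ⇒ st i r p [] o′ t [] q w) (back y) (≡.trans (back []) (++-identityʳ _))
          (sweep (λ x p q → st i r p x o′ t [] q w) (λ _ → refl) (λ _ → emit ⨟ emit ⨟ pop) R R≤
              (everything R) refl)
    b : B ⊢ _ ∶ st i r (code s ++ y) [] o′ t [] (code s) w
        ⇒ st i r (code s ++ y) [] (code s ʳ++ o′) t [] [] w
    b = sweep (λ x p _ → st i r (code s ++ y) [] p t [] x w) (λ _ → refl) (λ _ → emit ⨟ pop) (code s)
        {q = []}
          (subst (_≤ B) (≡.sym (length-code s)) s≤) (everything _) refl

  eqText : Equation → List Sym
  eqText (p ≐ q) = code p ++ equals ∷ code q ++ [ end ]

  record-rhs : ∀ p q → ∥ p ∥ + suc ∥ q ∥ ≤ B → atRoot (List.head r) ≡ true →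
    B ⊢ recordEntry ∶ st i r (eqText (p ≐ q) ++ y) [] o t [] [] w
        ⇒ st i r (eqText (p ≐ q) ++ y) [] (entryText (p ≐ q) ʳ++ o) t [] [] w
  record-rhs {B} {r} {i} {y} {o} {t} {w} p q pq≤ root
    rewrite ≡.sym (entryText-ʳ++ p q o) | ++-assoc (code p) (equals ∷ code q ++ [ end ]) y
        | ++-assoc (code q) [ end ] y =
    readKey-spec p (ℕ.m+n≤o⇒m≤o _ pq≤) ⨟ cond-true root (emit ⨟ (emit ⨟ pop) ⨟ a ⨟ b) ⨟ emit
    where
    o′ = equals ∷ keyText p ʳ++ o
    x′ = equals ∷ code p ʳ++ []
    a : B ⊢ _ ∶ st i r (code q ++ end ∷ y) x′ o′ t [] [] w
        ⇒ st i r (end ∷ y) (code q ʳ++ x′) (code q ʳ++ o′) t [] [] w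
    a = sweep (λ x p q → st i r (x ++ end ∷ y) p q t [] [] w) (λ p → p) (λ _ → emit ⨟ emit ⨟ pop) (code q)
          (subst (_≤ B) (≡.sym (length-code q)) (ℕ.≤-trans (ℕ.n≤1+n _) (ℕ.m+n≤o⇒n≤o ∥ p ∥ pq≤)))
              (code-syms q) refl
    len : length (code q ʳ++ x′) ≡ ∥ p ∥ + suc ∥ q ∥
    len = begin
      length (code q ʳ++ x′)         ≡⟨ List.length-ʳ++ (code q) ⟩
      length (code q) + suc (length (code p ʳ++ [])) ≡⟨ ≡.cong₂ (λ a b → a + suc b) (length-code q)
                                            (≡.trans (List.length-ʳ++ (code p))
                                                (≡.trans (ℕ.+-identityʳ _) (length-code p))) ⟩
      ∥ q ∥ + suc ∥ p ∥              ≡⟨ ℕ.+-comm ∥ q ∥ (suc ∥ p ∥) ⟩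
      suc ∥ p ∥ + ∥ q ∥              ≡⟨ ℕ.+-suc ∥ p ∥ ∥ q ∥ ⟨
      ∥ p ∥ + suc ∥ q ∥              ∎
      where open ≡-Reasoning
    b : B ⊢ restore ∶ st i r (end ∷ y) (code q ʳ++ x′) (code q ʳ++ o′) t [] [] w ⇒
              st i r (code p ++ equals ∷ code q ++ end ∷ y) [] (code q ʳ++ o′) t [] [] w
    b = subst (λ s → B ⊢ restore ∶ st i r (end ∷ y) (code q ʳ++ x′) (code q ʳ++ o′) t [] [] w
        ⇒ st i r s [] (code q ʳ++ o′) t [] [] w)
          (≡.trans (ʳ++-ʳ++ (code q)) (ʳ++-ʳ++ (code p)))
          (restore-spec (subst (_≤ B) (≡.sym len) pq≤))

  -- As the input is read backwards, the whole term that starts at the moved letter is on top of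
  -- stack 2.
  build : Cmd
  build = mv (# 1) (# 2) ⨟ cond (on (# 2) isSym) recordEntry skip

  inner-ʳ++ : ∀ {w} → All IsSym w → ∀ {r} → atRoot (List.head r) ≡ false →
      atRoot (List.head (w ʳ++ r)) ≡ false
  inner-ʳ++ [] h = h
  inner-ʳ++ {sym _ ∷ w} (_ ∷ ps) h = inner-ʳ++ ps refl

  tableText-++ : ∀ T U → tableText (T ++ U) ≡ tableText T ++ tableText U
  tableText-++ T U = List.concatMap-++ entryText T U

  tableText-ʳ++ : ∀ T U o → tableText (T ++ U) ʳ++ o ≡ tableText U ʳ++ tableText T ʳ++ o
  tableText-ʳ++ T U o = ≡.trans (≡.cong (_ʳ++ o) (tableText-++ T U)) (++-ʳ++ (tableText T))

  tableText-∷ʳ : ∀ T e o → tableText (T ++ [ e ]) ʳ++ o ≡ entryText e ʳ++ tableText T ʳ++ o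
  tableText-∷ʳ T e o = ≡.trans (tableText-ʳ++ T [ e ] o) (≡.cong (_ʳ++ _) (++-identityʳ (entryText e)))

  build-term : ∀ s → ∥ s ∥ ≤ B → atRoot (List.head r) ≡ false →
    B ⊢ on (# 1) is-just / build ∶ st i (code s ʳ++ r) y [] o t [] [] w
      ⇒[ ∥ s ∥ ] st i r (code s ++ y) [] (tableText (subterms s) ʳ++ o) t [] [] w
  build-terms : ∀ {n} (ss : Vec Term n) → ∥ ss ∥* ≤ B → atRoot (List.head r) ≡ false →
    B ⊢ on (# 1) is-just / build ∶ st i (codes ss ʳ++ r) y [] o t [] [] w
      ⇒[ ∥ ss ∥* ] st i r (codes ss ++ y) [] (tableText (subterms* ss) ʳ++ o) t [] [] w
  build-term {B} {r} {i} {y} {o} {t} {w} (node f ss) s≤ h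
    rewrite tableText-∷ʳ (subterms* ss) (node f ss ≐ node f ss) o =
    iterations (ℕ.+-comm ∥ ss ∥* 1)
      (build-terms ss (ℕ.≤-trans (ℕ.n≤1+n _) s≤) refl ⊹
       iter refl ((emit ⨟ pop) ⨟ cond-true refl (record-self (node f ss) s≤ h)) stop)
  build-terms [] _ _ = stop
  build-terms {B} {r} {i} {y} {o} {t} {w} (s ∷ ss) s≤ h
    rewrite ++-ʳ++ (code s) {codes ss} {r} | ++-assoc (code s) (codes ss) y
        | tableText-ʳ++ (subterms* ss) (subterms s) o =
    iterations (ℕ.+-comm ∥ ss ∥* ∥ s ∥)
      (build-terms ss (ℕ.m+n≤o⇒n≤o ∥ s ∥ s≤) (inner-ʳ++ (code-syms s) h) ⊹
       build-term s (ℕ.m+n≤o⇒m≤o ∥ s ∥ s≤) h)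

  build-equation : ∀ e → ∥ lhs e ∥ + suc ∥ rhs e ∥ ≤ B → atRoot (List.head r) ≡ true →
    B ⊢ on (# 1) is-just / build ∶ st i (eqText e ʳ++ r) y [] o t [] [] w
      ⇒[ suc (∥ rhs e ∥ + suc ∥ lhs e ∥) ] st i r (eqText e ++ y) [] (tableText (entries e) ʳ++ o) t [] [] w
  build-equation {B} {r} {i} {y} {o} {t} {w} (node f ps ≐ q) e≤ h
    rewrite tableText-ʳ++ (subterms q) (subterms* ps ++ [ node f ps ≐ q ]) o
          | tableText-∷ʳ (subterms* ps) (node f ps ≐ q) (tableText (subterms q) ʳ++ o)
          | ++-ʳ++ (codes ps) {equals ∷ code q ++ [ end ]} {sym f ∷ r}
          | ++-ʳ++ (code q) {[ end ]} {equals ∷ codes ps ʳ++ sym f ∷ r} =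
    iter refl ((emit ⨟ pop) ⨟ cond-false refl emit)
      (build-term q (ℕ.≤-trans (ℕ.n≤1+n _) (ℕ.m+n≤o⇒n≤o (suc ∥ ps ∥*) e≤)) refl ⊹
       iter refl ((emit ⨟ pop) ⨟ cond-false refl emit)
         (iterations (ℕ.+-comm ∥ ps ∥* 1)
           (build-terms ps (ℕ.≤-trans (ℕ.n≤1+n _) (ℕ.m+n≤o⇒m≤o (suc ∥ ps ∥*) e≤)) refl ⊹
            iter refl ((emit ⨟ pop) ⨟ cond-true refl last) stop)))
    where
    o′ = tableText (subterms* ps) ʳ++ tableText (subterms q) ʳ++ o
    assoc : eqText (node f ps ≐ q) ++ y ≡ code (node f ps) ++ equals ∷ code q ++ end ∷ y
    assoc = ≡.trans (++-assoc (code (node f ps)) _ y)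
        (≡.cong (λ z → code (node f ps) ++ equals ∷ z) (++-assoc (code q) [ end ] y))
    last : B ⊢ recordEntry ∶ st i r (code (node f ps) ++ equals ∷ code q ++ end ∷ y) [] o′ t [] [] w ⇒
             st i r (eqText (node f ps ≐ q) ++ y) [] (entryText (node f ps ≐ q) ʳ++ o′) t [] [] w
    last = subst (λ z → B ⊢ recordEntry ∶ st i r z [] o′ t [] [] w
        ⇒ st i r (eqText (node f ps ≐ q) ++ y) [] (entryText (node f ps ≐ q) ʳ++ o′) t [] [] w)
             assoc (record-rhs (node f ps) q e≤ h)

  ʳ++⁺ : ∀ {P : Sym → Set} {xs ys} → All P xs → All P ys → All P (xs ʳ++ ys)
  ʳ++⁺ [] qs = qs
  ʳ++⁺ (p ∷ ps) qs = ʳ++⁺ ps (p ∷ qs)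

  -- Undoes the reversal caused by an earlier sweep.
  sweepBack : ∀ {B t c} (S : (x p q : List Sym) → Store) {P : Sym → Set} →
              (∀ {a x p q} → P a → t (tops (S (a ∷ x) p q)) ≡ true) →
              (∀ {a x p q} → P a → B ⊢ c ∶ S (a ∷ x) p q ⇒ S x (a ∷ p) (a ∷ q)) →
              ∀ w {p q} → length w ≤ B → All P w → t (tops (S [] (w ++ p) (w ++ q))) ≡ false →
              B ⊢ while t c ∶ S (reverse w) p q ⇒ S [] (w ++ p) (w ++ q)
  sweepBack {B} {t} {c} S h b w {p} {q} w≤ ps f =
    ≡.subst₂ (λ p′ q′ → B ⊢ while t c ∶ S (reverse w) p q ⇒ S [] p′ q′) (ʳ++-ʳ++ w) (ʳ++-ʳ++ w)
      (sweep S h b (reverse w) (subst (_≤ B) (≡.sym (List.length-reverse w)) w≤) (ʳ++⁺ ps [])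
        (≡.subst₂ (λ p′ q′ → t (tops (S [] p′ q′)) ≡ false) (≡.sym (ʳ++-ʳ++ w)) (≡.sym (ʳ++-ʳ++ w)) f))

  rewind : Cmd
  rewind = while (on (# 4) is-just) (mv (# 4) (# 5))

  rewind-spec : ∀ w′ → length w′ ≤ B → B ⊢ rewind ∶ st i r y x (w′ ʳ++ []) [] u v w ⇒ st i r y x [] w′ u v w
  rewind-spec {B} {i} {r} {y} {x} {u} {v} {w} w′ w≤ =
    subst (λ s → B ⊢ rewind ∶ st i r y x (reverse w′) [] u v w ⇒ st i r y x [] s u v w) (++-identityʳ w′)
      (sweepBack (λ z p _ → st i r y x z p u v w) (λ _ → refl) (λ _ → emit ⨟ pop) w′ {q = []} w≤
          (everything w′) refl)

  equationsText : List Equation → List Sym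
  equationsText = concatMap eqText

  length-eqText : ∀ e → length (eqText e) ≡ suc (∥ rhs e ∥ + suc ∥ lhs e ∥)
  length-eqText (p ≐ q) = begin
    length (eqText (p ≐ q))                         ≡⟨ length-++ (code p) ⟩
    length (code p) + suc (length (code q ++ [ end ])) ≡⟨ ≡.cong₂ (λ a b → a + suc b) (length-code p)
                                                     (≡.trans (length-++ (code q))
                                                         (≡.cong (_+ 1) (length-code q))) ⟩
    ∥ p ∥ + suc (∥ q ∥ + 1)                         ≡⟨ ≡.cong (λ a → ∥ p ∥ + suc a) (ℕ.+-comm ∥ q ∥ 1) ⟩
    ∥ p ∥ + suc (suc ∥ q ∥)                         ≡⟨ ℕ.+-comm ∥ p ∥ (suc (suc ∥ q ∥)) ⟩
    suc (suc ∥ q ∥ + ∥ p ∥)                         ≡⟨ ≡.cong suc (ℕ.+-suc ∥ q ∥ ∥ p ∥) ⟨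
    suc (∥ q ∥ + suc ∥ p ∥)                         ∎
    where open ≡-Reasoning

  eqText-ʳ++-root : ∀ e r → atRoot (List.head (eqText e ʳ++ r)) ≡ true
  eqText-ʳ++-root (p ≐ q) r
    rewrite ++-ʳ++ (code p) {equals ∷ code q ++ [ end ]} {r}
        | ++-ʳ++ (code q) {[ end ]} {equals ∷ code p ʳ++ r} = refl

  FitsEq : ℕ → Equation → Set
  FitsEq B e = ∥ lhs e ∥ + suc ∥ rhs e ∥ ≤ B

  build-all : ∀ Γ → All (FitsEq B) Γ → atRoot (List.head r) ≡ true →
    B ⊢ on (# 1) is-just / build ∶ st i (equationsText Γ ʳ++ r) y [] o t [] [] w
      ⇒[ length (equationsText Γ) ] st i r (equationsText Γ ++ y) [] (tableText (table Γ) ʳ++ o) t [] [] w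
  build-all [] _ _ = stop
  build-all {B} {r} {i} {y} {o} {t} {w} (e ∷ Γ) (e≤ ∷ Γ≤) root
    rewrite ++-ʳ++ (eqText e) {equationsText Γ} {r} | ++-assoc (eqText e) (equationsText Γ) y
          | tableText-ʳ++ (table Γ) (entries e) o =
    iterations count (build-all Γ Γ≤ (eqText-ʳ++-root e r) ⊹ build-equation e e≤ root)
    where
    count : length (equationsText Γ) + suc (∥ rhs e ∥ + suc ∥ lhs e ∥)
        ≡ length (eqText e ++ equationsText Γ)
    count = ≡.trans (ℕ.+-comm (length (equationsText Γ)) _)
              (≡.sym (≡.trans (length-++ (eqText e))
                  (≡.cong (_+ length (equationsText Γ)) (length-eqText e))))

  -- The query term has no separator of its own; read backwards, it stops at the first letter that
  -- is no symbol, or at the blank if Γ is empty.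
  equationsText-reversed : ∀ Γ → isSym (List.head (equationsText Γ ʳ++ [])) ≡ false
  equationsText-reversed [] = refl
  equationsText-reversed (e ∷ Γ) rewrite ++-ʳ++ (eqText e) {equationsText Γ} {[]} =
      from-root Γ (eqText-ʳ++-root e [])
    where
    root-isSym : ∀ a → atRoot a ≡ true → isSym a ≡ false
    root-isSym nothing _ = refl
    root-isSym (just end) _ = refl

    from-root : ∀ Γ {r} → atRoot (List.head r) ≡ true → isSym (List.head (equationsText Γ ʳ++ r)) ≡ false
    from-root [] {r} h = root-isSym (List.head r) h
    from-root (e ∷ Γ) {r} h rewrite ++-ʳ++ (eqText e) {equationsText Γ} {r} =
        from-root Γ (eqText-ʳ++-root e r)

  prepare : Cmd
  prepare = while (on (# 0) is-just) (mv (# 0) (# 1)) ⨟ while (on (# 1) isSym) (mv (# 1) (# 0)) ⨟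
            while (on (# 1) is-just) build ⨟ rewind ⨟ while (on (# 2) is-just) (pop (# 2))

  prepare-spec : ∀ Γ s → All (FitsEq B) Γ → length (equationsText Γ) + ∥ s ∥ ≤ B →
      length (tableText (table Γ)) ≤ B →
    B ⊢ prepare ∶ st (equationsText Γ ++ code s) [] [] [] [] [] [] [] []
        ⇒ st (code s) [] [] [] [] (tableText (table Γ)) [] [] []
  prepare-spec {B} Γ s Γ≤ len≤ table≤ = a ⨟ b ⨟ loop g≤ (build-all Γ Γ≤ refl) refl ⨟ rewind-spec _ table≤ ⨟
      d
    where
    G = equationsText Γ
    g≤ = ℕ.m+n≤o⇒m≤o (length G) len≤
    s≤ : length (code s) ≤ B
    s≤ = subst (_≤ B) (≡.sym (length-code s)) (ℕ.m+n≤o⇒n≤o (length G) len≤)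
    a : B ⊢ _ ∶ st (G ++ code s) [] [] [] [] [] [] [] []
        ⇒ st [] (reverse (code s) ++ G ʳ++ []) [] [] [] [] [] [] []
    a = subst (λ z → B ⊢ _ ∶ st (G ++ code s) [] [] [] [] [] [] [] [] ⇒ st [] z [] [] [] [] [] [] [])
          (≡.trans (++-ʳ++ G {code s} {[]}) (ʳ++-defn (code s)))
          (sweep (λ z p _ → st z p [] [] [] [] [] [] []) (λ _ → refl) (λ _ → emit ⨟ pop) (G ++ code s)
              {q = []}
            (subst (_≤ B) (≡.sym (≡.trans (length-++ G) (≡.cong (length G +_) (length-code s)))) len≤)
                (everything _) refl)
    b : B ⊢ _ ∶ st [] (reverse (code s) ++ G ʳ++ []) [] [] [] [] [] [] []
        ⇒ st (code s) (G ʳ++ []) [] [] [] [] [] [] []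
    b = subst (λ z → B ⊢ _ ∶ st [] (reverse (code s) ++ G ʳ++ []) [] [] [] [] [] [] []
        ⇒ st z (G ʳ++ []) [] [] [] [] [] [] [])
          (++-identityʳ (code s))
          (sweepBack (λ z p _ → st p (z ++ G ʳ++ []) [] [] [] [] [] [] []) id (λ _ → emit ⨟ pop)
            (code s) {q = []} s≤ (code-syms s) (equationsText-reversed Γ))
    d : B ⊢ _ ∶ st (code s) [] (G ++ []) [] [] (tableText (table Γ)) [] [] []
        ⇒ st (code s) [] [] [] [] (tableText (table Γ)) [] [] []
    d = sweep (λ z _ _ → st (code s) [] z [] [] (tableText (table Γ)) [] [] []) (λ _ → refl) (λ _ → pop)
        (G ++ []) {[]} {[]}
          (subst (λ z → length z ≤ B) (≡.sym (++-identityʳ G)) g≤) (everything _) refl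

  -- Finding a conflict between two entries

  agree : Maybe Sym → Maybe Sym → Bool
  agree (just (sym f)) (just (sym g)) = does (f Fin.≟ g)
  agree (just bar) (just bar) = true
  agree _ _ = false

  agree-sound : ∀ a b → agree a b ≡ true → a ≡ b
  agree-sound (just (sym f)) (just (sym g)) eq with f Fin.≟ g
  ... | yes refl = refl
  agree-sound (just bar) (just bar) eq = refl

  agree-≢ : ∀ {a b} → a ≢ b → agree a b ≡ false
  agree-≢ {a} {b} a≢b with agree a b in eq
  ... | false = refl
  ... | true = contradiction (agree-sound a b eq) a≢b

  IsText : Sym → Set
  IsText a = agree (just a) (just a) ≡ true

  sym-text : ∀ {a} → IsSym a → IsText a
  sym-text {sym f} _ = dec-true (f Fin.≟ f) refl

  text-≢-equals : ∀ {a} → IsText a → isEquals (just a) ≡ false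
  text-≢-equals {sym f} _ = refl
  text-≢-equals {bar} _ = refl

  names-text : ∀ {n} (ts : Vec Term n) → All IsText (names ts)
  names-text [] = []
  names-text (t ∷ ts) = refl ∷ All.++⁺ (All.map sym-text (code-syms t)) (names-text ts)

  keyText-text : ∀ k → All IsText (keyText k)
  keyText-text (node f ts) = sym-text {sym f} refl ∷ names-text ts

  agreeOn : Fin 9 → Fin 9 → Tops → Bool
  agreeOn j l h = agree (lookup h j) (lookup h l)

  -- `agree` fails on `equals` and `end` even when both letters coincide, so the loop cannot run
  -- past a key or a value.
  compareTU : Cmd
  compareTU = while (agreeOn (# 5) (# 6)) (mv (# 5) (# 4) ⨟ mv (# 6) (# 7))

  compareTU-spec : ∀ c {a b} → length c ≤ B → All IsText c → agree (List.head a) (List.head b) ≡ false →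
    B ⊢ compareTU ∶ st i r y x o (c ++ a) (c ++ b) v w ⇒ st i r y x (c ʳ++ o) a b (c ʳ++ v) w
  compareTU-spec {i = i} {r} {y} {x} {w = w} c {a} {b} c≤ text =
    sweep (λ z p q → st i r y x p (z ++ a) (z ++ b) q w) id (λ _ → (emit ⨟ pop) ⨟ emit ⨟ pop) c c≤ text

  finish : Cmd
  finish = while (on (# 5) beforeEnd) (mv (# 5) (# 4)) ⨟ mv (# 5) (# 4)

  BeforeEnd : Sym → Set
  BeforeEnd a = beforeEnd (just a) ≡ true

  finish-spec : ∀ c → length c ≤ B → All BeforeEnd c →
    B ⊢ finish ∶ st i r y x o (c ++ end ∷ t) u v w ⇒ st i r y x (end ∷ c ʳ++ o) t u v w
  finish-spec {i = i} {r} {y} {x} {t = t} {u} {v} {w} c c≤ b =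
    sweep (λ z p _ → st i r y x p (z ++ end ∷ t) u v w) id (λ _ → emit ⨟ pop) c {q = []} c≤ b refl ⨟ emit ⨟
        pop

  restoreU : Cmd
  restoreU = while (on (# 7) is-just) (mv (# 7) (# 6))

  restoreU-spec : length v ≤ B → B ⊢ restoreU ∶ st i r y x o t u v w ⇒ st i r y x o t (v ʳ++ u) [] w
  restoreU-spec {v = v} {i = i} {r} {y} {x} {o} {t} {u} {w} v≤ =
    sweep (λ z p _ → st i r y x o t p z w) (λ _ → refl) (λ _ → emit ⨟ pop) v {q = []} v≤ (everything v) refl

  less : Maybe Sym → Maybe Sym → Bool
  less (just (sym f)) (just (sym g)) = does (f Fin.<? g)
  less _ _ = false

  -- Codes of terms being nonempty, stack 2 is empty exactly as long as no conflict has been found.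
  conflictTest : Tops → Bool
  conflictTest h = is-nothing (lookup h (# 2)) ∧ less (lookup h (# 6)) (lookup h (# 5))

  -- The comparison stopped inside the two values. Each is moved on to its `end` and then back to
  -- its `equals`, and on the way back its letters are copied, the larger value to stack 2 and the
  -- smaller to stack 8.
  grab : Cmd
  grab = while (on (# 5) isSym) (mv (# 5) (# 4)) ⨟
      while (on (# 4) isSym) (emit (# 4) (# 2) id ⨟ mv (# 4) (# 5)) ⨟
         while (on (# 6) isSym) (mv (# 6) (# 7)) ⨟
             while (on (# 7) isSym) (emit (# 7) (# 8) id ⨟ mv (# 7) (# 6))

  grab-spec : ∀ p q c a d b → code p ≡ c ++ a → code q ≡ d ++ b → ∥ p ∥ ≤ B → ∥ q ∥ ≤ B →
    B ⊢ grab ∶ st i r [] x (c ʳ++ equals ∷ o) (a ++ end ∷ t) (b ++ end ∷ u) (d ʳ++ equals ∷ v) []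
            ⇒ st i r (code p) x (equals ∷ o) (code p ++ end ∷ t) (code q ++ end ∷ u) (equals ∷ v) (code q)
  grab-spec {B} {i} {r} {x} {o} {t} {u} {v} p q c a d b p≡ q≡ p≤ q≤ = s₁ ⨟ s₂ ⨟ s₃ ⨟ s₄
    where
    part : ∀ s c a → code s ≡ c ++ a → ∥ s ∥ ≤ B → length a ≤ B × All IsSym a
    part s c a eq s≤ =
      ℕ.≤-trans (ℕ.≤-trans (ℕ.m≤n+m (length a) (length c))
        (ℕ.≤-reflexive (≡.trans (≡.sym (≡.trans (≡.cong length eq) (length-++ c))) (length-code s)))) s≤ ,
      All.++⁻ʳ c (subst (All IsSym) eq (code-syms s))
    join : ∀ s c a z → code s ≡ c ++ a → a ʳ++ (c ʳ++ z) ≡ reverse (code s) ++ z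
    join s c a z eq = ≡.trans (≡.sym (++-ʳ++ c)) (≡.trans (≡.cong (_ʳ++ z) (≡.sym eq)) (ʳ++-defn (code s)))
    s₁ : B ⊢ _ ∶ st i r [] x (c ʳ++ equals ∷ o) (a ++ end ∷ t) (b ++ end ∷ u) (d ʳ++ equals ∷ v) []
              ⇒ st i r [] x (reverse (code p) ++ equals ∷ o) (end ∷ t) (b ++ end ∷ u) (d ʳ++ equals ∷ v) []
    s₁ = subst (λ z → B ⊢ _ ∶ _ ⇒ st i r [] x z (end ∷ t) (b ++ end ∷ u) (d ʳ++ equals ∷ v) [])
        (join p c a _ p≡)
           (sweep (λ z p _ → st i r [] x p (z ++ end ∷ t) (b ++ end ∷ u) (d ʳ++ equals ∷ v) []) id
               (λ _ → emit ⨟ pop)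
             a {q = []} (proj₁ (part p c a p≡ p≤)) (proj₂ (part p c a p≡ p≤)) refl)
    s₂ : B ⊢ _ ∶ st i r [] x (reverse (code p) ++ equals ∷ o) (end ∷ t) (b ++ end ∷ u) (d ʳ++ equals ∷ v) []
              ⇒ st i r (code p) x (equals ∷ o) (code p ++ end ∷ t) (b ++ end ∷ u) (d ʳ++ equals ∷ v) []
    s₂ = subst (λ z → B ⊢ _ ∶ st i r [] x (reverse (code p) ++ equals ∷ o) (end ∷ t) (b ++ end ∷ u)
        (d ʳ++ equals ∷ v) [] ⇒ st i r z x (equals ∷ o) (code p ++ end ∷ t) (b ++ end ∷ u)
        (d ʳ++ equals ∷ v) [])
           (++-identityʳ (code p))
           (sweepBack (λ z p q → st i r q x (z ++ equals ∷ o) p (b ++ end ∷ u) (d ʳ++ equals ∷ v) []) id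
               (λ _ → emit ⨟ emit ⨟ pop)
             (code p) (subst (_≤ B) (≡.sym (length-code p)) p≤) (code-syms p) refl)
    s₃ : B ⊢ _ ∶ st i r (code p) x (equals ∷ o) (code p ++ end ∷ t) (b ++ end ∷ u) (d ʳ++ equals ∷ v) []
              ⇒ st i r (code p) x (equals ∷ o) (code p ++ end ∷ t) (end ∷ u)
                  (reverse (code q) ++ equals ∷ v) []
    s₃ = subst (λ z → B ⊢ _ ∶ _ ⇒ st i r (code p) x (equals ∷ o) (code p ++ end ∷ t) (end ∷ u) z [])
        (join q d b _ q≡)
           (sweep (λ z p′ _ → st i r (code p) x (equals ∷ o) (code p ++ end ∷ t) (z ++ end ∷ u) p′ []) id
               (λ _ → emit ⨟ pop)
             b {q = []} (proj₁ (part q d b q≡ q≤)) (proj₂ (part q d b q≡ q≤)) refl)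
    s₄ : B ⊢ _ ∶ st i r (code p) x (equals ∷ o) (code p ++ end ∷ t) (end ∷ u)
        (reverse (code q) ++ equals ∷ v) []
              ⇒ st i r (code p) x (equals ∷ o) (code p ++ end ∷ t) (code q ++ end ∷ u) (equals ∷ v) (code q)
    s₄ = subst (λ z → B ⊢ _ ∶ st i r (code p) x (equals ∷ o) (code p ++ end ∷ t) (end ∷ u)
        (reverse (code q) ++ equals ∷ v) []
        ⇒ st i r (code p) x (equals ∷ o) (code p ++ end ∷ t) (code q ++ end ∷ u) (equals ∷ v) z)
           (++-identityʳ (code q))
           (sweepBack (λ z p′ q′ → st i r (code p) x (equals ∷ o) (code p ++ end ∷ t) p′ (z ++ equals ∷ v)
               q′) id (λ _ → emit ⨟ emit ⨟ pop)
             (code q) (subst (_≤ B) (≡.sym (length-code q)) q≤) (code-syms q) refl)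

  mergeFrom mergeTo : Merge → List Sym
  mergeFrom (just (m , _)) = code m
  mergeFrom nothing = []
  mergeTo (just (_ , m)) = code m
  mergeTo nothing = []

  entryText-++ : ∀ k v z → entryText (k ≐ v) ++ z ≡ keyText k ++ equals ∷ code v ++ end ∷ z
  entryText-++ k v z = begin
    ((keyText k ++ equals ∷ code v) ++ [ end ]) ++ z ≡⟨ ++-assoc (entryBody (k ≐ v)) [ end ] z ⟩
    (keyText k ++ equals ∷ code v) ++ end ∷ z        ≡⟨ ++-assoc (keyText k) (equals ∷ code v) (end ∷ z) ⟩
    keyText k ++ equals ∷ code v ++ end ∷ z          ∎
    where open ≡-Reasoning

  text-beforeEnd : ∀ {a} → IsText a → BeforeEnd a
  text-beforeEnd {sym f} _ = refl
  text-beforeEnd {bar} _ = refl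

  entryBody-beforeEnd : ∀ e → All BeforeEnd (entryBody e)
  entryBody-beforeEnd (k ≐ v) =
    All.++⁺ (All.map text-beforeEnd (keyText-text k))
        (refl ∷ All.map (text-beforeEnd ∘ sym-text) (code-syms v))

  -- Without its bars a key text is the code of the key; injectivity and the matching of keys with
  -- terms both rest on this.
  debar : List Sym → List Sym
  debar [] = []
  debar (bar ∷ xs) = debar xs
  debar (x ∷ xs) = x ∷ debar xs

  debar-syms : ∀ {xs} ys → All IsSym xs → debar (xs ++ ys) ≡ xs ++ debar ys
  debar-syms ys [] = refl
  debar-syms {sym _ ∷ _} ys (_ ∷ ps) = ≡.cong (_ ∷_) (debar-syms ys ps)

  debar-names : ∀ {n} (ts : Vec Term n) → debar (names ts) ≡ codes ts
  debar-names [] = refl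
  debar-names (t ∷ ts) = ≡.trans (debar-syms (names ts) (code-syms t))
      (≡.cong (code t ++_) (debar-names ts))

  debar-keyText : ∀ k → debar (keyText k) ≡ code k
  debar-keyText (node f ts) = ≡.cong (sym f ∷_) (debar-names ts)

  keyText-injective : ∀ {k l} → keyText k ≡ keyText l → k ≡ l
  keyText-injective {k} {l} eq = proj₁ (code-injective {k} {l} {[]} {[]} (≡.cong (_++ [])
    (≡.trans (≡.sym (debar-keyText k)) (≡.trans (≡.cong debar eq) (debar-keyText l)))))

  _≟ˢ_ : (a b : Sym) → Dec (a ≡ b)
  _≟ˢ_ = ≡-dec Fin._≟_ Fin._≟_

  -- One text may be a prefix of the other, hence the `equals` appended after the common part.
  -- Distinct keys then never stop with `equals` on both sides.
  Diverge : List Sym → List Sym → Set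
  Diverge xs ys = ∃[ c ] ∃[ a ] ∃[ b ] xs ≡ c ++ a × ys ≡ c ++ b × All IsText c ×
    (∀ z z′ → agree (List.head (a ++ equals ∷ z)) (List.head (b ++ equals ∷ z′)) ≡ false ×
              isEquals (List.head (a ++ equals ∷ z)) ∧ isEquals (List.head (b ++ equals ∷ z′)) ≡ false)

  diverge : ∀ xs ys → All IsText xs → All IsText ys → xs ≢ ys → Diverge xs ys
  diverge [] [] _ _ ≢ = contradiction refl ≢
  diverge [] (b ∷ ys) [] (pb ∷ _) _ =
    [] , [] , b ∷ ys , refl , refl , [] , λ _ _ → refl , text-≢-equals pb
  diverge (a ∷ xs) [] (pa ∷ _) [] _ =
    [] , a ∷ xs , [] , refl , refl , [] ,
    λ _ _ → agree-≢ {just a} {just equals} (λ { refl → contradiction pa (λ ()) }) , ≡.cong (_∧ true)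
        (text-≢-equals pa)
  diverge (a ∷ xs) (b ∷ ys) (pa ∷ ps) (pb ∷ qs) ≢ with a ≟ˢ b
  ... | no a≢b = [] , a ∷ xs , b ∷ ys , refl , refl , [] ,
    λ _ _ → agree-≢ (a≢b ∘ just-injective) , ≡.cong (_∧ isEquals (just b)) (text-≢-equals pa)
  ... | yes refl with diverge xs ys ps qs (≢ ∘ ≡.cong (a ∷_))
  ...   | c , xs′ , ys′ , refl , refl , pc , h = a ∷ c , xs′ , ys′ , refl , refl , pa ∷ pc , h

  length-prefix : ∀ (c : List Sym) {a n} → length (c ++ a) ≤ n → length c ≤ n
  length-prefix c h = ℕ.m+n≤o⇒m≤o (length c) (subst (_≤ _) (length-++ c) h)

  length-suffix : ∀ (c : List Sym) {a n} → length (c ++ a) ≤ n → length a ≤ n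
  length-suffix c h = ℕ.m+n≤o⇒n≤o (length c) (subst (_≤ _) (length-++ c) h)

  FitsEntry : ℕ → Equation → Set
  FitsEntry B e = length (entryText e) ≤ B

  body-fits : ∀ e → FitsEntry B e → length (entryBody e) ≤ B
  body-fits e = length-prefix (entryBody e)

  rhs-fits : ∀ e → FitsEntry B e → length (code (rhs e)) ≤ B
  rhs-fits (k ≐ v) h = ℕ.≤-trans (ℕ.n≤1+n _) (length-suffix (keyText k) (body-fits (k ≐ v) h))

  rhs-size-fits : ∀ e → FitsEntry B e → ∥ rhs e ∥ ≤ B
  rhs-size-fits e h = subst (_≤ _) (length-code (rhs e)) (rhs-fits e h)

  key-fits : ∀ e → FitsEntry B e → length (keyText (lhs e)) ≤ B
  key-fits e h = length-prefix (keyText (lhs e)) (body-fits e h)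

  bothEquals : Tops → Bool
  bothEquals h = isEquals (lookup h (# 5)) ∧ isEquals (lookup h (# 6))

  scanValue : Cmd
  scanValue = (mv (# 5) (# 4) ⨟ mv (# 6) (# 7)) ⨟ compareTU ⨟ cond conflictTest grab skip

  scan : Cmd
  scan = compareTU ⨟ cond bothEquals scanValue skip

  probe-none : ∀ e a e′ → ¬ Conflict e e′ → probe e a e′ ≡ a
  probe-none e (just _) e′ _ = refl
  probe-none e nothing e′ ¬c with conflict? e e′
  ... | yes c = contradiction c ¬c
  ... | no _ = refl

  probe-conflict : ∀ e e′ → Conflict e e′ → probe e nothing e′ ≡ just (rhs e′ , rhs e)
  probe-conflict e e′ c with conflict? e e′
  ... | yes _ = refl
  ... | no ¬c = contradiction c ¬c

  -- Where the scan stops depends on the case. The fields only say how moved and unmoved parts join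
  -- up to the old texts, in the form that `finish` and `restoreU` consume.
  record Scanned (B : ℕ) (i r x o t u : List Sym) (e e′ : Equation) (a a′ : Merge) : Set where
    field
      {o′ t′ u′ v′} : List Sym
      run   : B ⊢ scan ∶ st i r (mergeFrom a) x o (entryText e′ ++ t) (entryText e ++ u) [] (mergeTo a)
                      ⇒ st i r (mergeFrom a′) x o′ (t′ ++ end ∷ t) u′ v′ (mergeTo a′)
      o-eq  : t′ ʳ++ o′ ≡ entryBody e′ ʳ++ o
      u-eq  : v′ ʳ++ u′ ≡ entryText e ++ u
      v-len : length v′ ≤ B
      t-len : length t′ ≤ B
      t-end : All BeforeEnd t′

  module _ {B : ℕ} {i r x o t u : List Sym} where

    module SameKey (k v v′ : Term) (fits : FitsEntry B (k ≐ v)) (fits′ : FitsEntry B (k ≐ v′)) where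

      key≤ : length (keyText k) ≤ B
      key≤ = key-fits (k ≐ v) fits

      o₁ v₁ : List Sym
      o₁ = equals ∷ keyText k ʳ++ o
      v₁ = equals ∷ keyText k ʳ++ []

      o₁-eq : ∀ {s} c a → code s ≡ c ++ a → a ʳ++ (c ʳ++ o₁) ≡ entryBody (k ≐ s) ʳ++ o
      o₁-eq {s} c a eq = ≡.trans (≡.sym (++-ʳ++ c))
          (≡.trans (≡.cong (_ʳ++ o₁) (≡.sym eq)) (≡.sym (++-ʳ++ (keyText k))))

      v₁-eq : ∀ {s} c a z → code s ++ end ∷ z ≡ c ++ a → (c ʳ++ v₁) ʳ++ a ≡ entryText (k ≐ s) ++ z
      v₁-eq {s} c a z eq = begin
        (c ʳ++ v₁) ʳ++ a                      ≡⟨ ʳ++-ʳ++ c ⟩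
        v₁ ʳ++ c ++ a                         ≡⟨ ≡.cong (v₁ ʳ++_) eq ⟨
        (keyText k ʳ++ []) ʳ++ equals ∷ code s ++ end ∷ z ≡⟨ ʳ++-ʳ++ (keyText k) ⟩
        keyText k ++ equals ∷ code s ++ end ∷ z ≡⟨ entryText-++ k s z ⟨
        entryText (k ≐ s) ++ z                ∎
        where open ≡-Reasoning

      v₁-len : ∀ c a → code v ≡ c ++ a → length (c ʳ++ v₁) ≤ B
      v₁-len c a eq = begin
        length (c ʳ++ v₁)                       ≡⟨ List.length-ʳ++ c ⟩
        length c + suc (length (keyText k ʳ++ [])) ≡⟨ ≡.cong (λ n → length c + suc n)
            (≡.trans (List.length-ʳ++ (keyText k)) (ℕ.+-identityʳ _)) ⟩
        length c + suc (length (keyText k))     ≤⟨ ℕ.+-monoˡ-≤ _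
            (ℕ.≤-trans (ℕ.m≤m+n (length c) (length a))
            (ℕ.≤-reflexive (≡.sym (≡.trans (≡.cong length eq) (length-++ c))))) ⟩
        length (code v) + suc (length (keyText k)) ≡⟨ ℕ.+-suc (length (code v)) _ ⟩
        suc (length (code v)) + length (keyText k) ≡⟨ ℕ.+-comm (suc (length (code v))) _ ⟩
        length (keyText k) + suc (length (code v)) ≡⟨ length-++ (keyText k) ⟨
        length (entryBody (k ≐ v))              ≤⟨ body-fits (k ≐ v) fits ⟩
        B                                       ∎
        where open ℕ.≤-Reasoning

      run-key : ∀ a {τ} →
        B ⊢ scanValue ∶ st i r (mergeFrom a) x (keyText k ʳ++ o) (equals ∷ code v′ ++ end ∷ t)
            (equals ∷ code v ++ end ∷ u) (keyText k ʳ++ []) (mergeTo a) ⇒ τ →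
        B ⊢ scan ∶ st i r (mergeFrom a) x o (entryText (k ≐ v′) ++ t) (entryText (k ≐ v) ++ u) []
            (mergeTo a) ⇒ τ
      run-key a d rewrite entryText-++ k v′ t | entryText-++ k v u =
        compareTU-spec (keyText k) key≤ (keyText-text k) refl ⨟ cond-true refl d

      run-value : ∀ a c b′ b → code v′ ≡ c ++ b′ → code v ≡ c ++ b →
        agree (List.head (b′ ++ end ∷ t)) (List.head (b ++ end ∷ u)) ≡ false → ∀ {τ} →
        B ⊢ cond conflictTest grab skip ∶ st i r (mergeFrom a) x (c ʳ++ o₁) (b′ ++ end ∷ t) (b ++ end ∷ u)
            (c ʳ++ v₁) (mergeTo a) ⇒ τ →
        B ⊢ scan ∶ st i r (mergeFrom a) x o (entryText (k ≐ v′) ++ t) (entryText (k ≐ v) ++ u) []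
            (mergeTo a) ⇒ τ
      run-value a c b′ b eq′ eq dis {τ} d = run-key a (((emit ⨟ pop) ⨟ emit ⨟ pop) ⨟ compare ⨟ d)
        where
        compare : B ⊢ compareTU ∶ st i r (mergeFrom a) x o₁ (code v′ ++ end ∷ t) (code v ++ end ∷ u) v₁
            (mergeTo a) ⇒
                      st i r (mergeFrom a) x (c ʳ++ o₁) (b′ ++ end ∷ t) (b ++ end ∷ u) (c ʳ++ v₁)
                          (mergeTo a)
        compare = ≡.subst₂ (λ y z → B ⊢ compareTU ∶ st i r (mergeFrom a) x o₁ y z v₁ (mergeTo a) ⇒
                      st i r (mergeFrom a) x (c ʳ++ o₁) (b′ ++ end ∷ t) (b ++ end ∷ u) (c ʳ++ v₁)
                          (mergeTo a))
          (≡.sym (≡.trans (≡.cong (_++ end ∷ t) eq′) (++-assoc c b′ (end ∷ t))))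
          (≡.sym (≡.trans (≡.cong (_++ end ∷ u) eq) (++-assoc c b (end ∷ u))))
          (compareTU-spec c
            (length-prefix c (subst (λ z → length z ≤ B) eq (rhs-fits (k ≐ v) fits)))
            (All.map sym-text (All.++⁻ˡ c (subst (All IsSym) eq (code-syms v)))) dis)

    no-conflict : ∀ k v v′ a c b′ b → FitsEntry B (k ≐ v) → FitsEntry B (k ≐ v′) → code v′ ≡ c ++ b′ →
        code v ≡ c ++ b →
      agree (List.head (b′ ++ end ∷ t)) (List.head (b ++ end ∷ u)) ≡ false →
      is-nothing (List.head (mergeFrom a)) ∧ less (List.head (b ++ end ∷ u)) (List.head (b′ ++ end ∷ t))
          ≡ false →
      Scanned B i r x o t u (k ≐ v) (k ≐ v′) a a
    no-conflict k v v′ a c b′ b fits fits′ eq′ eq dis test = record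
      { run = run-value a c b′ b eq′ eq dis (cond-false test emit)
      ; o-eq = o₁-eq c b′ eq′
      ; u-eq = v₁-eq c (b ++ end ∷ u) u (≡.trans (≡.cong (_++ end ∷ u) eq) (++-assoc c b (end ∷ u)))
      ; v-len = v₁-len c b eq
      ; t-len = length-suffix c (subst (λ z → length z ≤ B) eq′ (rhs-fits (k ≐ v′) fits′))
      ; t-end = All.map (text-beforeEnd ∘ sym-text) (All.++⁻ʳ c (subst (All IsSym) eq′ (code-syms v′)))
      }
      where open SameKey k v v′ fits fits′

    conflict : ∀ k v v′ → FitsEntry B (k ≐ v) → FitsEntry B (k ≐ v′) → v ≺ v′ →
      Scanned B i r x o t u (k ≐ v) (k ≐ v′) nothing (just (v′ , v))
    conflict k v v′ fits fits′ v≺v′ with divergence v≺v′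
    ... | c , f , g , b , b′ , eq , eq′ , f<g = record
      { run = run-value nothing c (sym g ∷ b′) (sym f ∷ b) eq′ eq
                (agree-≢ (λ g≡f → ℕ.<-irrefl (≡.cong Fin.toℕ (inj₁-injective (≡.sym (just-injective g≡f))))
                    f<g))
                (cond-true (dec-true (f Fin.<? g) f<g)
                  (grab-spec v′ v c (sym g ∷ b′) c (sym f ∷ b) eq′ eq (rhs-size-fits (k ≐ v′) fits′)
                      (rhs-size-fits (k ≐ v) fits)))
      ; o-eq = o₁-eq {v′} [] (code v′) refl
      ; u-eq = v₁-eq [] (code v ++ end ∷ u) u refl
      ; v-len = v₁-len [] (code v) refl
      ; t-len = rhs-fits (k ≐ v′) fits′
      ; t-end = All.map (text-beforeEnd ∘ sym-text) (code-syms v′)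
      }
      where open SameKey k v v′ fits fits′

    different-key : ∀ e e′ a → FitsEntry B e → FitsEntry B e′ → lhs e ≢ lhs e′ →
        Scanned B i r x o t u e e′ a a
    different-key (k ≐ v) (k′ ≐ v′) a fits fits′ k≢k′
      with diverge (keyText k′) (keyText k) (keyText-text k′) (keyText-text k)
          (k≢k′ ∘ ≡.sym ∘ keyText-injective)
    ... | c , b′ , b , eq′ , eq , text , h = record
      { run = ≡.subst₂ (λ p q → B ⊢ scan ∶ st i r (mergeFrom a) x o p q [] (mergeTo a) ⇒
                                  st i r (mergeFrom a) x (c ʳ++ o) (t′ ++ end ∷ t) u′ (c ʳ++ [])
                                      (mergeTo a))
                (≡.sym t-eq) (≡.sym u-eq′)
                (compareTU-spec c (length-prefix c (subst (λ z → length z ≤ B) eq (key-fits (k ≐ v) fits)))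
                    text
                   (subst (λ z → agree (List.head z) (List.head u′) ≡ false)
                       (≡.sym (++-assoc b′ (equals ∷ code v′) (end ∷ t))) (proj₁ (h _ _))) ⨟
                 cond-false (subst (λ z → isEquals (List.head z) ∧ isEquals (List.head u′) ≡ false)
                     (≡.sym (++-assoc b′ (equals ∷ code v′) (end ∷ t))) (proj₂ (h _ _))) emit)
      ; o-eq = ≡.trans (≡.sym (++-ʳ++ c)) (≡.cong (_ʳ++ o) body-eq)
      ; u-eq = ≡.trans (ʳ++-ʳ++ c) (≡.sym u-eq′)
      ; v-len = subst (_≤ B) (≡.sym (≡.trans (List.length-ʳ++ c) (ℕ.+-identityʳ _)))
                  (length-prefix c (subst (λ z → length z ≤ B) eq (key-fits (k ≐ v) fits)))
      ; t-len = length-suffix c (subst (λ z → length z ≤ B) (≡.sym body-eq) (body-fits (k′ ≐ v′) fits′))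
      ; t-end = All.++⁻ʳ c (subst (All BeforeEnd) (≡.sym body-eq) (entryBody-beforeEnd (k′ ≐ v′)))
      }
      where
      t′ = b′ ++ equals ∷ code v′
      u′ = b ++ equals ∷ code v ++ end ∷ u
      body-eq : c ++ t′ ≡ entryBody (k′ ≐ v′)
      body-eq = ≡.trans (≡.sym (++-assoc c b′ _)) (≡.cong (_++ equals ∷ code v′) (≡.sym eq′))
      t-eq : entryText (k′ ≐ v′) ++ t ≡ c ++ t′ ++ end ∷ t
      t-eq = ≡.trans (++-assoc (entryBody (k′ ≐ v′)) [ end ] t)
          (≡.trans (≡.cong (_++ end ∷ t) (≡.sym body-eq)) (++-assoc c t′ (end ∷ t)))
      u-eq′ : entryText (k ≐ v) ++ u ≡ c ++ u′
      u-eq′ = ≡.trans (entryText-++ k v u)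
          (≡.trans (≡.cong (_++ equals ∷ code v ++ end ∷ u) eq) (++-assoc c b _))

    scanned : ∀ e e′ a → FitsEntry B e → FitsEntry B e′ → Scanned B i r x o t u e e′ a (probe e a e′)
    scanned e@(k ≐ v) e′@(k′ ≐ v′) a fits fits′ with k ≟ k′
    ... | no k≢k′ rewrite probe-none e a e′ (k≢k′ ∘ proj₁) = different-key e e′ a fits fits′ k≢k′
    ... | yes refl with ≺-compare v v′
    -- Equal values: both rests are empty and the comparison stops at the two `end` marks.
    ...   | tri≈ v⊀v′ refl _ rewrite probe-none e a e′ (v⊀v′ ∘ proj₂) =
            no-conflict k v v a (code v) [] [] fits fits′ (≡.sym (++-identityʳ _)) (≡.sym (++-identityʳ _))
                refl (∧-zeroʳ _)
    ...   | tri> v⊀v′ _ v′≺v rewrite probe-none e a e′ (v⊀v′ ∘ proj₂) with divergence v′≺v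
    ...     | c , f , g , b′ , b , eq′ , eq , f<g =
            no-conflict k v v′ a c (sym f ∷ b′) (sym g ∷ b) fits fits′ eq′ eq
              (agree-≢ (λ f≡g → ℕ.<-irrefl (≡.cong Fin.toℕ (inj₁-injective (just-injective f≡g))) f<g))
              (≡.trans (≡.cong (is-nothing (List.head (mergeFrom a)) ∧_)
                  (dec-false (g Fin.<? f) (ℕ.<-asym f<g))) (∧-zeroʳ _))
    scanned e@(k ≐ v) e′@(k′ ≐ v′) nothing fits fits′ | yes refl | tri< v≺v′ _ _
      rewrite probe-conflict e e′ (refl , v≺v′) = conflict k v v′ fits fits′ v≺v′
    -- Matching on `node` exposes a first letter of `code m`, so stack 2 is visibly nonempty and the
    -- test fails.
    scanned e@(k ≐ v) e′@(k′ ≐ v′) (just (m@(node _ _) , m′)) fits fits′ | yes refl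
        | tri< v≺v′ _ _ with divergence v≺v′
    ... | c , f , g , b , b′ , eq , eq′ , f<g =
            no-conflict k v v′ (just (m , m′)) c (sym g ∷ b′) (sym f ∷ b) fits fits′ eq′ eq
              (agree-≢ (λ g≡f → ℕ.<-irrefl (≡.cong Fin.toℕ (inj₁-injective (≡.sym (just-injective g≡f))))
                  f<g)) refl

  FitsTable : ℕ → Table → Set
  FitsTable B T = length (tableText T) ≤ B

  fits-head : ∀ e T → FitsTable B (e ∷ T) → FitsEntry B e
  fits-head e T = length-prefix (entryText e)

  fits-tail : ∀ e T → FitsTable B (e ∷ T) → FitsTable B T
  fits-tail e T = length-suffix (entryText e)

  fits-length : ∀ T → FitsTable B T → length T ≤ B
  fits-length T = ℕ.≤-trans (shorter T)
    where
    shorter : ∀ T → length T ≤ length (tableText T)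
    shorter [] = z≤n
    shorter (e@(node f ts ≐ v) ∷ T) =
      s≤s (ℕ.≤-trans (shorter T) (subst (length (tableText T) ≤_)
          (≡.sym (length-++ ((names ts ++ equals ∷ code v) ++ [ end ]))) (ℕ.m≤n+m _ _)))

  probeEntry : Cmd
  probeEntry = scan ⨟ finish ⨟ restoreU

  probeEntry-spec : ∀ e a e′ → FitsEntry B e → FitsEntry B e′ →
    B ⊢ probeEntry ∶ st i r (mergeFrom a) x o (entryText e′ ++ t) (entryText e ++ u) [] (mergeTo a)
      ⇒ st i r (mergeFrom (probe e a e′)) x (entryText e′ ʳ++ o) t (entryText e ++ u) []
          (mergeTo (probe e a e′))
  probeEntry-spec {B} {i} {r} {x} {o} {t} {u} e a e′ fits fits′ =
    run ⨟
    subst (λ z → B ⊢ finish ∶ st i r (mergeFrom a′) x o′ (t′ ++ end ∷ t) u′ v′ (mergeTo a′)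
        ⇒ st i r (mergeFrom a′) x z t u′ v′ (mergeTo a′))
      (≡.trans (≡.cong (end ∷_) o-eq) (≡.sym (++-ʳ++ (entryBody e′)))) (finish-spec t′ t-len t-end) ⨟
    subst (λ z → B ⊢ restoreU ∶ st i r (mergeFrom a′) x (entryText e′ ʳ++ o) t u′ v′ (mergeTo a′)
        ⇒ st i r (mergeFrom a′) x (entryText e′ ʳ++ o) t z [] (mergeTo a′))
      u-eq (restoreU-spec v-len)
    where
    a′ = probe e a e′
    open Scanned (scanned {B} {i} {r} {x} {o} {t} {u} e e′ a fits fits′)

  probe-loop : ∀ e a T → FitsEntry B e → FitsTable B T →
    B ⊢ on (# 5) is-just / probeEntry ∶ st i r (mergeFrom a) x o (tableText T) (entryText e ++ u) []
        (mergeTo a)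
      ⇒[ length T ] st i r (mergeFrom (foldl (probe e) a T)) x (tableText T ʳ++ o) [] (entryText e ++ u) []
          (mergeTo (foldl (probe e) a T))
  probe-loop e a [] _ _ = stop
  probe-loop {o = o} e a (e′@(node _ _ ≐ _) ∷ T) fits fitsT rewrite ++-ʳ++ (entryText e′) {tableText T}
      {o} =
    iter refl (probeEntry-spec e a e′ fits (fits-head e′ T fitsT))
        (probe-loop e (probe e a e′) T fits (fits-tail e′ T fitsT))

  probeTable : Cmd
  probeTable = while (on (# 5) is-just) probeEntry ⨟ rewind ⨟ while (on (# 6) beforeEnd) (pop (# 6)) ⨟
      pop (# 6)

  probeTable-spec : ∀ e a T → FitsEntry B e → FitsTable B T →
    B ⊢ probeTable ∶ st i r (mergeFrom a) x [] (tableText T) (entryText e ++ u) [] (mergeTo a)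
      ⇒ st i r (mergeFrom (probeAll T a e)) x [] (tableText T) u [] (mergeTo (probeAll T a e))
  probeTable-spec {B} {i} {r} {x} {u} e a T fits fitsT =
    loop (fits-length T fitsT) (probe-loop e a T fits fitsT) refl ⨟ rewind-spec (tableText T) fitsT ⨟
        drop-entry
    where
    a′ = probeAll T a e
    drop-entry : B ⊢ while (on (# 6) beforeEnd) (pop (# 6)) ⨟ pop (# 6) ∶
                 st i r (mergeFrom a′) x [] (tableText T) (entryText e ++ u) [] (mergeTo a′)
                     ⇒ st i r (mergeFrom a′) x [] (tableText T) u [] (mergeTo a′)
    drop-entry rewrite ++-assoc (entryBody e) [ end ] u =
      sweep (λ z _ _ → st i r (mergeFrom a′) x [] (tableText T) (z ++ end ∷ u) [] (mergeTo a′)) id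
          (λ _ → pop)
        (entryBody e) {[]} {[]} (body-fits e fits) (entryBody-beforeEnd e) refl ⨟ pop

  probeTable-loop : ∀ a T U → FitsTable B T → FitsTable B U →
    B ⊢ on (# 6) is-just / probeTable ∶ st i r (mergeFrom a) x [] (tableText T) (tableText U) [] (mergeTo a)
      ⇒[ length U ] st i r (mergeFrom (foldl (probeAll T) a U)) x [] (tableText T) [] []
          (mergeTo (foldl (probeAll T) a U))
  probeTable-loop a T [] _ _ = stop
  probeTable-loop a T (e@(node _ _ ≐ _) ∷ U) fitsT fitsU =
    iter refl (probeTable-spec e a T (fits-head e U fitsU) fitsT)
        (probeTable-loop (probeAll T a e) T U fitsT (fits-tail e U fitsU))

  -- The copy on stack 6 supplies the entries of the outer fold; for each of them the table on stack
  -- 5 is traversed and rewound.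
  findConflict : Cmd
  findConflict = while (on (# 5) is-just) (mv (# 5) (# 4)) ⨟
      while (on (# 4) is-just) (emit (# 4) (# 6) id ⨟ mv (# 4) (# 5)) ⨟
                 while (on (# 6) is-just) probeTable

  findConflict-spec : ∀ T → FitsTable B T →
    B ⊢ findConflict ∶ st i r [] x [] (tableText T) [] [] []
        ⇒ st i r (mergeFrom (search T)) x [] (tableText T) [] [] (mergeTo (search T))
  findConflict-spec {B} {i} {r} {x} T fits =
    sweep (λ z p _ → st i r [] x p z [] [] []) (λ _ → refl) (λ _ → emit ⨟ pop) (tableText T) {q = []} fits
        (everything _) refl ⨟
    copy ⨟ loop (fits-length T fits) (probeTable-loop nothing T T fits fits) refl
    where
    copy : B ⊢ _ ∶ st i r [] x (reverse (tableText T)) [] [] [] []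
        ⇒ st i r [] x [] (tableText T) (tableText T) [] []
    copy = subst (λ z → B ⊢ _ ∶ st i r [] x (reverse (tableText T)) [] [] [] []
        ⇒ st i r [] x [] z z [] []) (++-identityʳ (tableText T))
             (sweepBack (λ z p q → st i r [] x z p q [] []) (λ _ → refl) (λ _ → emit ⨟ emit ⨟ pop)
                 (tableText T) fits (everything _) refl)

  -- Replacing a name throughout the table

  compareTM : Cmd
  compareTM = while (agreeOn (# 5) (# 2)) (mv (# 5) (# 4) ⨟ mv (# 2) (# 3))

  compareTM-spec : ∀ c {a b} → length c ≤ B → All IsSym c → agree (List.head a) (List.head b) ≡ false →
    B ⊢ compareTM ∶ st i r (c ++ b) x o (c ++ a) u v w ⇒ st i r b (c ʳ++ x) (c ʳ++ o) a u v w
  compareTM-spec {i = i} {r} {u = u} {v} {w} c {a} {b} c≤ syms =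
    sweep (λ z p q → st i r (z ++ b) q p (z ++ a) u v w) sym-text (λ _ → (emit ⨟ pop) ⨟ emit ⨟ pop) c c≤
        syms

  -- The copied letters are removed down to the mark before the name. Stack 1, empty by now, saves
  -- the new name while it is written.
  hit : Cmd
  hit = while (on (# 4) isSym) (pop (# 4)) ⨟
      while (on (# 8) is-just) (emit (# 8) (# 4) id ⨟ mv (# 8) (# 1)) ⨟
        while (on (# 1) is-just) (mv (# 1) (# 8))

  -- If stack 2 is used up, the old name is a prefix of the name at hand and hence equal to it,
  -- since codes of terms are prefix-free.
  replaceName : Cmd
  replaceName = mv (# 5) (# 4) ⨟ compareTM ⨟
      cond (on (# 2) is-nothing) hit (while (on (# 5) isSym) (mv (# 5) (# 4))) ⨟ restore

  agree-nothing : ∀ a → agree a nothing ≡ false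
  agree-nothing nothing = refl
  agree-nothing (just (sym _)) = refl
  agree-nothing (just equals) = refl
  agree-nothing (just end) = refl
  agree-nothing (just bar) = refl

  name-miss : ∀ m m′ s {a} c f g b d → code s ≡ c ++ sym f ∷ b → code m ≡ c ++ sym g ∷ d → f ≢ g →
    ∥ s ∥ ≤ B → isSym (List.head t) ≡ false →
    B ⊢ replaceName ∶ st i [] (code m) [] o (a ∷ code s ++ t) u v (code m′)
        ⇒ st i [] (code m) [] (code s ʳ++ (a ∷ o)) t u v (code m′)
  name-miss {B} {t} {i} {o} {u} {v} m m′ s {a} c f g b d s≡ m≡ f≢g s≤ t-mark =
    (emit ⨟ pop) ⨟ compare ⨟
    cond-false refl (sweep (λ z p _ → st i [] (sym g ∷ d) (reverse c) p (z ++ t) u v (code m′)) id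
        (λ _ → emit ⨟ pop)
                      (sym f ∷ b) {q = []} (length-suffix c len) (All.++⁻ʳ c syms) t-mark) ⨟
    ≡.subst₂ (λ p q → B ⊢ restore ∶ st i [] (sym g ∷ d) (reverse c) ((sym f ∷ b) ʳ++ (c ʳ++ a ∷ o)) t u v
        (code m′) ⇒ st i [] p [] q t u v (code m′))
      (≡.trans (ʳ++-ʳ++ c) (≡.sym m≡)) join
      (restore-spec (subst (_≤ B) (≡.sym (List.length-reverse c)) (length-prefix c len)))
    where
    len : length (c ++ sym f ∷ b) ≤ B
    len = subst (_≤ B) (≡.trans (≡.sym (length-code s)) (≡.cong length s≡)) s≤
    syms : All IsSym (c ++ sym f ∷ b)
    syms = subst (All IsSym) s≡ (code-syms s)
    join : (sym f ∷ b) ʳ++ (c ʳ++ a ∷ o) ≡ code s ʳ++ a ∷ o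
    join = ≡.trans (≡.sym (++-ʳ++ c)) (≡.cong (_ʳ++ a ∷ o) (≡.sym s≡))
    compare : B ⊢ compareTM ∶ st i [] (code m) [] (a ∷ o) (code s ++ t) u v (code m′) ⇒
                st i [] (sym g ∷ d) (reverse c) (c ʳ++ a ∷ o) (sym f ∷ b ++ t) u v (code m′)
    compare = ≡.subst₂ (λ p q → B ⊢ compareTM ∶ st i [] p [] (a ∷ o) q u v (code m′) ⇒
                st i [] (sym g ∷ d) (reverse c) (c ʳ++ a ∷ o) (sym f ∷ b ++ t) u v (code m′))
                (≡.sym m≡) (≡.sym (≡.trans (≡.cong (_++ t) s≡) (++-assoc c (sym f ∷ b) t)))
                (compareTM-spec c (length-prefix c len) (All.++⁻ˡ c syms)
                    (agree-≢ (f≢g ∘ inj₁-injective ∘ just-injective)))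

  replaceName-spec : ∀ m m′ s {a} → ∥ m′ ∥ ≤ B → ∥ s ∥ ≤ B → isSym (just a) ≡ false →
      isSym (List.head t) ≡ false →
    B ⊢ replaceName ∶ st i [] (code m) [] o (a ∷ code s ++ t) u v (code m′)
                    ⇒ st i [] (code m) [] (code ((m ↦ m′) s) ʳ++ (a ∷ o)) t u v (code m′)
  replaceName-spec {B} {t} {i} {o} {u} {v} m m′ s {a} m′≤ s≤ a-mark t-mark with ≺-compare s m
  ... | tri≈ _ refl _ =
    (emit ⨟ pop) ⨟ compare ⨟ cond-true refl (h₁ ⨟ h₂ ⨟ h₃) ⨟
    subst (λ z → B ⊢ restore ∶ st i [] [] (reverse (code s)) (code m′ ʳ++ a ∷ o) t u v (code m′)
        ⇒ st i [] z [] (code m′ ʳ++ a ∷ o) t u v (code m′))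
      (≡.trans (ʳ++-ʳ++ (code s)) (++-identityʳ _))
      (restore-spec (subst (_≤ B) (≡.sym (List.length-reverse (code s))) len))
    where
    len : length (code s) ≤ B
    len = subst (_≤ B) (≡.sym (length-code s)) s≤
    compare : B ⊢ compareTM ∶ st i [] (code s) [] (a ∷ o) (code s ++ t) u v (code m′)
        ⇒ st i [] [] (reverse (code s)) (code s ʳ++ a ∷ o) t u v (code m′)
    compare = subst (λ z → B ⊢ compareTM ∶ st i [] z [] (a ∷ o) (code s ++ t) u v (code m′)
        ⇒ st i [] [] (reverse (code s)) (code s ʳ++ a ∷ o) t u v (code m′))
                (++-identityʳ (code s)) (compareTM-spec (code s) len (code-syms s)
                    (agree-nothing (List.head t)))
    h₁ : B ⊢ _ ∶ st i [] [] (reverse (code s)) (code s ʳ++ a ∷ o) t u v (code m′)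
        ⇒ st i [] [] (reverse (code s)) (a ∷ o) t u v (code m′)
    h₁ = subst (λ z → B ⊢ _ ∶ st i [] [] (reverse (code s)) z t u v (code m′)
        ⇒ st i [] [] (reverse (code s)) (a ∷ o) t u v (code m′)) (≡.sym (ʳ++-defn (code s)))
           (sweep (λ z _ _ → st i [] [] (reverse (code s)) (z ++ a ∷ o) t u v (code m′)) id (λ _ → pop)
               (reverse (code s)) {[]} {[]}
             (subst (_≤ B) (≡.sym (List.length-reverse (code s))) len) (ʳ++⁺ (code-syms s) []) a-mark)
    len′ : length (code m′) ≤ B
    len′ = subst (_≤ B) (≡.sym (length-code m′)) m′≤
    h₂ : B ⊢ _ ∶ st i [] [] (reverse (code s)) (a ∷ o) t u v (code m′)
        ⇒ st i (reverse (code m′)) [] (reverse (code s)) (code m′ ʳ++ a ∷ o) t u v []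
    h₂ = sweep (λ z p q → st i q [] (reverse (code s)) p t u v z) (λ _ → refl) (λ _ → emit ⨟ emit ⨟ pop)
        (code m′) len′ (everything _) refl
    h₃ : B ⊢ _ ∶ st i (reverse (code m′)) [] (reverse (code s)) (code m′ ʳ++ a ∷ o) t u v []
        ⇒ st i [] [] (reverse (code s)) (code m′ ʳ++ a ∷ o) t u v (code m′)
    h₃ = subst (λ z → B ⊢ _ ∶ st i (reverse (code m′)) [] (reverse (code s)) (code m′ ʳ++ a ∷ o) t u v []
        ⇒ st i [] [] (reverse (code s)) (code m′ ʳ++ a ∷ o) t u v z)
           (++-identityʳ (code m′))
           (sweepBack (λ z p _ → st i z [] (reverse (code s)) (code m′ ʳ++ a ∷ o) t u v p) (λ _ → refl)
               (λ _ → emit ⨟ pop) (code m′) {q = []} len′ (everything _) refl)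
  ... | tri< s≺m s≢m _ with divergence s≺m
  ...   | c , f , g , b , d , s≡ , m≡ , f<g =
    name-miss m m′ s c f g b d s≡ m≡ (λ { refl → ℕ.<-irrefl refl f<g }) s≤ t-mark
  replaceName-spec m m′ s m′≤ s≤ a-mark t-mark | tri> _ s≢m m≺s with divergence m≺s
  ... | c , g , f , d , b , m≡ , s≡ , g<f =
    name-miss m m′ s c f g b d s≡ m≡ (λ { refl → ℕ.<-irrefl refl g<f }) s≤ t-mark

  -- Arguments and value are treated alike, each being a name behind a mark; the loop therefore
  -- makes one round more than the arity.
  replaceEntry : Cmd
  replaceEntry = mv (# 5) (# 4) ⨟ while (on (# 5) beforeEnd) replaceName ⨟ mv (# 5) (# 4)

  replaceNames-loop : ∀ m m′ {n} (ts : Vec Term n) → ∥ m′ ∥ ≤ B → VAll (λ s → ∥ s ∥ ≤ B) ts →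
      isSym (List.head t) ≡ false →
    B ⊢ on (# 5) beforeEnd / replaceName ∶ st i [] (code m) [] o (names ts ++ t) u v (code m′)
      ⇒[ n ] st i [] (code m) [] (names (Vec.map (m ↦ m′) ts) ʳ++ o) t u v (code m′)
  replaceNames-loop m m′ [] _ _ _ = stop
  replaceNames-loop {t = t} {o = o} m m′ (s ∷ ts) m′≤ (s≤ ∷ ts≤) t-mark
    rewrite ++-assoc (code s) (names ts) t
        | ++-ʳ++ (code ((m ↦ m′) s)) {names (Vec.map (m ↦ m′) ts)} {bar ∷ o} =
    iter refl (replaceName-spec m m′ s m′≤ s≤ refl (mark ts)) (replaceNames-loop m m′ ts m′≤ ts≤ t-mark)
    where
    mark : ∀ {n} (ts : Vec Term n) → isSym (List.head (names ts ++ t)) ≡ false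
    mark [] = t-mark
    mark (_ ∷ _) = refl

  -- A merge may enlarge the key of an entry, but never its arity.
  Small : ℕ → Equation → Set
  Small N (node f ts ≐ v) = VAll (λ s → ∥ s ∥ ≤ N) ts × arity f ≤ N × ∥ v ∥ ≤ N

  replaceEntry-spec : ∀ m m′ e {N} → Small N e → ∥ m′ ∥ ≤ N → suc N ≤ B →
    B ⊢ replaceEntry ∶ st i [] (code m) [] o (entryText e ++ t) u v (code m′)
                     ⇒ st i [] (code m) [] (entryText (rename (m ↦ m′) e) ʳ++ o) t u v (code m′)
  replaceEntry-spec {B} {i} {o} {t} {u} {v} m m′ (node f ts ≐ s) {N} (ts≤ , n≤ , s≤) m′≤ N<B
    rewrite entryText-++ (node f ts) s t
        | ≡.sym (entryText-ʳ++ (node f (Vec.map (m ↦ m′) ts)) ((m ↦ m′) s) o) =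
    (emit ⨟ pop) ⨟
    loop (subst (_≤ B) (ℕ.+-comm 1 (arity f)) (ℕ.≤-trans (s≤s n≤) N<B))
      (replaceNames-loop m m′ ts m′≤B (VAll.map (λ h → ℕ.≤-trans h N≤B) ts≤) refl ⊹
       iter refl (replaceName-spec m m′ s m′≤B (ℕ.≤-trans s≤ N≤B) refl refl) stop) refl ⨟
    emit ⨟ pop
    where
    N≤B = ℕ.≤-trans (ℕ.n≤1+n N) N<B
    m′≤B = ℕ.≤-trans m′≤ N≤B

  replaceAll : Cmd
  replaceAll = while (on (# 5) is-just) replaceEntry ⨟ rewind

  replaceEntries-loop : ∀ m m′ T {N} → All (Small N) T → ∥ m′ ∥ ≤ N → suc N ≤ B →
    B ⊢ on (# 5) is-just / replaceEntry ∶ st i [] (code m) [] o (tableText T) u v (code m′)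
      ⇒[ length T ] st i [] (code m) [] (tableText (map (rename (m ↦ m′)) T) ʳ++ o) [] u v (code m′)
  replaceEntries-loop m m′ [] _ _ _ = stop
  replaceEntries-loop {o = o} m m′ (e@(node _ _ ≐ _) ∷ T) (e≤ ∷ T≤) m′≤ N<B
    rewrite ++-ʳ++ (entryText (rename (m ↦ m′) e)) {tableText (map (rename (m ↦ m′)) T)} {o} =
    iter refl (replaceEntry-spec m m′ e e≤ m′≤ N<B) (replaceEntries-loop m m′ T T≤ m′≤ N<B)

  replaceAll-spec : ∀ m m′ T {N} → All (Small N) T → ∥ m′ ∥ ≤ N → suc N ≤ B → length T ≤ B →
    FitsTable B (map (rename (m ↦ m′)) T) →
    B ⊢ replaceAll ∶ st i [] (code m) [] [] (tableText T) u v (code m′)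
                   ⇒ st i [] (code m) [] [] (tableText (map (rename (m ↦ m′)) T)) u v (code m′)
  replaceAll-spec m m′ T T≤ m′≤ N<B len fits =
    loop len (replaceEntries-loop m m′ T T≤ m′≤ N<B) refl ⨟
        rewind-spec (tableText (map (rename (m ↦ m′)) T)) fits

  -- The saturation loop and its space bound

  mergeStep : Cmd
  mergeStep = replaceAll ⨟ while (on (# 2) is-just) (pop (# 2)) ⨟ while (on (# 8) is-just) (pop (# 8)) ⨟
      findConflict

  saturateTable : Cmd
  saturateTable = findConflict ⨟ while (on (# 2) is-just) mergeStep

  -- Three letters for the root, `equals` and `end`; at most N arguments of at most N letters and a
  -- bar; at most N letters for the value.
  entrySize : ℕ → ℕ
  entrySize N = 3 + (N * suc N + N)

  length-names : ∀ {n} (ts : Vec Term n) {N} → VAll (λ s → ∥ s ∥ ≤ N) ts → length (names ts) ≤ n * suc N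
  length-names [] [] = z≤n
  length-names (t ∷ ts) (t≤ ∷ ts≤) = s≤s (subst (_≤ _) (≡.sym (length-++ (code t)))
    (ℕ.+-mono-≤ (subst (_≤ _) (≡.sym (length-code t)) t≤) (length-names ts ts≤)))

  length-entry : ∀ e {N} → Small N e → length (entryText e) ≤ entrySize N
  length-entry (node f ts ≐ s) {N} (ts≤ , n≤ , s≤) = begin
    suc (length ((names ts ++ equals ∷ code s) ++ [ end ]))
      ≡⟨ ≡.cong suc (≡.trans (length-++ (names ts ++ equals ∷ code s))
          (≡.cong (_+ 1) (length-++ (names ts)))) ⟩
    suc (length (names ts) + suc (length (code s)) + 1)
      ≤⟨ s≤s (ℕ.+-monoˡ-≤ 1 (ℕ.+-mono-≤ (ℕ.≤-trans (length-names ts ts≤) (ℕ.*-monoˡ-≤ (suc N) n≤))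
                                          (s≤s (subst (_≤ N) (≡.sym (length-code s)) s≤)))) ⟩
    suc (N * suc N + suc N + 1) ≡⟨ ≡.cong suc
        (≡.trans (ℕ.+-comm (N * suc N + suc N) 1) (≡.cong suc (ℕ.+-suc (N * suc N) N))) ⟩
    entrySize N ∎
    where open ℕ.≤-Reasoning hiding (equals)

  length-tableText : ∀ T {N} → All (Small N) T → length (tableText T) ≤ length T * entrySize N
  length-tableText [] [] = z≤n
  length-tableText (e ∷ T) (e≤ ∷ T≤) =
      subst (_≤ _) (≡.sym (length-++ (entryText e)))
      (ℕ.+-mono-≤ (length-entry e e≤) (length-tableText T T≤))

  Small-rename : ∀ {N} m m′ → ∥ m′ ∥ ≤ N → ∀ {e} → Small N e → Small N (rename (m ↦ m′) e)
  Small-rename {N} m m′ m′≤ {node f ts ≐ s} (ts≤ , n≤ , s≤) =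
      args≤ ts ts≤ , n≤ , ↦-elim (λ s → ∥ s ∥ ≤ N) s s≤ m′≤
    where
    args≤ : ∀ {n} (ts : Vec Term n) → VAll (λ s → ∥ s ∥ ≤ N) ts →
        VAll (λ s → ∥ s ∥ ≤ N) (Vec.map (m ↦ m′) ts)
    args≤ [] [] = []
    args≤ (t ∷ ts) (t≤ ∷ ts≤) = ↦-elim (λ s → ∥ s ∥ ≤ N) t t≤ m′≤ ∷ args≤ ts ts≤

  Small-rhs : ∀ {N} e → Small N e → ∥ rhs e ∥ ≤ N
  Small-rhs (node _ _ ≐ _) (_ , _ , s≤) = s≤

  -- Invariant under merging, which keeps the number of entries and inserts only names of size at
  -- most N; so `L * entrySize N` bounds every intermediate text.
  Fitting : (B N L : ℕ) → Table → Set
  Fitting B N L T = All (Small N) T × length T ≡ L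

  module _ {B N L : ℕ} (N<B : suc N ≤ B) (L≤B : L ≤ B) (table≤B : L * entrySize N ≤ B) where

    fits : ∀ {T} → Fitting B N L T → FitsTable B T
    fits {T} (T≤ , refl) = ℕ.≤-trans (length-tableText T T≤) table≤B

    merge-loop : ∀ {T n U} → T ⟶[ n ] U → Fitting B N L T →
      B ⊢ on (# 2) is-just / mergeStep ∶ st i [] (mergeFrom (search T)) [] [] (tableText T) [] []
          (mergeTo (search T))
        ⇒[ n ] st i [] [] [] [] (tableText U) [] [] []
    merge-loop (done eq) _ rewrite eq = stop
    merge-loop {i = i} {T} (merge {m@(node _ _)} {m′} eq r) F@(T≤ , refl) with search-found T eq
    ... | e , e′ , e∈ , e′∈ , _ , m≡ , m′≡ rewrite eq =
      iter refl
        (replaceAll-spec m m′ T T≤ m′≤ N<B L≤B (fits F′) ⨟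
         sweep (λ z _ _ → st i [] z [] [] (tableText T′) [] [] (code m′)) (λ _ → refl) (λ _ → pop) (code m)
             {[]} {[]} (small m m≤) (everything _) refl ⨟
         sweep (λ z _ _ → st i [] [] [] [] (tableText T′) [] [] z) (λ _ → refl) (λ _ → pop) (code m′) {[]}
             {[]} (small m′ m′≤) (everything _) refl ⨟
         findConflict-spec T′ (fits F′))
        (merge-loop r F′)
      where
      T′ = map (rename (m ↦ m′)) T
      m≤ : ∥ m ∥ ≤ N
      m≤ = subst (λ s → ∥ s ∥ ≤ N) (≡.sym m≡) (Small-rhs e′ (All.lookup T≤ e′∈))
      m′≤ : ∥ m′ ∥ ≤ N
      m′≤ = subst (λ s → ∥ s ∥ ≤ N) (≡.sym m′≡) (Small-rhs e (All.lookup T≤ e∈))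
      small : ∀ s → ∥ s ∥ ≤ N → length (code s) ≤ B
      small s s≤ = subst (_≤ B) (≡.sym (length-code s)) (ℕ.≤-trans s≤ (ℕ.≤-trans (ℕ.n≤1+n N) N<B))
      F′ : Fitting B N (length T) T′
      F′ = All.map⁺ (All.map (λ {e} → Small-rename m m′ m′≤ {e}) T≤) , List.length-map _ T

    saturateTable-spec : ∀ {T n U} → T ⟶[ n ] U → n ≤ B → Fitting B N L T →
      B ⊢ saturateTable ∶ st i [] [] [] [] (tableText T) [] [] [] ⇒ st i [] [] [] [] (tableText U) [] [] []
    saturateTable-spec {T = T} r n≤ F = findConflict-spec T (fits F) ⨟ loop n≤ (merge-loop r F) refl

    ⟶-fitting : ∀ {T n U} → T ⟶[ n ] U → Fitting B N L T → Fitting B N L U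
    ⟶-fitting (done _) F = F
    ⟶-fitting {T} (merge {m} {m′} eq r) (T≤ , refl) with search-found T eq
    ... | e , e′ , e∈ , e′∈ , _ , m≡ , m′≡ =
      ⟶-fitting r (All.map⁺ (All.map (λ {d} → Small-rename m m′ m′≤ {d}) T≤) , List.length-map _ T)
      where
      m′≤ : ∥ m′ ∥ ≤ N
      m′≤ = subst (λ s → ∥ s ∥ ≤ N) (≡.sym m′≡) (Small-rhs e (All.lookup T≤ e∈))

  -- Evaluation by table lookup

  matchTop : Tops → Bool
  matchTop h = isBar (lookup h (# 5)) ∨ agree (lookup h (# 5)) (lookup h (# 0))

  -- Only the table side has bars to pass over. The term on stack 0 needs no end mark: a match that
  -- reaches `equals` has consumed exactly one term, codes being prefix-free.
  matchStep : Cmd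
  matchStep = cond (on (# 5) isBar) (mv (# 5) (# 4)) (mv (# 5) (# 4) ⨟ mv (# 0) (# 2))

  match-loop : ∀ k → All IsText k →
    B ⊢ matchTop / matchStep ∶ st (debar k ++ i) r y x o (k ++ t) u v w
      ⇒[ length k ] st i r (debar k ʳ++ y) x (k ʳ++ o) t u v w
  match-loop [] [] = stop
  match-loop (sym f ∷ k) (pf ∷ pk) = iter pf (cond-false refl ((emit ⨟ pop) ⨟ emit ⨟ pop)) (match-loop k pk)
  match-loop (bar ∷ k) (_ ∷ pk) = iter refl (cond-true refl (emit ⨟ pop)) (match-loop k pk)

  lookupTest : Tops → Bool
  lookupTest h = isEquals (lookup h (# 5)) ∧ is-nothing (lookup h (# 3))

  -- A letter on stack 3 records that an entry has already been applied.
  applyEntry : Cmd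
  applyEntry = emit (# 5) (# 3) (const (just end)) ⨟ while (on (# 2) is-just) (pop (# 2)) ⨟ mv (# 5) (# 4) ⨟
               while (on (# 5) isSym) (mv (# 5) (# 4)) ⨟
                   while (on (# 4) isSym) (emit (# 4) (# 0) id ⨟ mv (# 4) (# 5))

  unmatch : Cmd
  unmatch = while (on (# 2) is-just) (mv (# 2) (# 0))

  tryEntry : Cmd
  tryEntry = while matchTop matchStep ⨟ cond lookupTest applyEntry unmatch ⨟ finish

  unmatch-spec : ∀ c → length c ≤ B → B ⊢ unmatch ∶ st i r (c ʳ++ []) x o t u v w
      ⇒ st (c ++ i) r [] x o t u v w
  unmatch-spec {i = i} {r} {x} {o} {t} {u} {v} {w} c c≤ =
    sweepBack (λ z p _ → st p r z x o t u v w) (λ _ → refl) (λ _ → emit ⨟ pop) c {q = []} c≤ (everything c)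
        refl

  code≤key : ∀ k → ∥ k ∥ ≤ length (keyText k)
  code≤key (node f ts) = s≤s (subst (_≤ length (names ts)) (length-codes ts) (codes≤names ts))
    where
    codes≤names : ∀ {n} (ts : Vec Term n) → length (codes ts) ≤ length (names ts)
    codes≤names [] = z≤n
    codes≤names (t ∷ ts) = ℕ.≤-trans (append-mono (ℕ.+-monoʳ-≤ (length (code t)) (codes≤names ts)))
        (ℕ.n≤1+n _)
      where
      append-mono : length (code t) + length (codes ts) ≤ length (code t) + length (names ts) →
          length (code t ++ codes ts) ≤ length (code t ++ names ts)
      append-mono = ≡.subst₂ _≤_ (≡.sym (length-++ (code t))) (≡.sym (length-++ (code t)))

  match-key : ∀ k z v′ → FitsEntry B (k ≐ v′) → z ≡ k →
    B ⊢ while matchTop matchStep ∶ st (code z ++ i) r [] x o (entryText (k ≐ v′) ++ t) u v w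
      ⇒ st i r (code z ʳ++ []) x (keyText k ʳ++ o) (equals ∷ code v′ ++ end ∷ t) u v w
  match-key {B} {i} {r} {x} {o} {t} {u} {v} {w} k .k v′ fits refl
    rewrite entryText-++ k v′ t =
    subst (λ z → B ⊢ while matchTop matchStep ∶ st (z ++ i) r [] x o
        (keyText k ++ equals ∷ code v′ ++ end ∷ t) u v w
                       ⇒ st i r (z ʳ++ []) x (keyText k ʳ++ o) (equals ∷ code v′ ++ end ∷ t) u v w)
      (debar-keyText k) (loop (key-fits (k ≐ v′) fits) (match-loop (keyText k) (keyText-text k)) refl)

  -- Carries a position in the code of a key over to the text with bars. Bars just before the symbol
  -- go to the first part, because matching passes over them.
  debar-split : ∀ k {c f a} → All IsText k → debar k ≡ c ++ sym f ∷ a →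
      ∃[ k₁ ] ∃[ k₂ ] k ≡ k₁ ++ sym f ∷ k₂ × debar k₁ ≡ c
  debar-split [] {[]} _ ()
  debar-split [] {_ ∷ _} _ ()
  debar-split (bar ∷ k) {c} (_ ∷ pk) eq with debar-split k {c} pk eq
  ... | k₁ , k₂ , refl , eq′ = bar ∷ k₁ , k₂ , refl , eq′
  debar-split (sym g ∷ k) {[]} (_ ∷ pk) refl = [] , k , refl , refl
  debar-split (sym g ∷ k) {_ ∷ c} (_ ∷ pk) eq with ∷-injective eq
  ... | refl , eq₁ with debar-split k {c} pk eq₁
  ...   | k₁ , k₂ , refl , eq′ = sym g ∷ k₁ , k₂ , refl , ≡.cong (sym g ∷_) eq′

  differ : ∀ {p q} → p ≢ q → ∃[ c ] ∃[ f ] ∃[ g ] ∃[ a ] ∃[ b ] code p ≡ c ++ sym f ∷ a × code q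
      ≡ c ++ sym g ∷ b × f ≢ g
  differ {p} {q} p≢q with ≺-compare p q
  ... | tri≈ _ p≡q _ = contradiction p≡q p≢q
  ... | tri< p≺q _ _ with divergence p≺q
  ...   | c , f , g , a , b , eq , eq′ , f<g =
      c , f , g , a , b , eq , eq′ , λ { refl → ℕ.<-irrefl refl f<g }
  differ {p} {q} p≢q | tri> _ _ q≺p with divergence q≺p
  ... | c , g , f , b , a , eq′ , eq , g<f = c , f , g , a , b , eq , eq′ , λ { refl → ℕ.<-irrefl refl g<f }

  try-mismatch : ∀ e z → FitsEntry B e → lhs e ≢ z →
    B ⊢ tryEntry ∶ st (code z ++ i) r [] x o (entryText e ++ t) u v w
        ⇒ st (code z ++ i) r [] x (entryText e ʳ++ o) t u v w
  try-mismatch {B} {i} {r} {x} {o} {t} {u} {v} {w} e@(k ≐ s) z fits k≢z with differ k≢z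
  ... | c , f , g , a , b , k≡ , z≡ , f≢g with debar-split (keyText k) {c} (keyText-text k)
      (≡.trans (debar-keyText k) k≡)
  ...   | k₁ , k₂ , k-split , refl =
    subst (λ q → B ⊢ while matchTop matchStep ∶ st (code z ++ i) r [] x o q u v w
        ⇒ st (sym g ∷ b ++ i) r (reverse c) x (k₁ ʳ++ o) (t′ ++ end ∷ t) u v w)
      (≡.sym t-eq) (subst (λ q → B ⊢ while matchTop matchStep ∶ st q r [] x o (k₁ ++ t′ ++ end ∷ t) u v w
          ⇒ st (sym g ∷ b ++ i) r (reverse c) x (k₁ ʳ++ o) (t′ ++ end ∷ t) u v w)
        (≡.sym z-eq) (loop k₁≤ (match-loop k₁ k₁-text) (dec-false (f Fin.≟ g) f≢g))) ⨟
    cond-false refl (subst (λ q →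
        B ⊢ unmatch ∶ st (sym g ∷ b ++ i) r (reverse c) x (k₁ ʳ++ o) (t′ ++ end ∷ t) u v w
        ⇒ st q r [] x (k₁ ʳ++ o) (t′ ++ end ∷ t) u v w)
      (≡.sym z-eq) (unmatch-spec c c≤)) ⨟
    subst (λ q → B ⊢ finish ∶ st (code z ++ i) r [] x (k₁ ʳ++ o) (t′ ++ end ∷ t) u v w
        ⇒ st (code z ++ i) r [] x q t u v w)
      o-eq (finish-spec t′ t′≤ (All.++⁻ʳ k₁ (subst (All BeforeEnd) body-eq (entryBody-beforeEnd e))))
    where
    t′ : List Sym
    t′ = sym f ∷ k₂ ++ equals ∷ code s
    body-eq : entryBody e ≡ k₁ ++ t′
    body-eq = ≡.trans (≡.cong (_++ equals ∷ code s) k-split) (++-assoc k₁ (sym f ∷ k₂) _)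
    t-eq : entryText e ++ t ≡ k₁ ++ t′ ++ end ∷ t
    t-eq = ≡.trans (++-assoc (entryBody e) [ end ] t)
        (≡.trans (≡.cong (_++ end ∷ t) body-eq) (++-assoc k₁ t′ (end ∷ t)))
    z-eq : code z ++ i ≡ c ++ sym g ∷ b ++ i
    z-eq = ≡.trans (≡.cong (_++ i) z≡) (++-assoc c (sym g ∷ b) i)
    k₁≤ : length k₁ ≤ B
    k₁≤ = length-prefix k₁ (subst (λ q → length q ≤ B) k-split (key-fits e fits))
    k₁-text : All IsText k₁
    k₁-text = All.++⁻ˡ k₁ (subst (All IsText) k-split (keyText-text k))
    c≤ : length c ≤ B
    c≤ = length-prefix c (subst (λ q → length q ≤ B) k≡
        (subst (_≤ B) (≡.sym (length-code k)) (ℕ.≤-trans (code≤key k) (key-fits e fits))))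
    t′≤ : length t′ ≤ B
    t′≤ = length-suffix k₁ (subst (λ q → length q ≤ B) body-eq (body-fits e fits))
    o-eq : end ∷ t′ ʳ++ (k₁ ʳ++ o) ≡ entryText e ʳ++ o
    o-eq = ≡.trans (≡.cong (end ∷_) (≡.trans (≡.sym (++-ʳ++ k₁)) (≡.cong (_ʳ++ o) (≡.sym body-eq))))
        (≡.sym (++-ʳ++ (entryBody e)))

  code-fits : ∀ e → FitsEntry B e → length (code (lhs e)) ≤ B
  code-fits e h = subst (_≤ _) (≡.sym (length-code (lhs e))) (ℕ.≤-trans (code≤key (lhs e)) (key-fits e h))

  try-used : ∀ e z {a} → FitsEntry B e →
    B ⊢ tryEntry ∶ st (code z ++ i) r [] (a ∷ x) o (entryText e ++ t) u v w
        ⇒ st (code z ++ i) r [] (a ∷ x) (entryText e ʳ++ o) t u v w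
  try-used {B} {i} {r} {x} {o} {t} {u} {v} {w} e@(k ≐ s) z {a} fits with k ≟ z
  ... | no k≢z = try-mismatch e z fits k≢z
  ... | yes refl =
    match-key k k s fits refl ⨟ cond-false refl (unmatch-spec (code k) (code-fits e fits)) ⨟
    subst (λ q → B ⊢ finish ∶ st (code k ++ i) r [] (a ∷ x) (keyText k ʳ++ o) (equals ∷ code s ++ end ∷ t) u
        v w ⇒ st (code k ++ i) r [] (a ∷ x) q t u v w)
      (entryText-ʳ++ k s o)
      (finish-spec (equals ∷ code s) (length-suffix (keyText k) (body-fits e fits))
          (refl ∷ All.map (text-beforeEnd ∘ sym-text) (code-syms s)))

  try-match : ∀ e → FitsEntry B e →
    B ⊢ tryEntry ∶ st (code (lhs e) ++ i) r [] [] o (entryText e ++ t) u v w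
        ⇒ st (code (rhs e) ++ i) r [] [ end ] (entryText e ʳ++ o) t u v w
  try-match {B} {i} {r} {o} {t} {u} {v} {w} e@(k ≐ s) fits =
    match-key k k s fits refl ⨟
    cond-true refl (emit ⨟
      sweep (λ z _ _ → st i r z [ end ] (keyText k ʳ++ o) (equals ∷ code s ++ end ∷ t) u v w) (λ _ → refl)
          (λ _ → pop) (reverse (code k)) {[]} {[]}
        (subst (_≤ B) (≡.sym (List.length-reverse (code k))) (code-fits e fits)) (everything _) refl ⨟
      (emit ⨟ pop) ⨟ out ⨟
      sweepBack (λ z p q → st (q ++ i) r [] [ end ] (z ++ o₁) p u v w) id (λ _ → emit ⨟ emit ⨟ pop) (code s)
          (rhs-fits e fits) (code-syms s) refl) ⨟
    finish′
    where
    o₁ = equals ∷ keyText k ʳ++ o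
    out : B ⊢ _ ∶ st i r [] [ end ] o₁ (code s ++ end ∷ t) u v w
        ⇒ st i r [] [ end ] (reverse (code s) ++ o₁) (end ∷ t) u v w
    out = subst (λ q → B ⊢ _ ∶ st i r [] [ end ] o₁ (code s ++ end ∷ t) u v w
        ⇒ st i r [] [ end ] q (end ∷ t) u v w) (ʳ++-defn (code s))
            (sweep (λ z p _ → st i r [] [ end ] p (z ++ end ∷ t) u v w) id (λ _ → emit ⨟ pop) (code s)
                {q = []} (rhs-fits e fits) (code-syms s) refl)
    finish′ : B ⊢ finish ∶ st ((code s ++ []) ++ i) r [] [ end ] o₁ (code s ++ end ∷ t) u v w
        ⇒ st (code s ++ i) r [] [ end ] (entryText e ʳ++ o) t u v w
    finish′ = ≡.subst₂ (λ p q → B ⊢ finish ∶ st (p ++ i) r [] [ end ] o₁ (code s ++ end ∷ t) u v w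
        ⇒ st (code s ++ i) r [] [ end ] q t u v w)
                (≡.sym (++-identityʳ (code s))) (entryText-ʳ++ k s o)
                (finish-spec (code s) (rhs-fits e fits) (All.map (text-beforeEnd ∘ sym-text) (code-syms s)))

  used-loop : ∀ z T {a} → FitsTable B T →
    B ⊢ on (# 5) is-just / tryEntry ∶ st (code z ++ i) r [] (a ∷ x) o (tableText T) u v w
      ⇒[ length T ] st (code z ++ i) r [] (a ∷ x) (tableText T ʳ++ o) [] u v w
  used-loop z [] _ = stop
  used-loop {o = o} z (e@(node _ _ ≐ _) ∷ T) fits rewrite ++-ʳ++ (entryText e) {tableText T} {o} =
    iter refl (try-used e z (fits-head e T fits)) (used-loop z T (fits-tail e T fits))

  -- The flag `x` is empty or a single letter, so that one `pop` clears it in either case.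
  look-loop : ∀ k T → FitsTable B T → ∃[ x ] List.drop 1 x ≡ [] ×
    (B ⊢ on (# 5) is-just / tryEntry ∶ st (code k ++ i) r [] [] o (tableText T) u v w
      ⇒[ length T ] st (code (look T k) ++ i) r [] x (tableText T ʳ++ o) [] u v w)
  look-loop k [] _ = [] , refl , stop
  look-loop {o = o} k (e@(node f ts ≐ s) ∷ T) fits rewrite ++-ʳ++ (entryText e) {tableText T} {o} with node
      f ts ≟ k
  ... | yes refl = [ end ] , refl , iter refl (try-match e (fits-head e T fits))
      (used-loop s T (fits-tail e T fits))
  ... | no k≢ with look-loop k T (fits-tail e T fits)
  ...   | x , x≡ , l = x , x≡ , iter refl (try-mismatch e k (fits-head e T fits) k≢) l

  -- The arguments on stack 0 are already evaluated, so placing the symbol on top of them yields the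
  -- key to be looked up.
  normaliseStep : Cmd
  normaliseStep = mv (# 1) (# 0) ⨟ while (on (# 5) is-just) tryEntry ⨟ rewind ⨟ pop (# 3)

  normaliseStep-spec : ∀ T → FitsTable B T → ∀ f ts →
    B ⊢ normaliseStep ∶ st (codes ts ++ i) (sym f ∷ r) [] [] [] (tableText T) u v w
        ⇒ st (code (look T (node f ts)) ++ i) r [] [] [] (tableText T) u v w
  normaliseStep-spec {B} {i} {r} {u} {v} {w} T fits f ts with look-loop (node f ts) T fits
  ... | x , x≡ , l =
    (emit ⨟ pop) ⨟ loop (fits-length T fits) l refl ⨟ rewind-spec (tableText T) fits ⨟
    subst (λ q → B ⊢ pop (# 3) ∶ st N r [] x [] (tableText T) u v w
        ⇒ st N r [] q [] (tableText T) u v w) x≡ pop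
    where N = code (look T (node f ts)) ++ i

  normalise-term : ∀ T → FitsTable B T → ∀ s →
    B ⊢ on (# 1) is-just / normaliseStep ∶ st i (code s ʳ++ r) [] [] [] (tableText T) u v w
      ⇒[ ∥ s ∥ ] st (code (nf T s) ++ i) r [] [] [] (tableText T) u v w
  normalise-terms : ∀ T → FitsTable B T → ∀ {n} (ss : Vec Term n) →
    B ⊢ on (# 1) is-just / normaliseStep ∶ st i (codes ss ʳ++ r) [] [] [] (tableText T) u v w
      ⇒[ ∥ ss ∥* ] st (codes (nfs T ss) ++ i) r [] [] [] (tableText T) u v w
  normalise-term T fits (node f ss) =
    iterations (ℕ.+-comm ∥ ss ∥* 1)
        (normalise-terms T fits ss ⊹ iter refl (normaliseStep-spec T fits f (nfs T ss)) stop)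
  normalise-terms T fits [] = stop
  normalise-terms {i = i} {r} T fits (s ∷ ss)
    rewrite ++-ʳ++ (code s) {codes ss} {r} | ++-assoc (code (nf T s)) (codes (nfs T ss)) i =
    iterations (ℕ.+-comm ∥ ss ∥* ∥ s ∥) (normalise-terms T fits ss ⊹ normalise-term T fits s)

  normalise : Cmd
  normalise = while (on (# 0) is-just) (mv (# 0) (# 1)) ⨟ while (on (# 1) is-just) normaliseStep

  normalise-spec : ∀ T s → FitsTable B T → ∥ s ∥ ≤ B →
    B ⊢ normalise ∶ st (code s) [] [] [] [] (tableText T) u v w
        ⇒ st (code (nf T s)) [] [] [] [] (tableText T) u v w
  normalise-spec {B} {u} {v} {w} T s fits s≤ =
    sweep (λ z p _ → st z p [] [] [] (tableText T) u v w) (λ _ → refl) (λ _ → emit ⨟ pop) (code s) {q = []}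
      (subst (_≤ B) (≡.sym (length-code s)) s≤) (everything _) refl ⨟
    subst (λ z → B ⊢ while (on (# 1) is-just) normaliseStep ∶ st [] (reverse (code s)) [] [] []
        (tableText T) u v w ⇒ st z [] [] [] [] (tableText T) u v w)
      (++-identityʳ _) (loop s≤ (normalise-term T fits s) refl)

  program : Cmd
  program = prepare ⨟ saturateTable ⨟ normalise

  -- Size estimates and the common loop bound

  length-subterms  : ∀ t → length (subterms t) ≡ ∥ t ∥
  length-subterms* : ∀ {n} (ts : Vec Term n) → length (subterms* ts) ≡ ∥ ts ∥*
  length-subterms (node f ts) =
    ≡.trans (length-++ (subterms* ts)) (≡.trans (ℕ.+-comm _ 1) (≡.cong suc (length-subterms* ts)))
  length-subterms* [] = refl
  length-subterms* (t ∷ ts) = ≡.trans (length-++ (subterms* ts))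
    (≡.trans (ℕ.+-comm (length (subterms* ts)) _) (≡.cong₂ _+_ (length-subterms t) (length-subterms* ts)))

  length-entries : ∀ e → length (entries e) ≡ ∥ lhs e ∥ + ∥ rhs e ∥
  length-entries (node f ps ≐ q) = begin
    length (subterms q ++ subterms* ps ++ [ node f ps ≐ q ])
      ≡⟨ ≡.trans (length-++ (subterms q)) (≡.cong₂ _+_ (length-subterms q) (length-++ (subterms* ps))) ⟩
    ∥ q ∥ + (length (subterms* ps) + 1) ≡⟨ ≡.cong (∥ q ∥ +_)
        (≡.trans (ℕ.+-comm _ 1) (≡.cong suc (length-subterms* ps))) ⟩
    ∥ q ∥ + suc ∥ ps ∥*                 ≡⟨ ℕ.+-comm ∥ q ∥ _ ⟩
    suc ∥ ps ∥* + ∥ q ∥                 ∎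
    where open ≡-Reasoning

  length-table : ∀ Γ → length (table Γ) ≡ sizeEqs Γ
  length-table [] = refl
  length-table (e ∷ Γ) = ≡.trans (length-++ (table Γ))
    (≡.trans (ℕ.+-comm (length (table Γ)) _) (≡.cong₂ _+_ (length-entries e) (length-table Γ)))

  Sized : ℕ → Equation → Set
  Sized N e = ∥ lhs e ∥ ≤ N × ∥ rhs e ∥ ≤ N

  sized-small : ∀ {N} e → Sized N e → Small N e
  sized-small {N} (node f ts ≐ s) (k≤ , s≤) =
    args≤ ts ts≤ , ℕ.≤-trans (count ts) ts≤ , s≤
    where
    ts≤ = ℕ.≤-trans (ℕ.n≤1+n _) k≤
    args≤ : ∀ {n} (ts : Vec Term n) → ∥ ts ∥* ≤ N → VAll (λ t → ∥ t ∥ ≤ N) ts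
    args≤ [] _ = []
    args≤ (t ∷ ts) h = ℕ.m+n≤o⇒m≤o ∥ t ∥ h ∷ args≤ ts (ℕ.m+n≤o⇒n≤o ∥ t ∥ h)
    count : ∀ {n} (ts : Vec Term n) → n ≤ ∥ ts ∥*
    count [] = z≤n
    count (node _ ss ∷ ts) = s≤s (ℕ.≤-trans (count ts) (ℕ.m≤n+m _ ∥ ss ∥*))

  subterms-sized  : ∀ {N} t → ∥ t ∥ ≤ N → All (Sized N) (subterms t)
  subterms*-sized : ∀ {N n} (ts : Vec Term n) → ∥ ts ∥* ≤ N → All (Sized N) (subterms* ts)
  subterms-sized (node f ts) h = All.++⁺ (subterms*-sized ts (ℕ.≤-trans (ℕ.n≤1+n _) h)) ((h , h) ∷ [])
  subterms*-sized [] _ = []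
  subterms*-sized (t ∷ ts) h = All.++⁺ (subterms*-sized ts (ℕ.m+n≤o⇒n≤o ∥ t ∥ h))
      (subterms-sized t (ℕ.m+n≤o⇒m≤o ∥ t ∥ h))

  entries-sized : ∀ {N} e → ∥ lhs e ∥ + ∥ rhs e ∥ ≤ N → All (Sized N) (entries e)
  entries-sized (node f ps ≐ q) h =
    All.++⁺ (subterms-sized q q≤) (All.++⁺ (subterms*-sized ps (ℕ.≤-trans (ℕ.n≤1+n _) p≤)) ((p≤ , q≤) ∷ []))
    where
    p≤ = ℕ.m+n≤o⇒m≤o (suc ∥ ps ∥*) h
    q≤ = ℕ.m+n≤o⇒n≤o (suc ∥ ps ∥*) h

  table-sized : ∀ {N} Γ → sizeEqs Γ ≤ N → All (Sized N) (table Γ)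
  table-sized [] _ = []
  table-sized (e ∷ Γ) h =
    All.++⁺ (table-sized Γ (ℕ.m+n≤o⇒n≤o (∥ lhs e ∥ + ∥ rhs e ∥) h))
        (entries-sized e (ℕ.m+n≤o⇒m≤o (∥ lhs e ∥ + ∥ rhs e ∥) h))

  -- The two separators of an equation are paid for by its two sides, each of which has a node.
  length-equationsText : ∀ Γ → length (equationsText Γ) ≤ sizeEqs Γ + sizeEqs Γ
  length-equationsText [] = z≤n
  length-equationsText (e@(node _ ps ≐ node _ qs) ∷ Γ) = begin
    length (eqText e ++ equationsText Γ)            ≡⟨ length-++ (eqText e) ⟩
    length (eqText e) + length (equationsText Γ)    ≤⟨ ℕ.+-mono-≤ equation (length-equationsText Γ) ⟩
    (E + E) + (sizeEqs Γ + sizeEqs Γ)               ≡⟨ interchange ℕ.+-commutativeSemigroup E E (sizeEqs Γ)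
        (sizeEqs Γ) ⟩
    (E + sizeEqs Γ) + (E + sizeEqs Γ)               ∎
    where
    open ℕ.≤-Reasoning hiding (equals)
    E = ∥ lhs e ∥ + ∥ rhs e ∥
    equation : length (eqText e) ≤ E + E
    equation = begin
      length (eqText e)                       ≡⟨ length-eqText e ⟩
      suc (∥ rhs e ∥ + suc ∥ lhs e ∥)         ≡⟨ ≡.cong suc (ℕ.+-comm ∥ rhs e ∥ (suc ∥ lhs e ∥)) ⟩
      2 + E                                   ≤⟨ ℕ.+-monoˡ-≤ E
          (s≤s (subst (1 ≤_) (≡.sym (ℕ.+-suc ∥ ps ∥* ∥ qs ∥*)) (s≤s z≤n))) ⟩
      E + E                                   ∎

  -- The linear part covers loops over the input, `n * entrySize n` those over a table text, and
  -- `n * n` the number of merges.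
  loopBound : ℕ → ℕ
  loopBound n = suc (n + n) + (n * entrySize n + n * n)

  module _ where
    open Polynomials

    loopBound-poly : PolyBounded loopBound
    loopBound-poly = (constᵖ 1 +ᵖ (idᵖ +ᵖ idᵖ)) +ᵖ
      ((idᵖ *ᵖ (constᵖ 3 +ᵖ ((idᵖ *ᵖ (constᵖ 1 +ᵖ idᵖ)) +ᵖ idᵖ))) +ᵖ (idᵖ *ᵖ idᵖ))

  program-spec : ∀ Γ s → ∃[ σ ] loopBound (sizeInput (Γ , s)) ⊢ program ∶
    st (equationsText Γ ++ code s) [] [] [] [] [] [] [] [] ⇒ (code (rep Γ s) ∷ σ)
  program-spec Γ s =
    _ , (prepare-spec Γ s (equations-fit Γ ℕ.≤-refl) input≤ (fits N<K L≤K table≤K F) ⨟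
         saturateTable-spec N<K L≤K table≤K run steps≤ F ⨟
         normalise-spec (saturated Γ) s (fits N<K L≤K table≤K (⟶-fitting N<K L≤K table≤K run F)) s≤)
    where
    n = sizeInput (Γ , s)
    N = sizeEqs Γ
    K = loopBound n
    run = proj₂ (proj₂ (proj₂ (saturate (table Γ))))
    N≤n : N ≤ n
    N≤n = ℕ.m≤m+n N ∥ s ∥
    linear : ∀ {m} → m ≤ suc (n + n) → m ≤ K
    linear h = ℕ.≤-trans h (ℕ.m≤m+n _ _)
    n≤ : n ≤ suc (n + n)
    n≤ = ℕ.≤-trans (ℕ.m≤m+n n n) (ℕ.n≤1+n _)
    L≤K : N ≤ K
    L≤K = linear (ℕ.≤-trans N≤n n≤)
    N<K : suc N ≤ K
    N<K = linear (s≤s (ℕ.≤-trans N≤n (ℕ.m≤m+n n n)))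
    s≤ : ∥ s ∥ ≤ K
    s≤ = linear (ℕ.≤-trans (ℕ.m≤n+m ∥ s ∥ N) n≤)
    table≤K : N * entrySize N ≤ K
    table≤K = ℕ.≤-trans (ℕ.*-mono-≤ N≤n (s≤s (s≤s (s≤s (ℕ.+-mono-≤ (ℕ.*-mono-≤ N≤n (s≤s N≤n)) N≤n)))))
                (ℕ.≤-trans (ℕ.m≤m+n _ (n * n)) (ℕ.m≤n+m _ (suc (n + n))))
    steps≤ : proj₁ (proj₂ (saturate (table Γ))) ≤ K
    steps≤ = ℕ.≤-trans (proj₁ (proj₂ (proj₂ (saturate (table Γ)))))
               (ℕ.≤-trans (subst (λ l → l * l ≤ n * n) (≡.sym (length-table Γ)) (ℕ.*-mono-≤ N≤n N≤n))
                 (ℕ.≤-trans (ℕ.m≤n+m _ (n * entrySize n)) (ℕ.m≤n+m _ (suc (n + n)))))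
    F : Fitting K N N (table Γ)
    F = All.map (λ {e} → sized-small e) (table-sized Γ ℕ.≤-refl) , length-table Γ
    equations-fit : ∀ Δ → sizeEqs Δ ≤ N → All (FitsEq K) Δ
    equations-fit [] _ = []
    equations-fit (e ∷ Δ) h =
      linear (subst (_≤ suc (n + n)) (≡.sym (ℕ.+-suc ∥ lhs e ∥ ∥ rhs e ∥))
        (s≤s (ℕ.≤-trans (ℕ.m+n≤o⇒m≤o (∥ lhs e ∥ + ∥ rhs e ∥) h) (ℕ.≤-trans N≤n (ℕ.m≤m+n n n))))) ∷
      equations-fit Δ (ℕ.m+n≤o⇒n≤o (∥ lhs e ∥ + ∥ rhs e ∥) h)
    input≤ : length (equationsText Γ) + ∥ s ∥ ≤ K
    input≤ = linear (ℕ.≤-trans (ℕ.+-monoˡ-≤ ∥ s ∥ (length-equationsText Γ))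
      (ℕ.≤-trans (ℕ.≤-reflexive (ℕ.+-assoc N N ∥ s ∥)) (ℕ.≤-trans (ℕ.+-monoˡ-≤ n N≤n) (ℕ.n≤1+n _))))

  -- The machine has the additional letter `bar`, which occurs in neither input nor output.
  letter : Letter → Sym
  letter (symbol f) = sym f
  letter equalsᴸ = equals
  letter endᴸ = end

  letter-injective : ∀ {a b} → letter a ≡ letter b → a ≡ b
  letter-injective {symbol _} {symbol _} refl = refl
  letter-injective {symbol _} {equalsᴸ} ()
  letter-injective {symbol _} {endᴸ} ()
  letter-injective {equalsᴸ} {symbol _} ()
  letter-injective {equalsᴸ} {equalsᴸ} _ = refl
  letter-injective {equalsᴸ} {endᴸ} ()
  letter-injective {endᴸ} {symbol _} ()
  letter-injective {endᴸ} {equalsᴸ} ()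
  letter-injective {endᴸ} {endᴸ} _ = refl

  letters-term  : ∀ t → map letter (encodeTerm t) ≡ code t
  letters-terms : ∀ {n} (ts : Vec Term n) → map letter (encodeTerms ts) ≡ codes ts
  letters-term (node f ts) = ≡.cong (sym f ∷_) (letters-terms ts)
  letters-terms [] = refl
  letters-terms (t ∷ ts) = ≡.trans (List.map-++ letter (encodeTerm t) _)
      (≡.cong₂ _++_ (letters-term t) (letters-terms ts))

  letters-equation : ∀ e → map letter (encodeEquation e) ≡ eqText e
  letters-equation (p ≐ q) = ≡.trans (List.map-++ letter (encodeTerm p) _)
    (≡.cong₂ (λ a b → a ++ equals ∷ b) (letters-term p)
      (≡.trans (List.map-++ letter (encodeTerm q) _) (≡.cong (_++ [ end ]) (letters-term q))))

  letters-equations : ∀ Γ → map letter (concatMap encodeEquation Γ) ≡ equationsText Γ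
  letters-equations [] = refl
  letters-equations (e ∷ Γ) = ≡.trans (List.map-++ letter (encodeEquation e) _)
      (≡.cong₂ _++_ (letters-equation e) (letters-equations Γ))

  letters-input : ∀ Γ s → map letter (encodeInput (Γ , s)) ≡ equationsText Γ ++ code s
  letters-input Γ s = ≡.trans (List.map-++ letter (concatMap encodeEquation Γ) _)
      (≡.cong₂ _++_ (letters-equations Γ) (letters-term s))

  rep-computable : PolyTimeComputable sizeInput encodeInput encodeTerm (uncurry rep)
  rep-computable = Computation.computable (symbols + 3 , ↔-sym Fin.+↔⊎) (mk↣ letter-injective) 8
      {encY = encodeTerm} {f = uncurry rep}
    program loopBound-poly λ (Γ , s) → let σ , d = program-spec Γ s in σ ,
      ≡.subst₂ (λ x y → loopBound (sizeInput (Γ , s)) ⊢ program ∶ (x ∷ Vec.replicate 8 []) ⇒ (y ∷ σ))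
        (≡.sym (letters-input Γ s)) (≡.sym (letters-term (rep Γ s))) d


theorem3p4 : (Sig : Signature) → let open Ground Sig in
    Σ[ rep ∈ (List Equation → Term → Term) ]
    PolyTimeComputable sizeInput encodeInput encodeTerm (uncurry rep)
    × (∀ {Γ Δ} → Γ ∼[ set ] Δ → ∀ t → rep Γ t ≡ rep Δ t)
    × (∀ Γ p → Γ ⊢ p ∼ rep Γ p)
    × (∀ Γ p q → Γ ⊢ p ∼ q ⇔ rep Γ p ≡ rep Γ q)
theorem3p4 Sig = rep , Program.rep-computable Sig , rep-set , Representative.nf-sound , Representative.nf-⇔
  where open Closure Sig
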